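{- For every integer $m\ge 1$, $$\sum_{n=1}^\infty \frac{H_n^2}{n^{2m}}(-1)^{n-1} = -\zeta^\star(\overline{2m},2)-(2m+1)\zeta^\star(\overline{2m+1},1)-\zeta^\star(2m+1,1)-\zeta(2)\bar\zeta(2m)-2\sum_{l=2}^m \zeta^\star(2l-1,1)\,\bar\zeta(2m+2-2l),$$ and $$\begin{aligned}\sum_{n=1}^\infty \frac{H_nL_n(1)}{n^{2m}}(-1)^{n-1} &= \sum_{l=1}^{m-1}\zeta^\star(2l,1)\,\bar\zeta(2m+1-2l)-\ln 2\,\zeta^\star(\overline{2m},1)+\ln 2\,\zeta^\star(2m,1)+\frac12\zeta^\star(2m+1,1)\\ &\quad+\zeta^\star(\overline{2m},2)+\frac{2m-1}{2}\zeta^\star(\overline{2m+1},1)-\frac12\zeta(2)\bar\zeta(2m).\end{aligned}$$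
   Context: For integers $n,k\ge1$: $H_n=\sum_{j=1}^n \frac1j$, $L_n(k)=\sum_{j=1}^n \frac{(-1)^{j-1}}{j^k}$. $\zeta$ is the Riemann zeta function and $\bar\zeta(s)=\sum_{n=1}^\infty \frac{(-1)^{n-1}}{n^s}$ for $\Re(s)\ge 1$ (so $\bar\zeta(1)=\ln 2$). Multiple zeta-star values: for positive integers $s_1,\dots,s_k$, each possibly carrying a bar, $\zeta^\star(s_1,\dots,s_k)=\sum_{n_1\ge n_2\ge\cdots\ge n_k\ge1}\prod_{j=1}^k \frac{\varepsilon_j^{n_j}}{n_j^{s_j}}$, where $\varepsilon_j=-1$ if $s_j$ is barred and $\varepsilon_j=1$ otherwise; the series is read as the sum over $n_1$ of the finite inner sums. For instance $\zeta^\star(\bar q,p)=\sum_{m\ge1}\frac{(-1)^m}{m^q}\sum_{n=1}^m\frac1{n^p}$. Empty sums are zero. -}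

module Defs where

open import Data.Nat as ℕ using (ℕ; zero; suc; z≤n; s≤s)
import Data.Nat.Properties as ℕ
open import Data.Integer as ℤ using (ℤ; +_; 1ℤ; -1ℤ)
import Data.Integer.Properties as ℤ
open import Data.Rational
  using (ℚ; mkℚ; 0ℚ; 1ℚ; ½; _+_; _*_; -_; _-_; _/_; 1/_; ∣_∣; _≤_; _<_; *<*; toℚᵘ;
         Positive; positive; nonNegative)
import Data.Rational.Properties as ℚ
open import Data.Rational.Solver using (module +-*-Solver)
open import Data.Rational.Unnormalised as ℚᵘ using (mkℚᵘ; *≡*; *≤*)
import Data.Rational.Unnormalised.Properties as ℚᵘ
open import Data.Empty using (⊥)
open import Data.List using (List; []; _∷_; length; foldr; map; applyUpTo)
open import Data.List.Relation.Unary.All using (All; []; _∷_; all?)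
open import Data.Product using (∃; _×_; _,_; proj₁; proj₂)
open import Relation.Binary.PropositionalEquality
open import Relation.Nullary using (Dec; yes; no; _×-dec_)

-- A sequence of rationals indexed by n ≥ 1.
Term : Set
Term = (n : ℕ) → .{{ℕ.NonZero n}} → ℚ

-- ∑ f N = f 1 + ⋯ + f N
∑ : Term → ℕ → ℚ
∑ f zero    = 0ℚ
∑ f (suc N) = ∑ f N + f (suc N)

Cauchy : (ℕ → ℚ) → Set
Cauchy x = ∀ ε → 0ℚ < ε →
  ∃ λ N → ∀ m n → N ℕ.≤ m → N ℕ.≤ n → ∣ x m - x n ∣ < ε

-- Real numbers are Cauchy sequences of rationals, with equality _≃_.
record ℝ : Set where
  constructor real
  field
    seq    : ℕ → ℚ
    cauchy : Cauchy seq

open ℝ public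

infix 4 _≃_ _sumsTo_

_≃_ : ℝ → ℝ → Set
x ≃ y = ∀ ε → 0ℚ < ε → ∃ λ N → ∀ n → N ℕ.≤ n → ∣ seq x n - seq y n ∣ < ε

-- The series f 1 + f 2 + ⋯ converges to x: for every rational ε > 0, all
-- late partial sums lie within ε of all late rational approximations of x.
_sumsTo_ : Term → ℝ → Set
f sumsTo x = ∀ ε → 0ℚ < ε →
  ∃ λ N → ∀ n k → N ℕ.≤ n → N ℕ.≤ k → ∣ ∑ f n - seq x k ∣ < ε

module Sequences where
  open +-*-Solver using (solve; _:=_; _:+_; _:*_; _:-_; :-_; con)

  0≤⇒∣∣ : ∀ {p} → 0ℚ ≤ p → ∣ p ∣ ≡ p
  0≤⇒∣∣ = ℚ.0≤p⇒∣p∣≡p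

  *-monoˡ : ∀ {c a b} → 0ℚ ≤ c → a ≤ b → c * a ≤ c * b
  *-monoˡ {c} 0≤c = ℚ.*-monoˡ-≤-nonNeg c {{nonNegative 0≤c}}

  *-monoʳ : ∀ {c a b} → 0ℚ ≤ c → a ≤ b → a * c ≤ b * c
  *-monoʳ {c} 0≤c = ℚ.*-monoʳ-≤-nonNeg c {{nonNegative 0≤c}}

  *-mono : ∀ {a b c d} → 0ℚ ≤ a → 0ℚ ≤ d → a ≤ b → c ≤ d → a * c ≤ b * d
  *-mono 0≤a 0≤d a≤b c≤d = ℚ.≤-trans (*-monoˡ 0≤a c≤d) (*-monoʳ 0≤d a≤b)

  0≤* : ∀ {a b} → 0ℚ ≤ a → 0ℚ ≤ b → 0ℚ ≤ a * b
  0≤* {a} {b} 0≤a 0≤b = subst (_≤ a * b) (ℚ.*-zeroʳ a) (*-monoˡ 0≤a 0≤b)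

  0≤+ : ∀ {a b} → 0ℚ ≤ a → 0ℚ ≤ b → 0ℚ ≤ a + b
  0≤+ = ℚ.+-mono-≤

  0<* : ∀ {a b} → 0ℚ < a → 0ℚ < b → 0ℚ < a * b
  0<* {a} {b} 0<a 0<b =
    subst (_< a * b) (ℚ.*-zeroʳ a) (ℚ.*-monoʳ-<-pos a {{positive 0<a}} 0<b)

  0<½ : 0ℚ < ½
  0<½ = ℚ.positive⁻¹ ½

  0<1 : 0ℚ < 1ℚ
  0<1 = ℚ.positive⁻¹ 1ℚ

  0<½* : ∀ {ε} → 0ℚ < ε → 0ℚ < ½ * ε
  0<½* = 0<* 0<½

  halves : ∀ ε → ½ * ε + ½ * ε ≡ ε
  halves = solve 1 (λ e → con ½ :* e :+ con ½ :* e := e) refl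

  triangle : ∀ a b c → ∣ a - c ∣ ≤ ∣ a - b ∣ + ∣ b - c ∣
  triangle a b c = subst (λ t → ∣ t ∣ ≤ ∣ a - b ∣ + ∣ b - c ∣)
    (solve 3 (λ a b c → (a :- b) :+ (b :- c) := a :- c) refl a b c)
    (ℚ.∣p+q∣≤∣p∣+∣q∣ (a - b) (b - c))

  swap-∣-∣ : ∀ a b → ∣ a - b ∣ ≡ ∣ b - a ∣
  swap-∣-∣ a b = trans (sym (ℚ.∣-p∣≡∣p∣ (a - b)))
    (cong ∣_∣ (solve 2 (λ a b → :- (a :- b) := b :- a) refl a b))

  a≤a+b : ∀ {a b} → 0ℚ ≤ b → a ≤ a + b
  a≤a+b {a} {b} 0≤b = subst (_≤ a + b) (ℚ.+-identityʳ a) (ℚ.+-monoʳ-≤ a 0≤b)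

  a≤b+a : ∀ {a b} → 0ℚ ≤ b → a ≤ b + a
  a≤b+a {a} {b} 0≤b = subst (a ≤_) (ℚ.+-comm a b) (a≤a+b 0≤b)

  a-b≤a : ∀ {a b} → 0ℚ ≤ b → a - b ≤ a
  a-b≤a {a} {b} 0≤b =
    subst (a - b ≤_) (ℚ.+-identityʳ a) (ℚ.+-monoʳ-≤ a (ℚ.neg-antimono-≤ 0≤b))

  inverse : ∀ {K} → 0ℚ < K → ∃ λ δ → 0ℚ < δ × K * δ ≡ 1ℚ
  inverse {K} 0<K = 1/ K , ℚ.positive⁻¹ (1/ K) {{ℚ.1/pos⇒pos K}} , ℚ.*-inverseʳ K
    where instance
      pos : Positive K
      pos = positive 0<K
      K≢0 = ℚ.pos⇒nonZero K

  0<∣∣+1 : ∀ c → 0ℚ < ∣ c ∣ + 1ℚ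
  0<∣∣+1 c = ℚ.<-≤-trans 0<1 (a≤b+a (ℚ.0≤∣p∣ c))

  Null : (ℕ → ℚ) → Set
  Null x = ∀ ε → 0ℚ < ε → ∃ λ N → ∀ n → N ℕ.≤ n → ∣ x n ∣ < ε

  null-dominated : ∀ {x y} → (∀ n → ∣ y n ∣ ≤ ∣ x n ∣) → Null x → Null y
  null-dominated h nx ε 0<ε with nx ε 0<ε
  ... | N , p = N , λ n N≤n → ℚ.≤-<-trans (h n) (p n N≤n)

  null-+ : ∀ {x y} → Null x → Null y → Null (λ n → x n + y n)
  null-+ {x} {y} nx ny ε 0<ε with nx (½ * ε) (0<½* 0<ε) | ny (½ * ε) (0<½* 0<ε)
  ... | N , p | M , q = N ℕ.+ M , λ n h →
    subst (∣ x n + y n ∣ <_) (halves ε)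
      (ℚ.≤-<-trans (ℚ.∣p+q∣≤∣p∣+∣q∣ (x n) (y n))
        (ℚ.+-mono-< (p n (ℕ.≤-trans (ℕ.m≤m+n N M) h)) (q n (ℕ.≤-trans (ℕ.m≤n+m M N) h))))

  null-scale : ∀ c {x} → Null x → Null (λ n → c * x n)
  null-scale c {x} nx ε 0<ε with inverse (0<∣∣+1 c)
  ... | δ , 0<δ , Kδ≡1 with nx (δ * ε) (0<* 0<δ 0<ε)
  ... | N , p = N , λ n N≤n → begin-strict
    ∣ c * x n ∣              ≡⟨ ℚ.∣p*q∣≡∣p∣*∣q∣ c (x n) ⟩
    ∣ c ∣ * ∣ x n ∣          ≤⟨ *-monoʳ (ℚ.0≤∣p∣ (x n)) (a≤a+b {∣ c ∣} (ℚ.<⇒≤ 0<1)) ⟩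
    (∣ c ∣ + 1ℚ) * ∣ x n ∣   <⟨ ℚ.*-monoʳ-<-pos (∣ c ∣ + 1ℚ) {{positive (0<∣∣+1 c)}} (p n N≤n) ⟩
    (∣ c ∣ + 1ℚ) * (δ * ε)   ≡⟨ sym (ℚ.*-assoc (∣ c ∣ + 1ℚ) δ ε) ⟩
    (∣ c ∣ + 1ℚ) * δ * ε     ≡⟨ cong (_* ε) Kδ≡1 ⟩
    1ℚ * ε                   ≡⟨ ℚ.*-identityˡ ε ⟩
    ε ∎
    where open ℚ.≤-Reasoning

  null⇒cauchy : ∀ {x} → Null x → Cauchy x
  null⇒cauchy {x} nx ε 0<ε with nx (½ * ε) (0<½* 0<ε)
  ... | N , p = N , λ m n N≤m N≤n → subst (∣ x m - x n ∣ <_) (halves ε)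
    (ℚ.≤-<-trans (ℚ.∣p-q∣≤∣p∣+∣q∣ (x m) (x n)) (ℚ.+-mono-< (p m N≤m) (p n N≤n)))

  cauchy-resp : ∀ {x y} → (∀ n → x n ≡ y n) → Cauchy x → Cauchy y
  cauchy-resp eq cx ε 0<ε with cx ε 0<ε
  ... | N , p = N , λ m n N≤m N≤n →
    subst₂ (λ a b → ∣ a - b ∣ < ε) (eq m) (eq n) (p m n N≤m N≤n)

  cauchy-const : ∀ q → Cauchy (λ _ → q)
  cauchy-const q ε 0<ε = 0 , λ _ _ _ _ →
    subst (_< ε) (sym (cong ∣_∣ (ℚ.+-inverseʳ q))) 0<ε

  cauchy-neg : ∀ {x} → Cauchy x → Cauchy (λ n → - x n)
  cauchy-neg {x} cx ε 0<ε with cx ε 0<ε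
  ... | N , p = N , λ m n N≤m N≤n → subst (_< ε)
    (trans (swap-∣-∣ (x m) (x n))
      (cong ∣_∣ (solve 2 (λ a b → b :- a := (:- a) :- (:- b)) refl (x m) (x n))))
    (p m n N≤m N≤n)

  cauchy-+ : ∀ {x y} → Cauchy x → Cauchy y → Cauchy (λ n → x n + y n)
  cauchy-+ {x} {y} cx cy ε 0<ε with cx (½ * ε) (0<½* 0<ε) | cy (½ * ε) (0<½* 0<ε)
  ... | N , p | M , q = N ℕ.+ M , λ m n h k → subst₂ _<_
      (cong ∣_∣ {(x m - x n) + (y m - y n)}
        (solve 4 (λ a b c d → (a :- b) :+ (c :- d) := (a :+ c) :- (b :+ d)) refl
          (x m) (x n) (y m) (y n)))
      (halves ε)
      (ℚ.≤-<-trans (ℚ.∣p+q∣≤∣p∣+∣q∣ (x m - x n) (y m - y n))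
        (ℚ.+-mono-< (p m n (l h) (l k)) (q m n (r h) (r k))))
    where
      l : ∀ {i} → N ℕ.+ M ℕ.≤ i → N ℕ.≤ i
      l = ℕ.≤-trans (ℕ.m≤m+n N M)
      r : ∀ {i} → N ℕ.+ M ℕ.≤ i → M ℕ.≤ i
      r = ℕ.≤-trans (ℕ.m≤n+m M N)

  cauchy-bounded : ∀ {x} → Cauchy x →
    ∃ λ K → 0ℚ < K × (∃ λ N → ∀ n → N ℕ.≤ n → ∣ x n ∣ ≤ K)
  cauchy-bounded {x} cx with cx 1ℚ 0<1
  ... | N , p = ∣ x N ∣ + 1ℚ , 0<∣∣+1 (x N) , N , λ n N≤n → begin
    ∣ x n ∣                    ≡⟨ cong ∣_∣ (solve 2 (λ a b → a := b :+ (a :- b)) refl (x n) (x N)) ⟩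
    ∣ x N + (x n - x N) ∣      ≤⟨ ℚ.∣p+q∣≤∣p∣+∣q∣ (x N) (x n - x N) ⟩
    ∣ x N ∣ + ∣ x n - x N ∣    ≤⟨ ℚ.+-monoʳ-≤ ∣ x N ∣ (ℚ.<⇒≤ (p n N N≤n ℕ.≤-refl)) ⟩
    ∣ x N ∣ + 1ℚ ∎
    where open ℚ.≤-Reasoning

  product-estimate : ∀ {K L} a b c d {α β} → 0ℚ < K → 0ℚ < L → ∣ a ∣ ≤ K → ∣ d ∣ ≤ L →
    ∣ b - d ∣ < β → ∣ a - c ∣ < α → ∣ a * b - c * d ∣ < K * β + L * α
  product-estimate {K} {L} a b c d {α} {β} 0<K 0<L a≤K d≤L hb ha = begin-strict
    ∣ a * b - c * d ∣
      ≡⟨ cong ∣_∣ (solve 4 (λ a b c d → a :* b :- c :* d := a :* (b :- d) :+ d :* (a :- c))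
           refl a b c d) ⟩
    ∣ a * (b - d) + d * (a - c) ∣
      ≤⟨ ℚ.∣p+q∣≤∣p∣+∣q∣ (a * (b - d)) (d * (a - c)) ⟩
    ∣ a * (b - d) ∣ + ∣ d * (a - c) ∣
      ≡⟨ cong₂ _+_ (ℚ.∣p*q∣≡∣p∣*∣q∣ a (b - d)) (ℚ.∣p*q∣≡∣p∣*∣q∣ d (a - c)) ⟩
    ∣ a ∣ * ∣ b - d ∣ + ∣ d ∣ * ∣ a - c ∣
      ≤⟨ ℚ.+-mono-≤ (*-monoʳ (ℚ.0≤∣p∣ (b - d)) a≤K) (*-monoʳ (ℚ.0≤∣p∣ (a - c)) d≤L) ⟩
    K * ∣ b - d ∣ + L * ∣ a - c ∣
      <⟨ ℚ.+-mono-< (ℚ.*-monoʳ-<-pos K {{positive 0<K}} hb)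
                    (ℚ.*-monoʳ-<-pos L {{positive 0<L}} ha) ⟩
    K * β + L * α ∎
    where open ℚ.≤-Reasoning

  cauchy-* : ∀ {x y} → Cauchy x → Cauchy y → Cauchy (λ n → x n * y n)
  cauchy-* {x} {y} cx cy ε 0<ε =
    combine (cauchy-bounded cx) (cauchy-bounded cy)
    where
      Eventually : (ℕ → Set) → Set
      Eventually P = ∃ λ N → ∀ n → N ℕ.≤ n → P n
      cancel : ∀ K κ → K * κ ≡ 1ℚ → K * (κ * (½ * ε)) ≡ ½ * ε
      cancel K κ eq = trans (sym (ℚ.*-assoc K κ (½ * ε)))
        (trans (cong (_* (½ * ε)) eq) (ℚ.*-identityˡ (½ * ε)))
      scaled : ∀ {z K} → Cauchy z → 0ℚ < K →
        ∃ λ β → K * β ≡ ½ * ε × (∃ λ N → ∀ m n → N ℕ.≤ m → N ℕ.≤ n → ∣ z m - z n ∣ < β)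
      scaled {K = K} cz 0<K =
        let (κ , 0<κ , eq) = inverse 0<K
        in κ * (½ * ε) , cancel K κ eq , cz (κ * (½ * ε)) (0<* 0<κ (0<½* 0<ε))
      combine : (∃ λ K → 0ℚ < K × Eventually (λ n → ∣ x n ∣ ≤ K)) →
                (∃ λ L → 0ℚ < L × Eventually (λ n → ∣ y n ∣ ≤ L)) →
                ∃ λ N → ∀ m n → N ℕ.≤ m → N ℕ.≤ n → ∣ x m * y m - x n * y n ∣ < ε
      combine (K , 0<K , N₁ , bx) (L , 0<L , N₂ , by) = merge (scaled {y} cy 0<K) (scaled {x} cx 0<L)
        where
          merge : (∃ λ β → K * β ≡ ½ * ε × (∃ λ N → ∀ m n → N ℕ.≤ m → N ℕ.≤ n → ∣ y m - y n ∣ < β)) →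
                  (∃ λ α → L * α ≡ ½ * ε × (∃ λ N → ∀ m n → N ℕ.≤ m → N ℕ.≤ n → ∣ x m - x n ∣ < α)) →
                  ∃ λ N → ∀ m n → N ℕ.≤ m → N ℕ.≤ n → ∣ x m * y m - x n * y n ∣ < ε
          merge (β , eβ , N₃ , py) (α , eα , N₄ , px) =
            (N₁ ℕ.+ N₂) ℕ.+ (N₃ ℕ.+ N₄) , λ m n hm hn →
              subst (∣ x m * y m - x n * y n ∣ <_)
                (trans (cong₂ _+_ eβ eα) (halves ε))
                (product-estimate (x m) (y m) (x n) (y n) 0<K 0<L
                  (bx m (ℕ.m+n≤o⇒m≤o N₁ (ℕ.m+n≤o⇒m≤o (N₁ ℕ.+ N₂) hm)))
                  (by n (ℕ.m+n≤o⇒n≤o N₁ (ℕ.m+n≤o⇒m≤o (N₁ ℕ.+ N₂) hn)))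
                  (py m n (i₃ hm) (i₃ hn)) (px m n (i₄ hm) (i₄ hn)))
            where
              i₃ : ∀ {i} → (N₁ ℕ.+ N₂) ℕ.+ (N₃ ℕ.+ N₄) ℕ.≤ i → N₃ ℕ.≤ i
              i₃ h = ℕ.m+n≤o⇒m≤o N₃ (ℕ.m+n≤o⇒n≤o (N₁ ℕ.+ N₂) h)
              i₄ : ∀ {i} → (N₁ ℕ.+ N₂) ℕ.+ (N₃ ℕ.+ N₄) ℕ.≤ i → N₄ ℕ.≤ i
              i₄ h = ℕ.m+n≤o⇒n≤o N₃ (ℕ.m+n≤o⇒n≤o (N₁ ℕ.+ N₂) h)

  -- Increments dominated by those of a decreasing null sequence.
  cauchy-telescope : ∀ {x D} → (∀ n → 0ℚ ≤ D n) → Null D →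
    (∀ n → ∣ x (suc (suc n)) - x (suc n) ∣ ≤ D (suc n) - D (suc (suc n))) → Cauchy x
  cauchy-telescope {x} {D} 0≤D nD step ε 0<ε with nD (½ * ε) (0<½* 0<ε)
  ... | N , p = suc N , λ m n hm hn → begin-strict
    ∣ x m - x n ∣                                ≤⟨ triangle (x m) (x (suc N)) (x n) ⟩
    ∣ x m - x (suc N) ∣ + ∣ x (suc N) - x n ∣    ≡⟨ cong (_+_ ∣ x m - x (suc N) ∣) (swap-∣-∣ (x (suc N)) (x n)) ⟩
    ∣ x m - x (suc N) ∣ + ∣ x n - x (suc N) ∣    ≤⟨ ℚ.+-mono-≤ (near hm) (near hn) ⟩
    D (suc N) + D (suc N)                        <⟨ ℚ.+-mono-< small small ⟩
    ½ * ε + ½ * ε                                ≡⟨ halves ε ⟩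
    ε ∎
    where
      open ℚ.≤-Reasoning
      tele : ∀ k → ∣ x (k ℕ.+ suc N) - x (suc N) ∣ ≤ D (suc N) - D (k ℕ.+ suc N)
      tele zero = ℚ.≤-reflexive (trans (cong ∣_∣ (ℚ.+-inverseʳ (x (suc N)))) (sym (ℚ.+-inverseʳ (D (suc N)))))
      tele (suc k) with step (k ℕ.+ N)
      ... | st rewrite sym (ℕ.+-suc k N) = begin
        ∣ x (suc j) - x (suc N) ∣
          ≤⟨ triangle (x (suc j)) (x j) (x (suc N)) ⟩
        ∣ x (suc j) - x j ∣ + ∣ x j - x (suc N) ∣
          ≤⟨ ℚ.+-mono-≤ st (tele k) ⟩
        (D j - D (suc j)) + (D (suc N) - D j)
          ≡⟨ solve 3 (λ a b c → (a :- b) :+ (c :- a) := c :- b) refl (D j) (D (suc j)) (D (suc N)) ⟩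
        D (suc N) - D (suc j) ∎
        where
          j : ℕ
          j = k ℕ.+ suc N
      near : ∀ {m} → suc N ℕ.≤ m → ∣ x m - x (suc N) ∣ ≤ D (suc N)
      near {m} h = ℚ.≤-trans
        (subst (λ i → ∣ x i - x (suc N) ∣ ≤ D (suc N) - D i) (ℕ.m∸n+n≡m h) (tele (m ℕ.∸ suc N)))
        (a-b≤a (0≤D m))
      small : D (suc N) < ½ * ε
      small = subst (_< ½ * ε) (0≤⇒∣∣ (0≤D (suc N))) (p (suc N) (ℕ.n≤1+n N))

open Sequences

infixl 6 _+ᵣ_ _-ᵣ_
infixl 7 _*ᵣ_
infix  8 -ᵣ_

ι : ℚ → ℝ
ι q = real (λ _ → q) (cauchy-const q)

_+ᵣ_ _*ᵣ_ _-ᵣ_ : ℝ → ℝ → ℝ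
x +ᵣ y = real (λ n → seq x n + seq y n) (cauchy-+ {seq x} {seq y} (cauchy x) (cauchy y))
x *ᵣ y = real (λ n → seq x n * seq y n) (cauchy-* {seq x} {seq y} (cauchy x) (cauchy y))
x -ᵣ y = real (λ n → seq x n - seq y n) 
  (cauchy-+ {seq x} {λ n → - seq y n} (cauchy x) (cauchy-neg {seq y} (cauchy y)))

-ᵣ_ : ℝ → ℝ
-ᵣ x = real (λ n → - seq x n) (cauchy-neg {seq x} (cauchy x))

-- ∑ᵣ a b f = f a + f (a + 1) + ⋯ + f b, which is 0 when b < a
∑ᵣ : ℕ → ℕ → (ℕ → ℝ) → ℝ
∑ᵣ a b f = foldr _+ᵣ_ (ι 0ℚ) (map f (applyUpTo (a ℕ.+_) (suc b ℕ.∸ a)))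

infix 7 _÷_^_

_÷_^_ : ℤ → (n s : ℕ) → .{{ℕ.NonZero n}} → ℚ
i ÷ n ^ s = (i / (n ℕ.^ s)) {{ℕ.m^n≢0 n s}}

-- alt s n = (-1)ⁿ⁻¹ / nˢ
alt : ℕ → Term
alt s n = (-1ℤ ℤ.^ (n ℕ.∸ 1)) ÷ n ^ s

H : ℕ → ℚ
H = ∑ (λ j → + 1 / j)

L : ℕ → ℕ → ℚ
L k n = ∑ (alt k) n

data Index : Set where
  plain bar : ℕ → Index

weight : Index → ℕ
weight (plain s) = s
weight (bar s)   = s

sign : Index → ℤ
sign (plain _) = 1ℤ
sign (bar _)   = -1ℤ

-- ζ⋆-partial (s₁ ∷ ⋯ ∷ sₖ ∷ []) N is the part N ≥ n₁ ≥ ⋯ ≥ nₖ ≥ 1 of the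
-- sum defining ζ⋆(s₁, …, sₖ).
ζ⋆-partial : List Index → ℕ → ℚ
ζ⋆-partial []       N = 1ℚ
ζ⋆-partial (s ∷ ss) N =
  ∑ (λ n → ((sign s ℤ.^ n) ÷ n ^ weight s) * ζ⋆-partial ss n) N

-- Positive weights, and a first index other than an unbarred 1.
Head : Index → Set
Head (plain s) = 2 ℕ.≤ s
Head (bar s)   = 1 ℕ.≤ s

Admissible : List Index → Set
Admissible []       = ⊥
Admissible (s ∷ ss) = Head s × All (λ t → 1 ℕ.≤ weight t) ss

head? : ∀ s → Dec (Head s)
head? (plain s) = 2 ℕ.≤? s
head? (bar s)   = 1 ℕ.≤? s

admissible? : ∀ ss → Dec (Admissible ss)
admissible? []       = no λ ()
admissible? (s ∷ ss) = head? s ×-dec all? (λ t → 1 ℕ.≤? weight t) ss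

module Convergence where
  open +-*-Solver using (solve; _:=_; _:+_; _:*_; _:-_; :-_; con)

  toℚᵘ-/ : ∀ i d → toℚᵘ (i / suc d) ℚᵘ.≃ mkℚᵘ i d
  toℚᵘ-/ i d = ℚ.toℚᵘ-fromℚᵘ (mkℚᵘ i d)

  /-*-/ : ∀ i j a b → .{{_ : ℕ.NonZero a}} → .{{_ : ℕ.NonZero b}} → .{{_ : ℕ.NonZero (a ℕ.* b)}} →
    (i / a) * (j / b) ≡ (i ℤ.* j) / (a ℕ.* b)
  /-*-/ i j (suc a) (suc b) = ℚ.toℚᵘ-injective
    (ℚᵘ.≃-trans (ℚ.toℚᵘ-homo-* (i / suc a) (j / suc b))
      (ℚᵘ.≃-trans (ℚᵘ.*-cong (toℚᵘ-/ i a) (toℚᵘ-/ j b))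
        (ℚᵘ.≃-sym (toℚᵘ-/ (i ℤ.* j) (b ℕ.+ a ℕ.* suc b)))))

  recip-anti : ∀ {a b} → .{{_ : ℕ.NonZero a}} → .{{_ : ℕ.NonZero b}} → a ℕ.≤ b → (+ 1 / b) ≤ (+ 1 / a)
  recip-anti {suc a} {suc b} a≤b = ℚ.toℚᵘ-cancel-≤
    (ℚᵘ.≤-trans (ℚᵘ.≤-reflexive (toℚᵘ-/ (+ 1) b))
      (ℚᵘ.≤-trans (*≤* (ℤ.*-monoˡ-≤-nonNeg (+ 1) (ℤ.+≤+ a≤b)))
        (ℚᵘ.≤-reflexive (ℚᵘ.≃-sym (toℚᵘ-/ (+ 1) a)))))

  r : ℕ → ℚ
  r zero    = 0ℚ
  r (suc n) = + 1 / suc n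

  fromℕ : ℕ → ℚ
  fromℕ n = + n / 1

  0≤fromℕ : ∀ n → 0ℚ ≤ fromℕ n
  0≤fromℕ n = ℚ.nonNegative⁻¹ (fromℕ n) {{ℚ.normalize-nonNeg n 1}}

  0≤recip : ∀ n → .{{_ : ℕ.NonZero n}} → 0ℚ ≤ + 1 / n
  0≤recip n = ℚ.nonNegative⁻¹ (+ 1 / n) {{ℚ.normalize-nonNeg 1 n}}

  0≤r : ∀ n → 0ℚ ≤ r n
  0≤r zero    = ℚ.≤-refl
  0≤r (suc n) = 0≤recip (suc n)

  fromℕ-suc : ∀ n → fromℕ (suc n) ≡ 1ℚ + fromℕ n
  fromℕ-suc n = ℚ.toℚᵘ-injective
    (ℚᵘ.≃-trans (toℚᵘ-/ (+ suc n) 0)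
      (ℚᵘ.≃-trans (*≡* (cong (ℤ._* + 1) (cong (λ t → + 1 ℤ.+ t) (sym (ℤ.*-identityʳ (+ n))))))
        (ℚᵘ.≃-sym (ℚᵘ.≃-trans (ℚ.toℚᵘ-homo-+ 1ℚ (fromℕ n))
          (ℚᵘ.+-cong (ℚᵘ.≃-refl {mkℚᵘ (+ 1) 0}) (toℚᵘ-/ (+ n) 0))))))

  r-inverse : ∀ n → r (suc n) * fromℕ (suc n) ≡ 1ℚ
  r-inverse n = trans (/-*-/ (+ 1) (+ suc n) (suc n) 1)
    (ℚ.toℚᵘ-injective (ℚᵘ.≃-trans (toℚᵘ-/ (+ 1 ℤ.* + suc n) (n ℕ.* 1))
      (*≡* (trans (ℤ.*-identityʳ (+ 1 ℤ.* + suc n))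
        (trans (ℤ.*-identityˡ (+ suc n))
          (sym (trans (ℤ.*-identityˡ (+ (suc n ℕ.* 1))) (cong +_ (ℕ.*-identityʳ (suc n))))))))))

  r-difference : ∀ n → r (suc n) - r (suc (suc n)) ≡ r (suc n) * r (suc (suc n))
  r-difference n = begin
    u - v                        ≡⟨ cong₂ _-_ (sym (ℚ.*-identityʳ u)) (sym (ℚ.*-identityʳ v)) ⟩
    u * 1ℚ - v * 1ℚ              ≡⟨ cong₂ (λ s t → u * s - v * t)
                                      (sym (trans (cong (v *_) (sym (fromℕ-suc (suc n)))) (r-inverse (suc n))))
                                      (sym (r-inverse n)) ⟩
    u * (v * (1ℚ + w)) - v * (u * w)
      ≡⟨ solve 3 (λ u v w → u :* (v :* (con 1ℚ :+ w)) :- v :* (u :* w) := u :* v) refl u v w ⟩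
    u * v ∎
    where
      open ≡-Reasoning
      u v w : ℚ
      u = r (suc n)
      v = r (suc (suc n))
      w = fromℕ (suc n)

  null-r : Null r
  null-r ε@(mkℚ (+ suc p) d _) 0<ε = suc (suc d) , λ where
      (suc n) (s≤s h) → subst (_< ε) (sym (0≤⇒∣∣ (0≤r (suc n))))
        (ℚ.≤-<-trans (recip-anti (s≤s h)) less)
    where
      less : r (suc (suc d)) < ε
      less = ℚ.toℚᵘ-cancel-< (ℚᵘ.≤-<-trans (ℚᵘ.≤-reflexive (toℚᵘ-/ (+ 1) (suc d)))
        (ℚᵘ.*<* (ℤ.+<+ (ℕ.<-≤-trans
          (subst (ℕ._< suc (suc d)) (sym (ℕ.*-identityˡ (suc d))) ℕ.≤-refl)
          (ℕ.m≤n*m (suc (suc d)) (suc p))))))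
  null-r (mkℚ (+ zero) d _) (*<* (ℤ.+<+ ()))
  null-r (mkℚ (ℤ.-[1+ p ]) d _) (*<* ())

  fromℕ-mono : ∀ k N → fromℕ k ≤ fromℕ (k ℕ.+ N)
  fromℕ-mono zero    N = 0≤fromℕ N
  fromℕ-mono (suc k) N = subst₂ _≤_ (sym (fromℕ-suc k)) (sym (fromℕ-suc (k ℕ.+ N)))
    (ℚ.+-monoʳ-≤ 1ℚ (fromℕ-mono k N))

  fromℕ*r≤1 : ∀ n → fromℕ n * r n ≤ 1ℚ
  fromℕ*r≤1 zero    = ℚ.<⇒≤ 0<1
  fromℕ*r≤1 (suc n) = ℚ.≤-reflexive (trans (ℚ.*-comm (fromℕ (suc n)) (r (suc n))) (r-inverse n))

  cesàro : ∀ {a s : ℕ → ℚ} → (∀ n → s (suc n) ≡ s n + a (suc n)) → Null a → Null (λ n → s n * r n)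
  cesàro {a} {s} rec na ε 0<ε =
    N ℕ.+ M , λ n h → bound n (ℕ.m+n≤o⇒m≤o N h) (ℕ.m+n≤o⇒n≤o N h)
    where
      N : ℕ
      N = proj₁ (na (½ * ε) (0<½* 0<ε))
      p : ∀ n → N ℕ.≤ n → ∣ a n ∣ < ½ * ε
      p = proj₂ (na (½ * ε) (0<½* 0<ε))
      Mq : ∃ λ M → ∀ n → M ℕ.≤ n → ∣ ∣ s N ∣ * r n ∣ < ½ * ε
      Mq = null-scale ∣ s N ∣ {r} null-r (½ * ε) (0<½* 0<ε)
      M : ℕ
      M = proj₁ Mq
      q : ∀ n → M ℕ.≤ n → ∣ ∣ s N ∣ * r n ∣ < ½ * ε
      q = proj₂ Mq
      open ℚ.≤-Reasoning
      grow : ∀ k → ∣ s (k ℕ.+ N) ∣ ≤ ∣ s N ∣ + fromℕ k * (½ * ε)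
      grow zero = ℚ.≤-reflexive
        (solve 2 (λ a e → a := a :+ con 0ℚ :* e) refl ∣ s N ∣ (½ * ε))
      grow (suc k) = begin
        ∣ s (suc (k ℕ.+ N)) ∣                       ≡⟨ cong ∣_∣ (rec (k ℕ.+ N)) ⟩
        ∣ s (k ℕ.+ N) + a (suc (k ℕ.+ N)) ∣         ≤⟨ ℚ.∣p+q∣≤∣p∣+∣q∣ (s (k ℕ.+ N)) (a (suc (k ℕ.+ N))) ⟩
        ∣ s (k ℕ.+ N) ∣ + ∣ a (suc (k ℕ.+ N)) ∣
          ≤⟨ ℚ.+-mono-≤ (grow k) (ℚ.<⇒≤ (p (suc (k ℕ.+ N)) (ℕ.≤-trans (ℕ.m≤n+m N k) (ℕ.n≤1+n (k ℕ.+ N))))) ⟩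
        (∣ s N ∣ + fromℕ k * (½ * ε)) + ½ * ε
          ≡⟨ solve 3 (λ c f e → (c :+ f :* e) :+ e := c :+ (con 1ℚ :+ f) :* e) refl ∣ s N ∣ (fromℕ k) (½ * ε) ⟩
        ∣ s N ∣ + (1ℚ + fromℕ k) * (½ * ε)
          ≡⟨ cong (λ t → ∣ s N ∣ + t * (½ * ε)) (sym (fromℕ-suc k)) ⟩
        ∣ s N ∣ + fromℕ (suc k) * (½ * ε) ∎
      bound : ∀ n → N ℕ.≤ n → M ℕ.≤ n → ∣ s n * r n ∣ < ε
      bound n N≤n M≤n = begin-strict
        ∣ s n * r n ∣                           ≡⟨ ℚ.∣p*q∣≡∣p∣*∣q∣ (s n) (r n) ⟩
        ∣ s n ∣ * ∣ r n ∣                       ≡⟨ cong (∣ s n ∣ *_) (0≤⇒∣∣ (0≤r n)) ⟩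
        ∣ s n ∣ * r n
          ≤⟨ *-monoʳ (0≤r n) (subst (λ i → ∣ s i ∣ ≤ ∣ s N ∣ + fromℕ k * (½ * ε)) k+N≡n (grow k)) ⟩
        (∣ s N ∣ + fromℕ k * (½ * ε)) * r n
          ≡⟨ solve 4 (λ c f e r → (c :+ f :* e) :* r := c :* r :+ f :* r :* e) refl ∣ s N ∣ (fromℕ k) (½ * ε) (r n) ⟩
        ∣ s N ∣ * r n + fromℕ k * r n * (½ * ε)
          ≤⟨ ℚ.+-monoʳ-≤ (∣ s N ∣ * r n) (*-monoʳ (ℚ.<⇒≤ (0<½* 0<ε))
               (ℚ.≤-trans (*-monoʳ (0≤r n) (subst (λ i → fromℕ k ≤ fromℕ i) k+N≡n (fromℕ-mono k N)))
                 (fromℕ*r≤1 n))) ⟩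
        ∣ s N ∣ * r n + 1ℚ * (½ * ε)
          ≡⟨ cong₂ _+_ (sym (0≤⇒∣∣ (0≤* (ℚ.0≤∣p∣ (s N)) (0≤r n)))) (ℚ.*-identityˡ (½ * ε)) ⟩
        ∣ ∣ s N ∣ * r n ∣ + ½ * ε
          <⟨ ℚ.+-monoˡ-< (½ * ε) (q n M≤n) ⟩
        ½ * ε + ½ * ε                           ≡⟨ halves ε ⟩
        ε ∎
        where
          k : ℕ
          k = n ℕ.∸ N
          k+N≡n : k ℕ.+ N ≡ n
          k+N≡n = ℕ.m∸n+n≡m N≤n

  -- A k n = ζ⋆-partial at k unbarred ones; it bounds every partial sum of depth k.
  A B D : ℕ → ℕ → ℚ
  A zero    n       = 1ℚ
  A (suc k) zero    = 0ℚ
  A (suc k) (suc n) = A (suc k) n + r (suc n) * A k (suc n)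
  B zero    n = A zero n
  B (suc k) n = A (suc k) n + B k n
  D k n = B k n * r n

  0≤A : ∀ k n → 0ℚ ≤ A k n
  0≤A zero    n       = ℚ.<⇒≤ 0<1
  0≤A (suc k) zero    = ℚ.≤-refl
  0≤A (suc k) (suc n) = 0≤+ (0≤A (suc k) n) (0≤* (0≤r (suc n)) (0≤A k (suc n)))

  A≤B : ∀ k n → A k n ≤ B k n
  0≤B : ∀ k n → 0ℚ ≤ B k n
  0≤B k n = ℚ.≤-trans (0≤A k n) (A≤B k n)
  A≤B zero    n = ℚ.≤-refl
  A≤B (suc k) n = a≤a+b (0≤B k n)

  0≤D : ∀ k n → 0ℚ ≤ D k n
  0≤D k n = 0≤* (0≤B k n) (0≤r n)

  A-step : ∀ k n → A k (suc n) ≤ A (suc k) (suc n)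
  A-step zero zero = ℚ.≤-refl
  A-step zero (suc n) = ℚ.≤-trans (A-step zero n)
    (a≤a+b (0≤* (0≤r (suc (suc n))) (ℚ.<⇒≤ 0<1)))
  A-step (suc k) zero = ℚ.+-monoʳ-≤ 0ℚ (*-monoˡ (0≤r 1) (A-step k zero))
  A-step (suc k) (suc n) =
    ℚ.+-mono-≤ (A-step (suc k) n) (*-monoˡ (0≤r (suc (suc n))) (A-step k (suc n)))

  null-A*r : ∀ k → Null (λ n → A k n * r n)
  null-A*r zero = null-scale 1ℚ {r} null-r
  null-A*r (suc k) = cesàro {λ n → A k n * r n} {A (suc k)}
    (λ n → cong (_+_ (A (suc k) n)) (ℚ.*-comm (r (suc n)) (A k (suc n)))) (null-A*r k)

  null-D : ∀ k → Null (D k)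
  null-D zero = null-A*r zero
  null-D (suc k) = null-dominated
    (λ n → ℚ.≤-reflexive (cong ∣_∣ (ℚ.*-distribʳ-+ (r n) (A (suc k) n) (B k n))))
    (null-+ (null-A*r (suc k)) (null-D k))

  B-suc : ∀ k n → B (suc k) (suc n) ≡ B (suc k) n + r (suc n) * B k (suc n)
  B-suc zero n =
    solve 2 (λ a r → (a :+ r :* con 1ℚ) :+ con 1ℚ := (a :+ con 1ℚ) :+ r :* con 1ℚ) refl (A 1 n) (r (suc n))
  B-suc (suc k) n = trans (cong (_+_ (A (suc (suc k)) (suc n))) (B-suc k n))
    (solve 5 (λ a r b c d → (a :+ r :* b) :+ (c :+ r :* d) := (a :+ c) :+ r :* (b :+ d)) refl
      (A (suc (suc k)) n) (r (suc n)) (A (suc k) (suc n)) (B (suc k) n) (B k (suc n)))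

  D-difference : ∀ k n →
    r (suc n) * r (suc (suc n)) * A k (suc (suc n)) ≡ D k (suc n) - D k (suc (suc n))
  D-difference zero n = trans (cong (_* 1ℚ) (sym (r-difference n)))
    (solve 2 (λ u v → (u :- v) :* con 1ℚ := con 1ℚ :* u :- con 1ℚ :* v) refl (r (suc n)) (r (suc (suc n))))
  D-difference (suc k) n = begin
    u * v * a
      ≡⟨ solve 4 (λ u v a c → u :* v :* a := u :* v :* (a :+ c) :- u :* (v :* c)) refl u v a c ⟩
    u * v * (a + c) - u * (v * c)
      ≡⟨ cong (λ t → t * (a + c) - u * (v * c)) (sym (r-difference n)) ⟩
    (u - v) * (a + c) - u * (v * c)
      ≡⟨ solve 4 (λ u v b t → (u :- v) :* b :- u :* t := (b :- t) :* u :- b :* v) refl u v (a + c) (v * c) ⟩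
    ((a + c) - v * c) * u - (a + c) * v
      ≡⟨ cong (λ t → (t - v * c) * u - (a + c) * v) (B-suc k (suc n)) ⟩
    ((b + v * c) - v * c) * u - (a + c) * v
      ≡⟨ cong (λ t → t * u - (a + c) * v) (solve 2 (λ b t → (b :+ t) :- t := b) refl b (v * c)) ⟩
    b * u - (a + c) * v ∎
    where
      open ≡-Reasoning
      u v a b c : ℚ
      u = r (suc n)
      v = r (suc (suc n))
      a = A (suc k) (suc (suc n))
      b = B (suc k) (suc n)
      c = B k (suc (suc n))

  σ : Index → ℕ → ℚ
  σ s n = (sign s ℤ.^ n) / 1

  σ-suc : ∀ s n → σ s (suc n) ≡ (sign s / 1) * σ s n
  σ-suc s n = sym (/-*-/ (sign s) (sign s ℤ.^ n) 1 1)

  ∣σ∣≡1 : ∀ s n → ∣ σ s n ∣ ≡ 1ℚ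
  ∣σ∣≡1 s zero = refl
  ∣σ∣≡1 s (suc n) = trans (cong ∣_∣ (σ-suc s n))
    (trans (ℚ.∣p*q∣≡∣p∣*∣q∣ (sign s / 1) (σ s n)) (cong₂ _*_ (unit s) (∣σ∣≡1 s n)))
    where
      unit : ∀ s → ∣ sign s / 1 ∣ ≡ 1ℚ
      unit (plain _) = refl
      unit (bar _)   = refl

  coef : Index → ℕ → ℚ
  coef s n = (sign s ℤ.^ suc n) ÷ suc n ^ weight s

  /-split : ∀ i d → .{{_ : ℕ.NonZero d}} → i / d ≡ (i / 1) * (+ 1 / d)
  /-split i (suc d) = sym (trans (/-*-/ i (+ 1) 1 (suc d))
    (ℚ./-cong (ℤ.*-identityʳ i) (ℕ.+-identityʳ (suc d))))

  ÷-split : ∀ i n s → i ÷ suc n ^ s ≡ (i / 1) * (+ 1 ÷ suc n ^ s)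
  ÷-split i n s = /-split i (suc n ℕ.^ s) {{ℕ.m^n≢0 (suc n) s}}

  ÷-anti : ∀ n {s t} → s ℕ.≤ t → + 1 ÷ suc n ^ t ≤ + 1 ÷ suc n ^ s
  ÷-anti n {s} {t} s≤t = recip-anti {{ℕ.m^n≢0 (suc n) s}} {{ℕ.m^n≢0 (suc n) t}} (ℕ.^-monoʳ-≤ (suc n) s≤t)

  ÷^1 : ∀ i n → i ÷ suc n ^ 1 ≡ i / suc n
  ÷^1 i n = ℚ./-cong {i} refl (ℕ.^-identityʳ (suc n))

  ∣coef∣ : ∀ s n → ∣ coef s n ∣ ≡ + 1 ÷ suc n ^ weight s
  ∣coef∣ s n = begin
    ∣ coef s n ∣                  ≡⟨ cong ∣_∣ (÷-split (sign s ℤ.^ suc n) n (weight s)) ⟩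
    ∣ σ s (suc n) * q ∣           ≡⟨ ℚ.∣p*q∣≡∣p∣*∣q∣ (σ s (suc n)) q ⟩
    ∣ σ s (suc n) ∣ * ∣ q ∣       ≡⟨ cong₂ _*_ (∣σ∣≡1 s (suc n)) (0≤⇒∣∣ (0≤recip (suc n ℕ.^ weight s) {{ℕ.m^n≢0 (suc n) (weight s)}})) ⟩
    1ℚ * q                        ≡⟨ ℚ.*-identityˡ q ⟩
    q ∎
    where
      open ≡-Reasoning
      q : ℚ
      q = + 1 ÷ suc n ^ weight s

  ∣coef∣≤r : ∀ s n → 1 ℕ.≤ weight s → ∣ coef s n ∣ ≤ r (suc n)
  ∣coef∣≤r s n 1≤w = subst₂ _≤_ (sym (∣coef∣ s n)) (÷^1 (+ 1) n) (÷-anti n 1≤w)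

  ∣coef∣≤rr : ∀ s n → 2 ℕ.≤ weight s → ∣ coef s (suc n) ∣ ≤ r (suc n) * r (suc (suc n))
  ∣coef∣≤rr s n 2≤w = begin
    ∣ coef s (suc n) ∣                          ≡⟨ ∣coef∣ s (suc n) ⟩
    + 1 ÷ suc (suc n) ^ weight s                ≤⟨ ÷-anti (suc n) 2≤w ⟩
    + 1 ÷ suc (suc n) ^ 2                       ≤⟨ recip-anti (ℕ.*-mono-≤ (ℕ.n≤1+n (suc n)) (ℕ.≤-reflexive (sym (ℕ.^-identityʳ (suc (suc n)))))) ⟩
    + 1 / (suc n ℕ.* suc (suc n))               ≡⟨ sym (/-*-/ (+ 1) (+ 1) (suc n) (suc (suc n))) ⟩
    r (suc n) * r (suc (suc n)) ∎
    where open ℚ.≤-Reasoning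

  Positives : List Index → Set
  Positives = All (λ t → 1 ℕ.≤ weight t)

  ∣coef*∣ : ∀ s n {x a b} → ∣ coef s n ∣ ≤ a → ∣ x ∣ ≤ b → 0ℚ ≤ b → ∣ coef s n * x ∣ ≤ a * b
  ∣coef*∣ s n {x} c≤a x≤b 0≤b = ℚ.≤-trans (ℚ.≤-reflexive (ℚ.∣p*q∣≡∣p∣*∣q∣ (coef s n) x))
    (*-mono (ℚ.0≤∣p∣ (coef s n)) 0≤b c≤a x≤b)

  partial-bound : ∀ {ss} → Positives ss → ∀ n → ∣ ζ⋆-partial ss n ∣ ≤ A (length ss) n
  partial-bound [] n = ℚ.≤-refl
  partial-bound (p ∷ ps) zero = ℚ.≤-refl
  partial-bound {s ∷ ss} (p ∷ ps) (suc n) = ℚ.≤-trans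
    (ℚ.∣p+q∣≤∣p∣+∣q∣ (ζ⋆-partial (s ∷ ss) n) (coef s n * ζ⋆-partial ss (suc n)))
    (ℚ.+-mono-≤ (partial-bound (p ∷ ps) n)
      (∣coef*∣ s n (∣coef∣≤r s n p) (partial-bound ps (suc n)) (0≤A (length ss) (suc n))))

  partial-step : ∀ {ss} → Positives ss → ∀ n →
    ∣ ζ⋆-partial ss (suc n) - ζ⋆-partial ss n ∣ ≤ r (suc n) * A (length ss) (suc n)
  partial-step [] n = 0≤* (0≤r (suc n)) (ℚ.<⇒≤ 0<1)
  partial-step {s ∷ ss} (p ∷ ps) n = ℚ.≤-trans
    (ℚ.≤-reflexive (cong ∣_∣ (solve 2 (λ a t → (a :+ t) :- a := t) refl
      (ζ⋆-partial (s ∷ ss) n) (coef s n * ζ⋆-partial ss (suc n)))))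
    (∣coef*∣ s n (∣coef∣≤r s n p)
      (ℚ.≤-trans (partial-bound ps (suc n)) (A-step (length ss) n))
      (0≤A (suc (length ss)) (suc n)))

  cauchy-absolute : ∀ {s ss} → 2 ℕ.≤ weight s → Positives ss → Cauchy (ζ⋆-partial (s ∷ ss))
  cauchy-absolute {s} {ss} 2≤w ps = cauchy-telescope {ζ⋆-partial (s ∷ ss)} {D k} (0≤D k) (null-D k) λ n → begin
    ∣ ζ⋆-partial (s ∷ ss) (suc (suc n)) - ζ⋆-partial (s ∷ ss) (suc n) ∣
      ≡⟨ cong ∣_∣ (solve 2 (λ a t → (a :+ t) :- a := t) refl
           (ζ⋆-partial (s ∷ ss) (suc n)) (coef s (suc n) * ζ⋆-partial ss (suc (suc n)))) ⟩
    ∣ coef s (suc n) * ζ⋆-partial ss (suc (suc n)) ∣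
      ≤⟨ ∣coef*∣ s (suc n) (∣coef∣≤rr s n 2≤w) (partial-bound ps (suc (suc n))) (0≤A k (suc (suc n))) ⟩
    r (suc n) * r (suc (suc n)) * A k (suc (suc n))
      ≡⟨ D-difference k n ⟩
    D k (suc n) - D k (suc (suc n)) ∎
    where
      open ℚ.≤-Reasoning
      k : ℕ
      k = length ss

  coef-bar1 : ∀ n → coef (bar 1) n ≡ σ (bar 1) (suc n) * r (suc n)
  coef-bar1 n = trans (÷-split (-1ℤ ℤ.^ suc n) n 1)
    (cong (σ (bar 1) (suc n) *_) (÷^1 (+ 1) n))

  coef-bar1-sum : ∀ n → ∣ coef (bar 1) (suc n) + coef (bar 1) n ∣ ≡ r (suc n) * r (suc (suc n))
  coef-bar1-sum n = begin
    ∣ coef (bar 1) (suc n) + coef (bar 1) n ∣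
      ≡⟨ cong₂ (λ a b → ∣ a + b ∣)
           (trans (coef-bar1 (suc n)) (cong (_* v) (σ-suc (bar 1) (suc n)))) (coef-bar1 n) ⟩
    ∣ (- 1ℚ * t) * v + t * u ∣
      ≡⟨ cong ∣_∣ (solve 3 (λ t u v → (:- con 1ℚ :* t) :* v :+ t :* u := t :* (u :- v)) refl t u v) ⟩
    ∣ t * (u - v) ∣
      ≡⟨ ℚ.∣p*q∣≡∣p∣*∣q∣ t (u - v) ⟩
    ∣ t ∣ * ∣ u - v ∣
      ≡⟨ cong₂ (λ a b → a * ∣ b ∣) (∣σ∣≡1 (bar 1) (suc n)) (r-difference n) ⟩
    1ℚ * ∣ u * v ∣
      ≡⟨ trans (ℚ.*-identityˡ ∣ u * v ∣) (0≤⇒∣∣ (0≤* (0≤r (suc n)) (0≤r (suc (suc n))))) ⟩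
    u * v ∎
    where
      open ≡-Reasoning
      t u v : ℚ
      t = σ (bar 1) (suc n)
      u = r (suc n)
      v = r (suc (suc n))

  -- Subtracting half of the last term makes the alternating series
  -- absolutely convergent.
  cauchy-bar1 : ∀ {ss} → Positives ss → Cauchy (ζ⋆-partial (bar 1 ∷ ss))
  cauchy-bar1 {ss} ps = cauchy-resp
      (λ n → solve 2 (λ a t → (a :- con ½ :* t) :+ con ½ :* t := a) refl (X n) (T n))
      (cauchy-+ {W} {λ n → ½ * T n} cauchy-W (null⇒cauchy {λ n → ½ * T n} (null-scale ½ {T} null-T)))
    where
      open ℚ.≤-Reasoning
      k : ℕ
      k = length ss
      S X T W : ℕ → ℚ
      S = ζ⋆-partial ss
      X = ζ⋆-partial (bar 1 ∷ ss)
      T zero    = 0ℚ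
      T (suc n) = coef (bar 1) n * S (suc n)
      W n = X n - ½ * T n
      null-T : Null T
      null-T = null-dominated dom (null-D k)
        where
          dom : ∀ n → ∣ T n ∣ ≤ ∣ D k n ∣
          dom zero    = ℚ.0≤∣p∣ (D k zero)
          dom (suc n) = begin
            ∣ coef (bar 1) n * S (suc n) ∣
              ≤⟨ ∣coef*∣ (bar 1) n (∣coef∣≤r (bar 1) n ℕ.≤-refl)
                   (ℚ.≤-trans (partial-bound ps (suc n)) (A≤B k (suc n))) (0≤B k (suc n)) ⟩
            r (suc n) * B k (suc n)  ≡⟨ ℚ.*-comm (r (suc n)) (B k (suc n)) ⟩
            D k (suc n)              ≡⟨ sym (0≤⇒∣∣ (0≤D k (suc n))) ⟩
            ∣ D k (suc n) ∣ ∎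
      cauchy-W : Cauchy W
      cauchy-W = cauchy-telescope {W} {D k} (0≤D k) (null-D k) λ n →
        let c = coef (bar 1) n
            c′ = coef (bar 1) (suc n)
            x = S (suc n)
            x′ = S (suc (suc n))
            u = r (suc n)
            v = r (suc (suc n))
            a = A k (suc (suc n))
        in begin
        ∣ W (suc (suc n)) - W (suc n) ∣
          ≡⟨ cong ∣_∣ (solve 5 (λ X c c′ x x′ →
               ((X :+ c′ :* x′) :- con ½ :* (c′ :* x′)) :- (X :- con ½ :* (c :* x))
               := con ½ :* ((c′ :+ c) :* x′ :- c :* (x′ :- x))) refl (X (suc n)) c c′ x x′) ⟩
        ∣ ½ * ((c′ + c) * x′ - c * (x′ - x)) ∣
          ≡⟨ ℚ.∣p*q∣≡∣p∣*∣q∣ ½ ((c′ + c) * x′ - c * (x′ - x)) ⟩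
        ½ * ∣ (c′ + c) * x′ - c * (x′ - x) ∣
          ≤⟨ *-monoˡ (ℚ.<⇒≤ 0<½) (ℚ.∣p-q∣≤∣p∣+∣q∣ ((c′ + c) * x′) (c * (x′ - x))) ⟩
        ½ * (∣ (c′ + c) * x′ ∣ + ∣ c * (x′ - x) ∣)
          ≤⟨ *-monoˡ (ℚ.<⇒≤ 0<½) (ℚ.+-mono-≤
               (ℚ.≤-trans
                 (ℚ.≤-reflexive (trans (ℚ.∣p*q∣≡∣p∣*∣q∣ (c′ + c) x′) (cong (_* ∣ x′ ∣) (coef-bar1-sum n))))
                 (*-monoˡ (0≤* (0≤r (suc n)) (0≤r (suc (suc n)))) (partial-bound ps (suc (suc n)))))
               (∣coef*∣ (bar 1) n (∣coef∣≤r (bar 1) n ℕ.≤-refl) (partial-step ps (suc n))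
                 (0≤* (0≤r (suc (suc n))) (0≤A k (suc (suc n)))))) ⟩
        ½ * (u * v * a + u * (v * a))
          ≡⟨ solve 3 (λ u v a → con ½ :* (u :* v :* a :+ u :* (v :* a)) := u :* v :* a) refl u v a ⟩
        u * v * a
          ≡⟨ D-difference k n ⟩
        D k (suc n) - D k (suc (suc n)) ∎

  cauchy-ζ⋆ : ∀ ss → Admissible ss → Cauchy (ζ⋆-partial ss)
  cauchy-ζ⋆ (plain s ∷ ss)           (2≤s , ps) = cauchy-absolute {plain s} 2≤s ps
  cauchy-ζ⋆ (bar (suc zero) ∷ ss)    (_ , ps)   = cauchy-bar1 ps
  cauchy-ζ⋆ (bar (suc (suc s)) ∷ ss) (_ , ps)   = cauchy-absolute {bar (suc (suc s))} (s≤s (s≤s z≤n)) ps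

  cauchy-ζ : ∀ s → 2 ℕ.≤ s → Cauchy (∑ (λ n → + 1 ÷ n ^ s))
  cauchy-ζ s 2≤s = cauchy-resp eq (cauchy-ζ⋆ (plain s ∷ []) (2≤s , []))
    where
      eq : ∀ n → ζ⋆-partial (plain s ∷ []) n ≡ ∑ (λ n → + 1 ÷ n ^ s) n
      eq zero    = refl
      eq (suc n) = cong₂ _+_ (eq n)
        (trans (ℚ.*-identityʳ (coef (plain s) n)) (cong (λ i → i ÷ suc n ^ s) (ℤ.^-zeroˡ (suc n))))

  cauchy-ζ̄ : ∀ s → 1 ℕ.≤ s → Cauchy (∑ (alt s))
  cauchy-ζ̄ s 1≤s = cauchy-resp eq
    (cauchy-neg {ζ⋆-partial (bar s ∷ [])} (cauchy-ζ⋆ (bar s ∷ []) (1≤s , [])))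
    where
      eq : ∀ n → - ζ⋆-partial (bar s ∷ []) n ≡ ∑ (alt s) n
      eq zero    = refl
      eq (suc n) = trans
        (ℚ.neg-distrib-+ (ζ⋆-partial (bar s ∷ []) n) (coef (bar s) n * 1ℚ))
        (cong₂ _+_ (eq n) (begin
          - (coef (bar s) n * 1ℚ)
            ≡⟨ cong -_ (trans (ℚ.*-identityʳ (coef (bar s) n)) (÷-split (-1ℤ ℤ.^ suc n) n s)) ⟩
          - (σ (bar s) (suc n) * q)
            ≡⟨ cong (λ t → - (t * q)) (σ-suc (bar s) n) ⟩
          - (- 1ℚ * σ (bar s) n * q)
            ≡⟨ solve 2 (λ t q → :- (:- con 1ℚ :* t :* q) := t :* q) refl (σ (bar s) n) q ⟩
          σ (bar s) n * q
            ≡⟨ sym (÷-split (-1ℤ ℤ.^ n) n s) ⟩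
          alt s (suc n) ∎))
        where
          open ≡-Reasoning
          q : ℚ
          q = + 1 ÷ suc n ^ s

  cauchy-ln2 : Cauchy (λ N → H (2 ℕ.* N) - H N)
  cauchy-ln2 = cauchy-telescope {λ N → H (2 ℕ.* N) - H N} {D 0} (0≤D 0) (null-D 0) λ n → step n
    where
      open ℚ.≤-Reasoning
      double : ∀ N → H (2 ℕ.* suc N) ≡ H (2 ℕ.* N) + r (suc (2 ℕ.* N)) + r (suc (suc (2 ℕ.* N)))
      double N = cong H (cong suc (ℕ.+-suc N (N ℕ.+ 0)))
      -- 1/(N+1) = 2/(2N+2)
      half : ∀ N → r (suc N) ≡ r (suc (suc (2 ℕ.* N))) + r (suc (suc (2 ℕ.* N)))
      half N = sym (begin-equality
        w + w                       ≡⟨ solve 1 (λ w → w :+ w := con (+ 2 / 1) :* w) refl w ⟩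
        (+ 2 / 1) * w               ≡⟨ cong ((+ 2 / 1) *_) (ℚ./-cong {+ 1} refl (cong suc (sym (ℕ.+-suc N (N ℕ.+ 0))))) ⟩
        (+ 2 / 1) * (+ 1 / (2 ℕ.* suc N))
          ≡⟨ cong ((+ 2 / 1) *_) (sym (/-*-/ (+ 1) (+ 1) 2 (suc N))) ⟩
        (+ 2 / 1) * (½ * r (suc N)) ≡⟨ solve 1 (λ q → con (+ 2 / 1) :* (con ½ :* q) := q) refl (r (suc N)) ⟩
        r (suc N) ∎)
        where
          w : ℚ
          w = r (suc (suc (2 ℕ.* N)))
      step : ∀ n → ∣ (H (2 ℕ.* suc (suc n)) - H (suc (suc n))) - (H (2 ℕ.* suc n) - H (suc n)) ∣
                   ≤ D 0 (suc n) - D 0 (suc (suc n))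
      step n = begin
        ∣ (H (2 ℕ.* suc (suc n)) - H (suc (suc n))) - (H (2 ℕ.* suc n) - H (suc n)) ∣
          ≡⟨ cong₂ (λ a b → ∣ (a - (H (suc n) + b)) - (H (2 ℕ.* suc n) - H (suc n)) ∣)
               (double (suc n)) (half (suc n)) ⟩
        ∣ (H (2 ℕ.* suc n) + p + q - (H (suc n) + (q + q))) - (H (2 ℕ.* suc n) - H (suc n)) ∣
          ≡⟨ cong ∣_∣ (solve 4 (λ a p q h → (a :+ p :+ q :- (h :+ (q :+ q))) :- (a :- h) := p :- q)
               refl (H (2 ℕ.* suc n)) p q (H (suc n))) ⟩
        ∣ p - q ∣
          ≡⟨ cong ∣_∣ (r-difference (2 ℕ.* suc n)) ⟩
        ∣ p * q ∣
          ≡⟨ 0≤⇒∣∣ (0≤* (0≤r (suc (2 ℕ.* suc n))) (0≤r (suc (suc (2 ℕ.* suc n))))) ⟩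
        p * q
          ≤⟨ *-mono (0≤r (suc (2 ℕ.* suc n))) (0≤r (suc (suc n)))
               (recip-anti (s≤s (ℕ.≤-trans (ℕ.n≤1+n n) (ℕ.m≤m+n (suc n) (suc n ℕ.+ 0)))))
               (recip-anti (s≤s (ℕ.≤-trans (ℕ.m≤m+n (suc n) (suc n ℕ.+ 0)) (ℕ.n≤1+n (2 ℕ.* suc n))))) ⟩
        r (suc n) * r (suc (suc n))
          ≡⟨ trans (sym (ℚ.*-identityʳ (r (suc n) * r (suc (suc n))))) (D-difference 0 n) ⟩
        D 0 (suc n) - D 0 (suc (suc n)) ∎
        where
          p q : ℚ
          p = r (suc (2 ℕ.* suc n))
          q = r (suc (suc (2 ℕ.* suc n)))

open Convergence

-- The limit of x if P (a sufficient condition for convergence) holds, and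
-- the conventional value 0 otherwise.
limitIf : ∀ {P : Set} {x : ℕ → ℚ} → Dec P → (P → Cauchy x) → ℝ
limitIf {x = x} (yes p) c = real x (c p)
limitIf         (no _)  c = ι 0ℚ

-- Meaningful for s ≥ 2.
ζ : ℕ → ℝ
ζ s = limitIf {x = ∑ (λ n → + 1 ÷ n ^ s)} (2 ℕ.≤? s) (cauchy-ζ s)

-- Meaningful for s ≥ 1.
ζ̄ : ℕ → ℝ
ζ̄ s = limitIf {x = ∑ (alt s)} (1 ℕ.≤? s) (cauchy-ζ̄ s)

-- Meaningful for admissible lists.
ζ⋆ : List Index → ℝ
ζ⋆ ss = limitIf {x = ζ⋆-partial ss} (admissible? ss) (cauchy-ζ⋆ ss)

-- ln 2 = ∫₁² dt/t, as the limit of the right Riemann sums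
-- ∑_{j=1}^{N} (1/N) · 1/(1 + j/N) = ∑_{j=1}^{N} 1/(N + j) = H (2N) - H N.
ln2 : ℝ
ln2 = real (λ N → H (2 ℕ.* N) - H N) cauchy-ln2

-- Write x = 1/k, y = 1/n.  Multiplying out the finite sum over l on the
-- right-hand side, the product of ζ⋆-partial sums up to N becomes a double sum
-- over n, k ≤ N of (-1)ⁿ⁻¹ H_k times a geometric sum in x² and y².  Off the
-- diagonal this geometric sum is (x²ᵐ⁻² - y²ᵐ⁻²)/(n² - k²) up to a factor, and
-- partial fractions separate it into k⁻²ᵐ and n⁻²ᵐ times combinations of
-- 1/(n - k) and 1/(n + k).  The inner sums ∑ₙ (-1)ⁿ⁻¹/(n ± k) and
-- ∑ₖ H_k/(k ± n) then have closed forms in H, H⁽²⁾ and L, up to tails.  So for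
-- every N the two sides differ, term by term, by tails that are
-- O(H_N / (n (N + 1 - n))); summed over n ≤ N this is O(H_N² / N).  In the second
-- formula ln 2 arises as L_N, while its Riemann sums are L_{2N} by Catalan's identity.

module Submission where

open import Defs

-- The argument is an exact identity of rationals for each N, with every series cut at the same N,
-- so no limits are interchanged; the only limit statement is that an explicit remainder is null.
-- This matters because the pieces diverge separately: the sums of `h k` against 1/(k - n) and 1/(k
-- + n) both contain `h*r N`, which grows like half of H_N², and it cancels in the combinations that
-- partial fractions produce. The two formulas differ in the weight in front of the geometric sum:
-- 1/k for the odd arguments 2l - 1, 1/n for the even arguments 2l. With 1/k the two harmonic sums
-- are added and produce H_n², while L_n cancels. With 1/n they are subtracted, so the squares
-- cancel and L_n survives from the alternating sums. On the diagonal the geometric sum has m - 1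
-- equal terms, and the separated expression, with 1/(n - k) read as 0, misses one more of the same
-- kind. The resulting factor m is the origin of the coefficients 2m + 1 and (2m - 1)/2.

module EulerSums where
  open import Data.Nat as ℕ using (ℕ; zero; suc; z≤n; s≤s; compare; less; equal; greater)
  import Data.Nat.Properties as ℕ
  open import Data.Integer as ℤ using (ℤ; -1ℤ)
  import Data.Integer.Properties as ℤ
  open import Data.Rational using (ℚ; 0ℚ; 1ℚ; ½; _+_; _*_; -_; _-_; _/_; ∣_∣; _≤_; _<_)
  import Data.Rational.Properties as ℚ
  open import Data.Rational.Solver using (module +-*-Solver)
  open import Data.Empty using (⊥-elim)
  open import Data.List using (List; []; _∷_; foldr; map; applyUpTo)
  open import Data.List.Relation.Unary.All using ([]; _∷_)
  open import Data.Product using (∃; _×_; _,_)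
  open import Relation.Binary.PropositionalEquality
  open import Relation.Nullary using (Dec; yes; no)
  open +-*-Solver using (solve; _:=_; _:+_; _:*_; _:-_; :-_; con)
  open Sequences
  open Convergence hiding (r; 0≤r; r-inverse; B; D)

  -- r 0 = 0 computes, while the reciprocals themselves never unfold to
  -- normalised fractions.
  opaque
    1/suc : ℕ → ℚ
    1/suc n = Convergence.r (suc n)

  r : ℕ → ℚ
  r zero    = 0ℚ
  r (suc n) = 1/suc n

  opaque
    unfolding 1/suc

    r≡ : ∀ n → r n ≡ Convergence.r n
    r≡ zero    = refl
    r≡ (suc n) = refl

  r-inverse : ∀ n → r (suc n) * fromℕ (suc n) ≡ 1ℚ
  r-inverse n = trans (cong (_* fromℕ (suc n)) (r≡ (suc n))) (Convergence.r-inverse n)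

  -- Finite sums of rationals

  Σ : (ℕ → ℚ) → ℕ → ℚ
  Σ f zero    = 0ℚ
  Σ f (suc N) = Σ f N + f (suc N)

  ∑≡Σ : ∀ {F : Term} {f} → (∀ n → F (suc n) ≡ f (suc n)) → ∀ N → ∑ F N ≡ Σ f N
  ∑≡Σ eq zero    = refl
  ∑≡Σ eq (suc N) = cong₂ _+_ (∑≡Σ eq N) (eq N)

  Σ-cong : ∀ {f g} N → (∀ n → n ℕ.< N → f (suc n) ≡ g (suc n)) → Σ f N ≡ Σ g N
  Σ-cong zero    eq = refl
  Σ-cong (suc N) eq = cong₂ _+_ (Σ-cong N λ n n<N → eq n (ℕ.m≤n⇒m≤1+n n<N)) (eq N ℕ.≤-refl)

  Σ-+ : ∀ f g N → Σ (λ n → f n + g n) N ≡ Σ f N + Σ g N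
  Σ-+ f g zero    = refl
  Σ-+ f g (suc N) = trans (cong (_+ (f (suc N) + g (suc N))) (Σ-+ f g N))
    (solve 4 (λ a b c d → (a :+ b) :+ (c :+ d) := (a :+ c) :+ (b :+ d)) refl
      (Σ f N) (Σ g N) (f (suc N)) (g (suc N)))

  Σ-* : ∀ c f N → Σ (λ n → c * f n) N ≡ c * Σ f N
  Σ-* c f zero    = sym (ℚ.*-zeroʳ c)
  Σ-* c f (suc N) = trans (cong (_+ c * f (suc N)) (Σ-* c f N))
    (sym (ℚ.*-distribˡ-+ c (Σ f N) (f (suc N))))

  Σ-0 : ∀ N → Σ (λ _ → 0ℚ) N ≡ 0ℚ
  Σ-0 zero    = refl
  Σ-0 (suc N) = trans (ℚ.+-identityʳ _) (Σ-0 N)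

  Σ-swap : ∀ (f : ℕ → ℕ → ℚ) M N → Σ (λ n → Σ (f n) M) N ≡ Σ (λ k → Σ (λ n → f n k) N) M
  Σ-swap f M zero    = sym (Σ-0 M)
  Σ-swap f M (suc N) = trans (cong (_+ Σ (f (suc N)) M) (Σ-swap f M N))
    (sym (Σ-+ (λ k → Σ (λ n → f n k) N) (f (suc N)) M))

  Σ-first : ∀ f N → Σ f (suc N) ≡ f 1 + Σ (λ n → f (suc n)) N
  Σ-first f zero    = ℚ.+-comm 0ℚ (f 1)
  Σ-first f (suc N) = trans (cong (_+ f (suc (suc N))) (Σ-first f N))
    (ℚ.+-assoc (f 1) (Σ (λ n → f (suc n)) N) (f (suc (suc N))))

  -- Partial fractions in `d` fail on the diagonal, where `d` is 0 by convention. This lets such an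
  -- identity be summed over the whole range, at the price of its defect at the one bad index.
  Σ-except : ∀ {f g} k N → k ℕ.< N → (∀ n → n ≢ k → f (suc n) ≡ g (suc n)) →
    Σ f N ≡ Σ g N + (f (suc k) - g (suc k))
  Σ-except {f} {g} k (suc N) (s≤s k≤N) eq with N ℕ.≟ k
  ... | yes refl = trans
    (cong (_+ f (suc N)) (Σ-cong {f} {g} N λ n n<N → eq n (ℕ.<⇒≢ n<N)))
    (solve 3 (λ a b c → a :+ b := (a :+ c) :+ (b :- c)) refl (Σ g N) (f (suc N)) (g (suc N)))
  ... | no N≢k = trans
    (cong₂ _+_ (Σ-except {f} {g} k N (ℕ.≤∧≢⇒< k≤N (≢-sym N≢k)) eq) (eq N N≢k))
    (solve 3 (λ a b c → (a :+ b) :+ c := (a :+ c) :+ b) refl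
      (Σ g N) (f (suc k) - g (suc k)) (g (suc N)))

  Σ-mono : ∀ {f g} N → (∀ n → n ℕ.< N → f (suc n) ≤ g (suc n)) → Σ f N ≤ Σ g N
  Σ-mono zero    f≤g = ℚ.≤-refl
  Σ-mono (suc N) f≤g = ℚ.+-mono-≤ (Σ-mono N λ n n<N → f≤g n (ℕ.m≤n⇒m≤1+n n<N)) (f≤g N ℕ.≤-refl)

  ∣Σ∣≤ : ∀ f N → ∣ Σ f N ∣ ≤ Σ (λ n → ∣ f n ∣) N
  ∣Σ∣≤ f zero    = ℚ.≤-refl
  ∣Σ∣≤ f (suc N) = ℚ.≤-trans (ℚ.∣p+q∣≤∣p∣+∣q∣ (Σ f N) (f (suc N)))
    (ℚ.+-monoˡ-≤ ∣ f (suc N) ∣ (∣Σ∣≤ f N))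

  -- s n = (-1)ⁿ⁻¹, with s 0 = -1
  s : ℕ → ℚ
  s zero    = - 1ℚ
  s (suc n) = - s n

  s*s : ∀ n → s n * s n ≡ 1ℚ
  s*s zero    = refl
  s*s (suc n) = trans (solve 1 (λ a → (:- a) :* (:- a) := a :* a) refl (s n)) (s*s n)

  -- Since `s n` is minus the n-th power of -1, a product of two values carries one sign too many.
  s-+ : ∀ n k → s (n ℕ.+ k) ≡ - (s n * s k)
  s-+ zero    k = solve 1 (λ a → a := :- (:- con 1ℚ :* a)) refl (s k)
  s-+ (suc n) k = trans (cong -_ (s-+ n k))
    (solve 2 (λ a b → :- (:- (a :* b)) := :- (:- a :* b)) refl (s n) (s k))

  -- Harmonic numbers, and reciprocals of sums and differences

  h h₂ l : ℕ → ℚ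
  h  = Σ r
  h₂ = Σ (λ n → r n * r n)
  l  = Σ (λ n → s n * r n)

  fromℕ-+ : ∀ a b → fromℕ (a ℕ.+ b) ≡ fromℕ a + fromℕ b
  fromℕ-+ zero    b = sym (ℚ.+-identityˡ (fromℕ b))
  fromℕ-+ (suc a) b = begin
    fromℕ (suc (a ℕ.+ b))         ≡⟨ fromℕ-suc (a ℕ.+ b) ⟩
    1ℚ + fromℕ (a ℕ.+ b)          ≡⟨ cong (_+_ 1ℚ) (fromℕ-+ a b) ⟩
    1ℚ + (fromℕ a + fromℕ b)      ≡⟨ sym (ℚ.+-assoc 1ℚ (fromℕ a) (fromℕ b)) ⟩
    (1ℚ + fromℕ a) + fromℕ b      ≡⟨ cong (_+ fromℕ b) (sym (fromℕ-suc a)) ⟩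
    fromℕ (suc a) + fromℕ b ∎
    where open ≡-Reasoning

  -- Padding the summands with `v * b` and `u * a`, both equal to 1, turns `u + v` into
  -- `u * v * (a + b)`. Reciprocals enter only through their defining equations, so polynomial
  -- identities suffice.
  recip-sum : ∀ u v w a b → u * a ≡ 1ℚ → v * b ≡ 1ℚ → w * (a + b) ≡ 1ℚ → w * (u + v) ≡ u * v
  recip-sum u v w a b ua vb wab = begin
    w * (u + v)                        ≡⟨ cong₂ (λ p q → w * (p + q)) (sym (ℚ.*-identityʳ u)) (sym (ℚ.*-identityʳ v)) ⟩
    w * (u * 1ℚ + v * 1ℚ)              ≡⟨ cong₂ (λ p q → w * (u * p + v * q)) (sym vb) (sym ua) ⟩
    w * (u * (v * b) + v * (u * a))    ≡⟨ solve 5 (λ u v w a b → w :* (u :* (v :* b) :+ v :* (u :* a))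
                                            := (u :* v) :* (w :* (a :+ b))) refl u v w a b ⟩
    (u * v) * (w * (a + b))            ≡⟨ cong ((u * v) *_) wab ⟩
    (u * v) * 1ℚ                       ≡⟨ ℚ.*-identityʳ (u * v) ⟩
    u * v ∎
    where open ≡-Reasoning

  r-sum : ∀ a b → r (suc a ℕ.+ suc b) * (r (suc a) + r (suc b)) ≡ r (suc a) * r (suc b)
  r-sum a b = recip-sum (r (suc a)) (r (suc b)) (r (suc a ℕ.+ suc b)) (fromℕ (suc a)) (fromℕ (suc b))
    (r-inverse a) (r-inverse b)
    (trans (cong (r (suc a ℕ.+ suc b) *_) (sym (fromℕ-+ (suc a) (suc b)))) (r-inverse (a ℕ.+ suc b)))

  -- d n k = 1/(n - k) for n ≢ k, and 0 on the diagonal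
  d : ℕ → ℕ → ℚ
  d n k = r (n ℕ.∸ k) - r (k ℕ.∸ n)

  d-diag : ∀ n → d n n ≡ 0ℚ
  d-diag n = ℚ.+-inverseʳ (r (n ℕ.∸ n))

  d-antisym : ∀ n k → d n k ≡ - d k n
  d-antisym n k = solve 2 (λ a b → a :- b := :- (b :- a)) refl (r (n ℕ.∸ k)) (r (k ℕ.∸ n))

  d-+ : ∀ t n → d (t ℕ.+ n) n ≡ r t
  d-+ t n = trans
    (cong₂ (λ a b → r a - r b) (ℕ.m+n∸n≡m t n) (ℕ.m≤n⇒m∸n≡0 (ℕ.m≤n+m n t)))
    (solve 1 (λ a → a :- con 0ℚ := a) refl (r t))

  -- This is `r-sum` for the summands `suc j` and `suc b` of `suc a`.
  d-recip-above : ∀ b j → let a = suc (b ℕ.+ j) in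
    d (suc a) (suc b) * (r (suc b) - r (suc a)) ≡ r (suc a) * r (suc b)
  d-recip-above b j = subst (λ a → d (suc a) (suc b) * (r (suc b) - r (suc a)) ≡ r (suc a) * r (suc b))
    (trans (ℕ.+-suc j b) (cong suc (ℕ.+-comm j b))) (begin
    d (suc (j ℕ.+ suc b)) (suc b) * (y - w)   ≡⟨ cong (_* (y - w)) (d-+ (suc j) (suc b)) ⟩
    x * (y - w)                               ≡⟨ solve 3 (λ x y w → x :* (y :- w) := x :* y :- w :* x) refl x y w ⟩
    x * y - w * x                             ≡⟨ cong (_- w * x) (sym (r-sum j b)) ⟩
    w * (x + y) - w * x                       ≡⟨ solve 3 (λ x y w → w :* (x :+ y) :- w :* x := w :* y) refl x y w ⟩
    w * y ∎)
    where
    open ≡-Reasoning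
    x y w : ℚ
    x = r (suc j)
    y = r (suc b)
    w = r (suc j ℕ.+ suc b)

  d-recip : ∀ a b → a ≢ b → d (suc a) (suc b) * (r (suc b) - r (suc a)) ≡ r (suc a) * r (suc b)
  d-recip a b a≢b with compare a b
  ... | equal _     = ⊥-elim (a≢b refl)
  ... | greater b j = d-recip-above b j
  ... | less a j    = begin
    d (suc a) k * (v - u)       ≡⟨ cong (_* (v - u)) (d-antisym (suc a) k) ⟩
    (- d k (suc a)) * (v - u)   ≡⟨ solve 3 (λ e u v → (:- e) :* (v :- u) := e :* (u :- v)) refl (d k (suc a)) u v ⟩
    d k (suc a) * (u - v)       ≡⟨ d-recip-above a j ⟩
    v * u                       ≡⟨ ℚ.*-comm v u ⟩
    u * v ∎
    where
    open ≡-Reasoning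
    k : ℕ
    k = suc (suc (a ℕ.+ j))
    u v : ℚ
    u = r (suc a)
    v = r k

  -- Putting n = k + j or n = k - j makes `s n` equal to `- s k * s j`. The terms above k give
  -- `- s k * l t`; those below give `s k * l (k - 1)`, which is `s k * l k - r k`. The upper limit
  -- is t + k so that lowering both arguments of `d` by one reduces k + 1 to k with the same t.
  Σ-s*d : ∀ t k → Σ (λ n → s n * d n k) (t ℕ.+ k) ≡ - (s k * (l t - l k)) - r k
  Σ-s*d t zero = begin
    Σ (λ n → s n * d n 0) (t ℕ.+ 0)       ≡⟨ cong (Σ (λ n → s n * d n 0)) (ℕ.+-identityʳ t) ⟩
    Σ (λ n → s n * d n 0) t               ≡⟨ Σ-cong t (λ n _ → solve 2 (λ a b → a :* (b :- con 0ℚ) := a :* b)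
                                               refl (s (suc n)) (r (suc n))) ⟩
    l t                                   ≡⟨ solve 1 (λ a → a := :- ((:- con 1ℚ) :* (a :- con 0ℚ)) :- con 0ℚ)
                                               refl (l t) ⟩
    - (s 0 * (l t - l 0)) - r 0 ∎
    where open ≡-Reasoning
  Σ-s*d t (suc k) = begin
    Σ f (t ℕ.+ suc k)
      ≡⟨ cong (Σ f) (ℕ.+-suc t k) ⟩
    Σ f (suc (t ℕ.+ k))
      ≡⟨ Σ-first f (t ℕ.+ k) ⟩
    1ℚ * d 0 k + Σ (λ n → - s n * d n k) (t ℕ.+ k)
      ≡⟨ cong₂ _+_ (cong (λ e → 1ℚ * (e - r k)) (cong r (ℕ.0∸n≡0 k)))
           (trans (Σ-cong (t ℕ.+ k) (λ n _ → solve 2 (λ a b → (:- a) :* b := (:- con 1ℚ) :* (a :* b)) refl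
                      (s (suc n)) (d (suc n) k)))
             (trans (Σ-* (- 1ℚ) (λ n → s n * d n k) (t ℕ.+ k)) (cong (- 1ℚ *_) (Σ-s*d t k)))) ⟩
    1ℚ * (0ℚ - r k) + - 1ℚ * (- (s k * (l t - l k)) - r k)
      ≡⟨ solve 5 (λ σ a b x y → con 1ℚ :* (con 0ℚ :- x) :+ (:- con 1ℚ) :* (:- (σ :* (a :- b)) :- x)
           := σ :* (a :- b) :+ con 1ℚ :* y :- y) refl (s k) (l t) (l k) (r k) (r (suc k)) ⟩
    s k * (l t - l k) + 1ℚ * r (suc k) - r (suc k)
      -- The new term gets the coefficient `s k * s k`, so that it is absorbed into `l (suc k)`
      -- under the common factor `s k`.
      ≡⟨ cong (λ q → s k * (l t - l k) + q * r (suc k) - r (suc k)) (sym (s*s k)) ⟩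
    s k * (l t - l k) + s k * s k * r (suc k) - r (suc k)
      ≡⟨ solve 4 (λ σ a b y → σ :* (a :- b) :+ σ :* σ :* y :- y
           := :- ((:- σ) :* (a :- (b :+ (:- σ) :* y))) :- y) refl (s k) (l t) (l k) (r (suc k)) ⟩
    - (s (suc k) * (l t - l (suc k))) - r (suc k) ∎
    where
    open ≡-Reasoning
    f : ℕ → ℚ
    f n = s n * d n (suc k)

  -- Because `s n` is `- s k * s (n + k)`, these are, up to the factor `- s k`, the terms of `l`
  -- with indices from k + 1 to N + k.
  Σ-s*r+ : ∀ N k → Σ (λ n → s n * r (n ℕ.+ k)) N ≡ - (s k * (l (N ℕ.+ k) - l k))
  Σ-s*r+ zero    k = solve 2 (λ σ a → con 0ℚ := :- (σ :* (a :- a))) refl (s k) (l k)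
  Σ-s*r+ (suc N) k = begin
    Σ (λ n → s n * r (n ℕ.+ k)) N + σ′ * x
      ≡⟨ cong₂ (λ a b → a + b * x) (Σ-s*r+ N k) (sym (ℚ.*-identityʳ σ′)) ⟩
    - (s k * (a - b)) + σ′ * 1ℚ * x
      ≡⟨ cong (λ q → - (s k * (a - b)) + σ′ * q * x) (sym (s*s k)) ⟩
    - (s k * (a - b)) + σ′ * (s k * s k) * x
      ≡⟨ solve 5 (λ σ τ a b x → :- (σ :* (a :- b)) :+ τ :* (σ :* σ) :* x
           := :- (σ :* ((a :+ (:- (τ :* σ)) :* x) :- b))) refl (s k) σ′ a b x ⟩
    - (s k * ((a + - (σ′ * s k) * x) - b))
      ≡⟨ cong (λ q → - (s k * ((a + q * x) - b))) (sym (s-+ (suc N) k)) ⟩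
    - (s k * (l (suc N ℕ.+ k) - b)) ∎
    where
    open ≡-Reasoning
    σ′ x a b : ℚ
    σ′ = s (suc N)
    x = r (suc N ℕ.+ k)
    a = l (N ℕ.+ k)
    b = l k

  Σ-r+ : ∀ N k → Σ (λ n → r (k ℕ.+ n)) N ≡ h (k ℕ.+ N) - h k
  Σ-r+ zero    k = trans (sym (ℚ.+-inverseʳ (h k))) (cong (λ i → h i - h k) (sym (ℕ.+-identityʳ k)))
  Σ-r+ (suc N) k = begin
    Σ (λ n → r (k ℕ.+ n)) N + r (k ℕ.+ suc N)    ≡⟨ cong₂ _+_ (Σ-r+ N k) (cong r (ℕ.+-suc k N)) ⟩
    h (k ℕ.+ N) - h k + r (suc (k ℕ.+ N))        ≡⟨ solve 3 (λ a b c → a :- b :+ c := a :+ c :- b) refl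
                                                      (h (k ℕ.+ N)) (h k) (r (suc (k ℕ.+ N))) ⟩
    h (suc (k ℕ.+ N)) - h k                      ≡⟨ cong (λ i → h i - h k) (sym (ℕ.+-suc k N)) ⟩
    h (k ℕ.+ suc N) - h k ∎
    where open ≡-Reasoning

  -- The terms above k sum to `h t`, those below to minus `h (k - 1)`; the final `r k` makes up for
  -- the index k. At k = 0 it vanishes because `r 0` is 0.
  Σ-d : ∀ t k → Σ (λ n → d n k) (t ℕ.+ k) ≡ h t - h k + r k
  Σ-d t zero = begin
    Σ (λ n → d n 0) (t ℕ.+ 0)     ≡⟨ cong (Σ (λ n → d n 0)) (ℕ.+-identityʳ t) ⟩
    Σ (λ n → d n 0) t             ≡⟨ Σ-cong t (λ n _ → ℚ.+-identityʳ (r (suc n))) ⟩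
    h t                           ≡⟨ solve 1 (λ a → a := a :- con 0ℚ :+ con 0ℚ) refl (h t) ⟩
    h t - h 0 + r 0 ∎
    where open ≡-Reasoning
  Σ-d t (suc k) = begin
    Σ (λ n → d n (suc k)) (t ℕ.+ suc k)       ≡⟨ cong (Σ (λ n → d n (suc k))) (ℕ.+-suc t k) ⟩
    Σ (λ n → d n (suc k)) (suc (t ℕ.+ k))     ≡⟨ Σ-first (λ n → d n (suc k)) (t ℕ.+ k) ⟩
    d 0 k + Σ (λ n → d n k) (t ℕ.+ k)         ≡⟨ cong₂ _+_ (cong (λ i → r i - r k) (ℕ.0∸n≡0 k)) (Σ-d t k) ⟩
    (0ℚ - r k) + (h t - h k + r k)            ≡⟨ solve 4 (λ a b x y → (con 0ℚ :- x) :+ (a :- b :+ x)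
                                                   := a :- (b :+ y) :+ y) refl (h t) (h k) (r k) (r (suc k)) ⟩
    h t - h (suc k) + r (suc k) ∎
    where open ≡-Reasoning

  -- Harmonic sums against 1/(k - n) and 1/(k + n)

  P Q : ℕ → ℕ → ℚ
  P N n = Σ (λ k → h k * d k n) N
  Q N n = Σ (λ k → h k * r (n ℕ.+ k)) N

  h*r : ℕ → ℚ
  h*r = Σ (λ k → h k * r k)

  -- Summation by parts: replacing k by k + 1 turns 1/(k - n - 1) into 1/(k - n). The increment of
  -- `h` contributes the last sum, the upper end of the range the boundary term.
  P-shift : ∀ n N → P N (suc n) ≡ P N n - h N * d N n + Σ (λ j → r j * d j (suc n)) N
  P-shift n zero = solve 1 (λ e → con 0ℚ := con 0ℚ :- con 0ℚ :* e :+ con 0ℚ) refl (d 0 n)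
  P-shift n (suc N) = begin
    P N (suc n) + (h N + x) * d N n
      ≡⟨ cong (_+ (h N + x) * d N n) (P-shift n N) ⟩
    P N n - h N * d N n + Σ (λ j → r j * d j (suc n)) N + (h N + x) * d N n
      ≡⟨ solve 6 (λ p y x e e′ z → p :- y :* e :+ z :+ (y :+ x) :* e
           := (p :+ (y :+ x) :* e′) :- (y :+ x) :* e′ :+ (z :+ x :* e)) refl
           (P N n) (h N) x (d N n) (d (suc N) n) (Σ (λ j → r j * d j (suc n)) N) ⟩
    P (suc N) n - h (suc N) * d (suc N) n + Σ (λ j → r j * d j (suc n)) (suc N) ∎
    where
    open ≡-Reasoning
    x : ℚ
    x = r (suc N)

  Q-shift : ∀ n N → Q N (suc n) ≡ Q N n + h N * r (suc n ℕ.+ N) - Σ (λ j → r j * r (n ℕ.+ j)) N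
  Q-shift n zero = solve 1 (λ e → con 0ℚ := con 0ℚ :+ con 0ℚ :* e :- con 0ℚ) refl (r (suc n ℕ.+ 0))
  Q-shift n (suc N) = begin
    Q N (suc n) + (h N + x) * r (suc n ℕ.+ suc N)
      ≡⟨ cong (_+ (h N + x) * r (suc n ℕ.+ suc N)) (Q-shift n N) ⟩
    Q N n + h N * r (suc n ℕ.+ N) - z + (h N + x) * e′
      ≡⟨ cong (λ e → Q N n + h N * e - z + (h N + x) * e′) (cong r (sym (ℕ.+-suc n N))) ⟩
    Q N n + h N * e - z + (h N + x) * e′
      ≡⟨ solve 6 (λ p y x e e′ z → p :+ y :* e :- z :+ (y :+ x) :* e′
           := (p :+ (y :+ x) :* e) :+ (y :+ x) :* e′ :- (z :+ x :* e)) refl (Q N n) (h N) x e e′ z ⟩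
    Q (suc N) n + h (suc N) * e′ - Σ (λ j → r j * r (n ℕ.+ j)) (suc N) ∎
    where
    open ≡-Reasoning
    x e e′ z : ℚ
    x = r (suc N)
    e = r (n ℕ.+ suc N)
    e′ = r (suc n ℕ.+ suc N)
    z = Σ (λ j → r j * r (n ℕ.+ j)) N

  Σ-r*r+ : ∀ n N → Σ (λ j → r j * r (suc n ℕ.+ j)) N ≡ r (suc n) * (h N - (h (suc n ℕ.+ N) - h (suc n)))
  Σ-r*r+ n N = begin
    Σ (λ j → r j * r (suc n ℕ.+ j)) N
      ≡⟨ Σ-cong N (λ j _ → pointwise j) ⟩
    Σ (λ j → y * (r j + - 1ℚ * r (suc n ℕ.+ j))) N
      ≡⟨ Σ-* y (λ j → r j + - 1ℚ * r (suc n ℕ.+ j)) N ⟩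
    y * Σ (λ j → r j + - 1ℚ * r (suc n ℕ.+ j)) N
      ≡⟨ cong (y *_) (trans (Σ-+ r (λ j → - 1ℚ * r (suc n ℕ.+ j)) N)
           (cong (h N +_) (trans (Σ-* (- 1ℚ) (λ j → r (suc n ℕ.+ j)) N) (cong (- 1ℚ *_) (Σ-r+ N (suc n)))))) ⟩
    y * (h N + - 1ℚ * (h (suc n ℕ.+ N) - h (suc n)))
      ≡⟨ solve 3 (λ y a b → y :* (a :+ (:- con 1ℚ) :* b) := y :* (a :- b)) refl
           y (h N) (h (suc n ℕ.+ N) - h (suc n)) ⟩
    y * (h N - (h (suc n ℕ.+ N) - h (suc n))) ∎
    where
    open ≡-Reasoning
    y : ℚ
    y = r (suc n)
    pointwise : ∀ j → r (suc j) * r (suc n ℕ.+ suc j) ≡ y * (r (suc j) + - 1ℚ * r (suc n ℕ.+ suc j))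
    pointwise j = begin
      x * e                      ≡⟨ solve 3 (λ x y e → x :* e := e :* (y :+ x) :- y :* e) refl x y e ⟩
      e * (y + x) - y * e        ≡⟨ cong (_- y * e) (r-sum n j) ⟩
      y * x - y * e              ≡⟨ solve 3 (λ x y e → y :* x :- y :* e := y :* (x :+ (:- con 1ℚ) :* e)) refl x y e ⟩
      y * (x + - 1ℚ * e) ∎
      where
      x e : ℚ
      x = r (suc j)
      e = r (suc n ℕ.+ suc j)

  Σ-d≤ : ∀ {n N} → n ℕ.≤ N → Σ (λ j → d j n) N ≡ h (N ℕ.∸ n) - h n + r n
  Σ-d≤ {n} {N} n≤N = trans (cong (Σ (λ j → d j n)) (sym (ℕ.m∸n+n≡m n≤N))) (Σ-d (N ℕ.∸ n) n)

  -- Partial fractions give `r (suc n) * (d j (suc n) - r j)` for each term except j = n + 1, where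
  -- the true term is 0 and the formula yields minus the square of `r (suc n)`. Correcting this is
  -- the last `r (suc n)` in the bracket; the earlier one comes from `Σ-d≤`.
  Σ-r*d : ∀ {n N} → n ℕ.< N → Σ (λ j → r j * d j (suc n)) N ≡
    r (suc n) * (h (N ℕ.∸ suc n) - h (suc n) + r (suc n) - h N + r (suc n))
  Σ-r*d {n} {N} n<N = begin
    Σ (λ j → r j * d j (suc n)) N
      ≡⟨ Σ-except {λ j → r j * d j (suc n)} {λ j → y * (d j (suc n) + - 1ℚ * r j)} n N n<N pointwise ⟩
    Σ (λ j → y * (d j (suc n) + - 1ℚ * r j)) N + (y * d (suc n) (suc n) - y * (d (suc n) (suc n) + - 1ℚ * y))
      ≡⟨ cong₂ (λ a e → a + (y * e - y * (e + - 1ℚ * y)))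
           (trans (Σ-* y (λ j → d j (suc n) + - 1ℚ * r j) N)
             (cong (y *_) (trans (Σ-+ (λ j → d j (suc n)) (λ j → - 1ℚ * r j) N)
               (cong₂ _+_ (Σ-d≤ n<N) (Σ-* (- 1ℚ) r N)))))
           (d-diag (suc n)) ⟩
    y * (z + - 1ℚ * h N) + (y * 0ℚ - y * (0ℚ + - 1ℚ * y))
      ≡⟨ solve 3 (λ y z a → y :* (z :+ (:- con 1ℚ) :* a) :+ (y :* con 0ℚ :- y :* (con 0ℚ :+ (:- con 1ℚ) :* y))
           := y :* (z :- a :+ y)) refl y z (h N) ⟩
    y * (z - h N + y) ∎
    where
    open ≡-Reasoning
    y z : ℚ
    y = r (suc n)
    z = h (N ℕ.∸ suc n) - h (suc n) + y
    pointwise : ∀ j → j ≢ n → r (suc j) * d (suc j) (suc n) ≡ y * (d (suc j) (suc n) + - 1ℚ * r (suc j))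
    pointwise j j≢n = begin
      x * e                   ≡⟨ solve 3 (λ x y e → x :* e := y :* e :- e :* (y :- x)) refl x y e ⟩
      y * e - e * (y - x)     ≡⟨ cong (_-_ (y * e)) (d-recip j n j≢n) ⟩
      y * e - x * y           ≡⟨ solve 3 (λ x y e → y :* e :- x :* y := y :* (e :+ (:- con 1ℚ) :* x)) refl x y e ⟩
      y * (e + - 1ℚ * x) ∎
      where
      x e : ℚ
      x = r (suc j)
      e = d (suc j) (suc n)

  -- Q-error N n is the tail in the closed form of Q N (suc n), whereas
  -- P-error N n is that of P N n.
  P-error Q-error : ℕ → ℕ → ℚ
  P-error N n = Σ (λ i → r i * (h N - h (N ℕ.∸ i))) n + h N * (h N - h (N ℕ.∸ n))
  Q-error N n = Σ (λ i → r i * (h (i ℕ.+ N) - h N)) n + h N * (h (suc n ℕ.+ N) - h N)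

  ∸-suc : ∀ {n N} → n ℕ.< N → N ℕ.∸ n ≡ suc (N ℕ.∸ suc n)
  ∸-suc {n} {suc N} (s≤s n≤N) = ℕ.+-∸-assoc 1 n≤N

  -- `P N 0` is `h*r N`. Up to the tail, the shift that reaches index n adds
  -- `r n * (2 * r n - h n)`, which is the increment of half of 3 `h₂` minus the square of `h`.
  P-closed : ∀ {n N} → n ℕ.≤ N →
    P N n ≡ h*r N + ½ * ((1ℚ + 1ℚ + 1ℚ) * h₂ n - h n * h n) - P-error N n
  P-closed {zero} {N} _ = trans (Σ-cong N λ k _ → cong (h (suc k) *_) (ℚ.+-identityʳ (r (suc k))))
    (solve 2 (λ a b → a := a :+ con ½ :* ((con 1ℚ :+ con 1ℚ :+ con 1ℚ) :* con 0ℚ :- con 0ℚ :* con 0ℚ)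
      :- (con 0ℚ :+ b :* (b :- b))) refl (h*r N) (h N))
  P-closed {suc n} {N} n<N = begin
    P N (suc n)
      ≡⟨ P-shift n N ⟩
    P N n - hN * d N n + Σ (λ j → r j * d j (suc n)) N
      ≡⟨ cong₂ (λ a b → a - hN * d N n + b) (P-closed (ℕ.<⇒≤ n<N)) (Σ-r*d n<N) ⟩
    h*r N + ½ * (three * h₂ n - h n * h n) - (E + hN * (hN - h (N ℕ.∸ n))) - hN * d N n
      + y * (h t - (h n + y) + y - hN + y)
      -- The boundary term of the shift is `h N` times 1/(N - n), exactly what the tail gains when
      -- `h (N ∸ n)` is replaced by `h (N ∸ suc n)`.
      ≡⟨ cong₂ (λ a b → h*r N + ½ * (three * h₂ n - h n * h n) - (E + hN * (hN - h a)) - hN * b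
           + y * (h t - (h n + y) + y - hN + y))
           (∸-suc n<N) (cong₂ (λ a b → r a - r b) (∸-suc n<N) (ℕ.m≤n⇒m∸n≡0 (ℕ.<⇒≤ n<N))) ⟩
    h*r N + ½ * (three * h₂ n - h n * h n) - (E + hN * (hN - (h t + r (suc t)))) - hN * (r (suc t) - 0ℚ)
      + y * (h t - (h n + y) + y - hN + y)
      ≡⟨ solve 8 (λ S b a E c g w y →
           S :+ con ½ :* ((con 1ℚ :+ con 1ℚ :+ con 1ℚ) :* b :- a :* a) :- (E :+ c :* (c :- (g :+ w)))
             :- c :* (w :- con 0ℚ) :+ y :* (g :- (a :+ y) :+ y :- c :+ y)
           := S :+ con ½ :* ((con 1ℚ :+ con 1ℚ :+ con 1ℚ) :* (b :+ y :* y) :- (a :+ y) :* (a :+ y))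
             :- (E :+ y :* (c :- g) :+ c :* (c :- g))) refl
           (h*r N) (h₂ n) (h n) E hN (h t) (r (suc t)) y ⟩
    h*r N + ½ * (three * h₂ (suc n) - h (suc n) * h (suc n)) - P-error N (suc n) ∎
    where
    open ≡-Reasoning
    t : ℕ
    t = N ℕ.∸ suc n
    hN E y three : ℚ
    hN = h N
    three = 1ℚ + 1ℚ + 1ℚ
    E = Σ (λ i → r i * (hN - h (N ℕ.∸ i))) n
    y = r (suc n)

  -- Again `Q N 0` is `h*r N`. The first shift subtracts `h₂ N`, unlike the others, whence the
  -- offset in the index. Up to the tail, the shift from j to j + 1 with j ≥ 1 subtracts
  -- `r j * h j`, and these add up to half of the square of `h n` plus `h₂ n`.
  Q-closed : ∀ n N → Q N (suc n) ≡ h*r N - h₂ N - ½ * (h n * h n + h₂ n) + Q-error N n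
  Q-closed zero N = trans (Q-shift 0 N)
    (solve 4 (λ S c x b → S :+ c :* x :- b
      := S :- b :- con ½ :* (con 0ℚ :* con 0ℚ :+ con 0ℚ) :+ (con 0ℚ :+ c :* ((c :+ x) :- c))) refl
      (h*r N) (h N) (r (suc N)) (h₂ N))
  Q-closed (suc n) N = begin
    Q N (suc (suc n))
      ≡⟨ Q-shift (suc n) N ⟩
    Q N (suc n) + hN * w - Σ (λ j → r j * r (suc n ℕ.+ j)) N
      ≡⟨ cong₂ (λ a b → a + hN * w - b) (Q-closed n N) (Σ-r*r+ n N) ⟩
    h*r N - h₂ N - ½ * (h n * h n + h₂ n) + (E + hN * (g - hN)) + hN * w - y * (hN - (g - (h n + y)))
      ≡⟨ solve 9 (λ S B b a E c g w y →
           S :- B :- con ½ :* (a :* a :+ b) :+ (E :+ c :* (g :- c)) :+ c :* w :- y :* (c :- (g :- (a :+ y)))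
           := S :- B :- con ½ :* ((a :+ y) :* (a :+ y) :+ (b :+ y :* y))
             :+ (E :+ y :* (g :- c) :+ c :* ((g :+ w) :- c))) refl
           (h*r N) (h₂ N) (h₂ n) (h n) E hN g w y ⟩
    h*r N - h₂ N - ½ * (h (suc n) * h (suc n) + h₂ (suc n)) + Q-error N (suc n) ∎
    where
    open ≡-Reasoning
    hN E y g w : ℚ
    hN = h N
    E = Σ (λ i → r i * (h (i ℕ.+ N) - hN)) n
    y = r (suc n)
    g = h (suc n ℕ.+ N)
    w = r (suc (suc n) ℕ.+ N)

  -- Geometric sums and partial fractions

  infixr 8 _^_

  _^_ : ℚ → ℕ → ℚ
  x ^ zero  = 1ℚ
  x ^ suc n = x * x ^ n

  Σ₀ : (ℕ → ℚ) → ℕ → ℚ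
  Σ₀ f zero    = 0ℚ
  Σ₀ f (suc c) = f 0 + Σ₀ (λ i → f (suc i)) c

  Σ₀-cong : ∀ {f g} c → (∀ i → i ℕ.< c → f i ≡ g i) → Σ₀ f c ≡ Σ₀ g c
  Σ₀-cong zero    eq = refl
  Σ₀-cong (suc c) eq = cong₂ _+_ (eq 0 (s≤s z≤n)) (Σ₀-cong c λ i i<c → eq (suc i) (s≤s i<c))

  Σ₀-* : ∀ a f c → Σ₀ (λ i → a * f i) c ≡ a * Σ₀ f c
  Σ₀-* a f zero    = sym (ℚ.*-zeroʳ a)
  Σ₀-* a f (suc c) = trans (cong (_+_ (a * f 0)) (Σ₀-* a (λ i → f (suc i)) c))
    (sym (ℚ.*-distribˡ-+ a (f 0) (Σ₀ (λ i → f (suc i)) c)))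

  Σ-Σ₀-swap : ∀ (f : ℕ → ℕ → ℚ) N c → Σ₀ (λ i → Σ (f i) N) c ≡ Σ (λ n → Σ₀ (λ i → f i n) c) N
  Σ-Σ₀-swap f N zero    = sym (Σ-0 N)
  Σ-Σ₀-swap f N (suc c) = trans (cong (_+_ (Σ (f 0) N)) (Σ-Σ₀-swap (λ i → f (suc i)) N c))
    (sym (Σ-+ (f 0) (λ n → Σ₀ (λ i → f (suc i) n) c) N))

  -- For a ≠ b this is a b (a^c - b^c)/(a - b). Every summand has total degree c + 1 and at least
  -- one factor of each kind, like the products of zeta values in the theorem.
  geometric : ℚ → ℚ → ℕ → ℚ
  geometric a b c = Σ₀ (λ i → a ^ suc i * b ^ (c ℕ.∸ i)) c

  geometric-suc : ∀ a b c → geometric a b (suc c) ≡ a * b ^ suc c + a * geometric a b c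
  geometric-suc a b c = cong₂ (λ p q → p * b ^ suc c + q) (ℚ.*-identityʳ a)
    (trans (Σ₀-cong c (λ i _ → ℚ.*-assoc a (a ^ suc i) (b ^ (c ℕ.∸ i))))
      (Σ₀-* a (λ i → a ^ suc i * b ^ (c ℕ.∸ i)) c))

  geometric-diag : ∀ a c → geometric a a c ≡ fromℕ c * a ^ suc c
  geometric-diag a zero    = sym (ℚ.*-zeroˡ (a ^ 1))
  geometric-diag a (suc c) = begin
    geometric a a (suc c)                          ≡⟨ geometric-suc a a c ⟩
    a * a ^ suc c + a * geometric a a c            ≡⟨ cong (λ g → a * a ^ suc c + a * g) (geometric-diag a c) ⟩
    a * a ^ suc c + a * (fromℕ c * a ^ suc c)      ≡⟨ solve 3 (λ a p f → a :* p :+ a :* (f :* p)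
                                                        := (con 1ℚ :+ f) :* (a :* p)) refl a (a ^ suc c) (fromℕ c) ⟩
    (1ℚ + fromℕ c) * a ^ suc (suc c)               ≡⟨ cong (_* a ^ suc (suc c)) (sym (fromℕ-suc c)) ⟩
    fromℕ (suc c) * a ^ suc (suc c) ∎
    where open ≡-Reasoning

  -- w (a - b)⁻¹ = B/a = A/b, so this is the closed form of a geometric sum.
  geometric-closed : ∀ {a b w} A B → a * A ≡ b * B → (a - b) * B ≡ w * a →
    ∀ c → w * geometric a b c ≡ a ^ suc c * A - b ^ suc c * B
  geometric-closed {a} {b} {w} A B aA wa zero = sym (begin
    a ^ 1 * A - b ^ 1 * B     ≡⟨ solve 4 (λ a b A B → a :* con 1ℚ :* A :- b :* con 1ℚ :* B := a :* A :- b :* B)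
                                   refl a b A B ⟩
    a * A - b * B             ≡⟨ cong (_- b * B) aA ⟩
    b * B - b * B             ≡⟨ solve 2 (λ w p → p :- p := w :* con 0ℚ) refl w (b * B) ⟩
    w * 0ℚ ∎)
    where open ≡-Reasoning
  geometric-closed {a} {b} {w} A B aA wa (suc c) = begin
    w * geometric a b (suc c)
      ≡⟨ cong (w *_) (geometric-suc a b c) ⟩
    w * (a * q + a * geometric a b c)
      ≡⟨ solve 4 (λ w a q g → w :* (a :* q :+ a :* g) := (w :* a) :* q :+ a :* (w :* g)) refl
           w a q (geometric a b c) ⟩
    (w * a) * q + a * (w * geometric a b c)
      ≡⟨ cong₂ (λ u v → u * q + a * v) (sym wa) (geometric-closed {a} {b} {w} A B aA wa c) ⟩
    ((a - b) * B) * q + a * (p * A - q * B)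
      ≡⟨ solve 6 (λ a b p q A B → ((a :- b) :* B) :* q :+ a :* (p :* A :- q :* B)
           := (a :* p) :* A :- (b :* q) :* B) refl a b p q A B ⟩
    a ^ suc (suc c) * A - b ^ suc (suc c) * B ∎
    where
    open ≡-Reasoning
    p q : ℚ
    p = a ^ suc c
    q = b ^ suc c

  -- With x = 1/k, y = 1/n, d = 1/(n - k) and e = 1/(n + k), the factor `½ * (d - e)` is k/(n² -
  -- k²), and x² - y² is (n² - k²)/(n² k²). In `sum-kernel` the factor is n/(n² - k²) instead.
  difference-kernel : ∀ x y d e → d * (x - y) ≡ y * x → e * (y + x) ≡ y * x →
    ½ * (d - e) * (x * x - y * y) ≡ x * (y * y)
  difference-kernel x y d e dxy exy = begin
    ½ * (d - e) * (x * x - y * y)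
      ≡⟨ solve 4 (λ x y d e → con ½ :* (d :- e) :* (x :* x :- y :* y)
           := con ½ :* (d :* (x :- y) :* (x :+ y) :- e :* (y :+ x) :* (x :- y))) refl x y d e ⟩
    ½ * (d * (x - y) * (x + y) - e * (y + x) * (x - y))
      ≡⟨ cong₂ (λ p q → ½ * (p * (x + y) - q * (x - y))) dxy exy ⟩
    ½ * (y * x * (x + y) - y * x * (x - y))
      ≡⟨ solve 2 (λ x y → con ½ :* (y :* x :* (x :+ y) :- y :* x :* (x :- y)) := x :* (y :* y)) refl x y ⟩
    x * (y * y) ∎
    where open ≡-Reasoning

  sum-kernel : ∀ x y d e → d * (x - y) ≡ y * x → e * (y + x) ≡ y * x →
    ½ * (d + e) * (x * x - y * y) ≡ y * (x * x)
  sum-kernel x y d e dxy exy = begin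
    ½ * (d + e) * (x * x - y * y)
      ≡⟨ solve 4 (λ x y d e → con ½ :* (d :+ e) :* (x :* x :- y :* y)
           := con ½ :* (d :* (x :- y) :* (x :+ y) :+ e :* (y :+ x) :* (x :- y))) refl x y d e ⟩
    ½ * (d * (x - y) * (x + y) + e * (y + x) * (x - y))
      ≡⟨ cong₂ (λ p q → ½ * (p * (x + y) + q * (x - y))) dxy exy ⟩
    ½ * (y * x * (x + y) + y * x * (x - y))
      ≡⟨ solve 2 (λ x y → con ½ :* (y :* x :* (x :+ y) :+ y :* x :* (x :- y)) := y :* (x :* x)) refl x y ⟩
    y * (x * x) ∎
    where open ≡-Reasoning

  -- By `difference-kernel`, x² g = y² (x + g) for g = ½ (d - e), so g and x + g serve as the A and
  -- B of `geometric-closed`. For `even-kernel` they are g - y and g with g = ½ (d + e).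
  odd-kernel : ∀ x y d e → d * (x - y) ≡ y * x → e * (y + x) ≡ y * x → ∀ c →
    x * geometric (x * x) (y * y) c ≡
    (x * x) ^ suc c * (½ * (d - e)) - (y * y) ^ suc c * (x + ½ * (d - e))
  odd-kernel x y d e dxy exy = geometric-closed {w = x} g (x + g)
    (trans (solve 3 (λ a b g → a :* g := g :* (a :- b) :+ b :* g) refl (x * x) (y * y) g)
      (trans (cong (_+ y * y * g) kernel)
        (solve 3 (λ x b g → x :* b :+ b :* g := b :* (x :+ g)) refl x (y * y) g)))
    (trans (solve 4 (λ x a b g → (a :- b) :* (x :+ g) := x :* (a :- b) :+ g :* (a :- b)) refl x (x * x) (y * y) g)
      (trans (cong (_+_ (x * (x * x - y * y))) kernel)
        (solve 3 (λ x a b → x :* (a :- b) :+ x :* b := x :* a) refl x (x * x) (y * y))))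
    where
    g : ℚ
    g = ½ * (d - e)
    kernel : g * (x * x - y * y) ≡ x * (y * y)
    kernel = difference-kernel x y d e dxy exy

  even-kernel : ∀ x y d e → d * (x - y) ≡ y * x → e * (y + x) ≡ y * x → ∀ c →
    y * geometric (x * x) (y * y) c ≡
    (x * x) ^ suc c * (½ * (d + e) - y) - (y * y) ^ suc c * (½ * (d + e))
  even-kernel x y d e dxy exy = geometric-closed {w = y} (g - y) g
    (trans (solve 4 (λ y a b g → a :* (g :- y) := g :* (a :- b) :+ b :* g :- y :* a) refl y (x * x) (y * y) g)
      (trans (cong (λ k → k + y * y * g - y * (x * x)) kernel)
        (solve 3 (λ y a b → a :+ b :- a := b) refl y (y * (x * x)) (y * y * g))))
    (trans (ℚ.*-comm (x * x - y * y) g) kernel)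
    where
    g : ℚ
    g = ½ * (d + e)
    kernel : g * (x * x - y * y) ≡ y * (x * x)
    kernel = sum-kernel x y d e dxy exy

  -- Separating the double sums

  ΣΣ-diagonal : ∀ (K R : ℕ → ℕ → ℚ) (D : ℕ → ℚ) →
    (∀ n k → k ≢ n → K (suc n) (suc k) ≡ R (suc n) (suc k)) →
    (∀ n → K (suc n) (suc n) - R (suc n) (suc n) ≡ D (suc n)) →
    ∀ N → Σ (λ n → Σ (K n) N) N ≡ Σ (λ n → Σ (R n) N) N + Σ D N
  ΣΣ-diagonal K R D off diag N = trans
    (Σ-cong N λ n n<N → trans (Σ-except {K (suc n)} {R (suc n)} n N n<N (off n))
      (cong (_+_ (Σ (R (suc n)) N)) (diag n)))
    (Σ-+ (λ n → Σ (R n) N) D N)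

  Σ-linear₃ : ∀ a b c f g e N → Σ (λ n → a * f n + b * g n + c * e n) N ≡ a * Σ f N + b * Σ g N + c * Σ e N
  Σ-linear₃ a b c f g e N = trans (Σ-+ (λ n → a * f n + b * g n) (λ n → c * e n) N)
    (cong₂ _+_ (trans (Σ-+ (λ n → a * f n) (λ n → b * g n) N) (cong₂ _+_ (Σ-* a f N) (Σ-* b g N))) (Σ-* c e N))

  alternating : ℕ → ℕ → ℚ
  alternating N k = Σ (λ n → s n * d n k) N

  alternating⁺ : ℕ → ℕ → ℚ
  alternating⁺ N k = Σ (λ n → s n * r (n ℕ.+ k)) N

  -- Terms whose coefficient depends on k are summed over n first, giving alternating sums; those
  -- whose coefficient depends on n are summed over k first, giving harmonic sums. Renaming the
  -- outer index makes both parts a single sum.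
  ΣΣ-split : ∀ (a b c a′ b′ c′ : ℕ → ℚ) N →
    Σ (λ n → Σ (λ k →
      (a k * (s n * d n k) + b k * (s n * r (n ℕ.+ k)) + c k * (s n * r n)) +
      (a′ n * (h k * r k) + b′ n * (h k * d k n) + c′ n * (h k * r (n ℕ.+ k)))) N) N ≡
    Σ (λ n →
      (a n * alternating N n + b n * alternating⁺ N n + c n * l N) +
      (a′ n * h*r N + b′ n * P N n + c′ n * Q N n)) N
  ΣΣ-split a b c a′ b′ c′ N = begin
    Σ (λ n → Σ (λ k → U n k + V n k) N) N
      ≡⟨ Σ-cong N (λ n _ → Σ-+ (U (suc n)) (V (suc n)) N) ⟩
    Σ (λ n → Σ (U n) N + Σ (V n) N) N
      ≡⟨ Σ-+ (λ n → Σ (U n) N) (λ n → Σ (V n) N) N ⟩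
    Σ (λ n → Σ (U n) N) N + Σ (λ n → Σ (V n) N) N
      ≡⟨ cong₂ _+_
           (trans (Σ-swap U N N) (Σ-cong N λ k _ → Σ-linear₃ (a (suc k)) (b (suc k)) (c (suc k))
             (λ n → s n * d n (suc k)) (λ n → s n * r (n ℕ.+ suc k)) (λ n → s n * r n) N))
           (Σ-cong N λ n _ → Σ-linear₃ (a′ (suc n)) (b′ (suc n)) (c′ (suc n))
             (λ k → h k * r k) (λ k → h k * d k (suc n)) (λ k → h k * r (suc n ℕ.+ k)) N) ⟩
    Σ (λ n → a n * alternating N n + b n * alternating⁺ N n + c n * l N) N +
    Σ (λ n → a′ n * h*r N + b′ n * P N n + c′ n * Q N n) N
      ≡⟨ sym (Σ-+ (λ n → a n * alternating N n + b n * alternating⁺ N n + c n * l N)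
           (λ n → a′ n * h*r N + b′ n * P N n + c′ n * Q N n) N) ⟩
    Σ (λ n →
      (a n * alternating N n + b n * alternating⁺ N n + c n * l N) +
      (a′ n * h*r N + b′ n * P N n + c′ n * Q N n)) N ∎
    where
    open ≡-Reasoning
    U V : ℕ → ℕ → ℚ
    U n k = a k * (s n * d n k) + b k * (s n * r (n ℕ.+ k)) + c k * (s n * r n)
    V n k = a′ n * (h k * r k) + b′ n * (h k * d k n) + c′ n * (h k * r (n ℕ.+ k))

  -- X c n = 1 / n²⁽ᶜ⁺¹⁾
  X : ℕ → ℕ → ℚ
  X c n = (r n * r n) ^ suc c

  -- The terms of m times the sum of (-1)ⁿ⁻¹ H_n / n²ᵐ⁺¹ for m = c + 1, that is, of -m times the
  -- series for the zeta-star value at (2m + 1 barred, 1).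
  diagonal : ℕ → ℕ → ℚ
  diagonal c n = fromℕ (suc c) * (s n * (h n * (r n * X c n)))

  -- The zero coefficients here and in `even-total` give both totals the common shape of `ΣΣ-split`.
  odd-total : ℕ → ℕ → ℕ → ℚ
  odd-total c N n =
    (½ * (h n * X c n) * alternating N n + - (½ * (h n * X c n)) * alternating⁺ N n + 0ℚ * l N) +
    (- (s n * X c n) * h*r N + ½ * (s n * X c n) * P N n + ½ * (s n * X c n) * Q N n)

  even-total : ℕ → ℕ → ℕ → ℚ
  even-total c N n =
    (½ * (h n * X c n) * alternating N n + ½ * (h n * X c n) * alternating⁺ N n + - (h n * X c n) * l N) +
    (0ℚ * h*r N + ½ * (s n * X c n) * P N n + - (½ * (s n * X c n)) * Q N n)

  -- At equal arguments the geometric sum consists of c equal terms, and subtracting the negative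
  -- separated expression R adds one more of them.
  diagonal-term : ∀ c n {R} → R ≡ - (s n * h n * (X c n * r n)) →
    s n * h n * (r n * geometric (r n * r n) (r n * r n) c) - R ≡ diagonal c n
  diagonal-term c n {R} eq = begin
    s n * h n * (r n * geometric (r n * r n) (r n * r n) c) - R
      ≡⟨ cong₂ (λ g R → s n * h n * (r n * g) - R) (geometric-diag (r n * r n) c) eq ⟩
    s n * h n * (r n * (fromℕ c * X c n)) - - (s n * h n * (X c n * r n))
      ≡⟨ solve 5 (λ σ a x f y → σ :* a :* (x :* (f :* y)) :- (:- (σ :* a :* (y :* x)))
           := (con 1ℚ :+ f) :* (σ :* (a :* (x :* y)))) refl (s n) (h n) (r n) (fromℕ c) (X c n) ⟩
    (1ℚ + fromℕ c) * (s n * (h n * (r n * X c n)))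
      ≡⟨ cong (_* (s n * (h n * (r n * X c n)))) (sym (fromℕ-suc c)) ⟩
    diagonal c n ∎
    where open ≡-Reasoning

  odd-double-sum : ∀ c N →
    Σ (λ n → Σ (λ k → s n * h k * (r k * geometric (r k * r k) (r n * r n) c)) N) N ≡
    Σ (odd-total c N) N + Σ (diagonal c) N
  odd-double-sum c N = trans (ΣΣ-diagonal K R (diagonal c) off diag N)
    (cong (_+ Σ (diagonal c) N) (ΣΣ-split
      (λ k → ½ * (h k * X c k)) (λ k → - (½ * (h k * X c k))) (λ _ → 0ℚ)
      (λ n → - (s n * X c n)) (λ n → ½ * (s n * X c n)) (λ n → ½ * (s n * X c n)) N))
    where
    open ≡-Reasoning
    K R : ℕ → ℕ → ℚ
    K n k = s n * h k * (r k * geometric (r k * r k) (r n * r n) c)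
    R n k =
      (½ * (h k * X c k) * (s n * d n k) + - (½ * (h k * X c k)) * (s n * r (n ℕ.+ k)) + 0ℚ * (s n * r n)) +
      (- (s n * X c n) * (h k * r k) + ½ * (s n * X c n) * (h k * d k n) + ½ * (s n * X c n) * (h k * r (n ℕ.+ k)))
    off : ∀ n k → k ≢ n → K (suc n) (suc k) ≡ R (suc n) (suc k)
    off n′ k′ k≢n = begin
      K n k
        ≡⟨ cong (s n * h k *_) (odd-kernel x y δ e (d-recip n′ k′ (≢-sym k≢n)) (r-sum n′ k′) c) ⟩
      s n * h k * (X c k * (½ * (δ - e)) - X c n * (x + ½ * (δ - e)))
        ≡⟨ solve 8 (λ σ a u v x y δ e → σ :* a :* (u :* (con ½ :* (δ :- e)) :- v :* (x :+ con ½ :* (δ :- e)))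
             := (con ½ :* (a :* u) :* (σ :* δ) :+ (:- (con ½ :* (a :* u))) :* (σ :* e) :+ con 0ℚ :* (σ :* y)) :+
                ((:- (σ :* v)) :* (a :* x) :+ con ½ :* (σ :* v) :* (a :* (:- δ)) :+ con ½ :* (σ :* v) :* (a :* e)))
             refl (s n) (h k) (X c k) (X c n) x y δ e ⟩
      (½ * (h k * X c k) * (s n * δ) + - (½ * (h k * X c k)) * (s n * e) + 0ℚ * (s n * y)) +
      (- (s n * X c n) * (h k * x) + ½ * (s n * X c n) * (h k * (- δ)) + ½ * (s n * X c n) * (h k * e))
        ≡⟨ cong (λ z → (½ * (h k * X c k) * (s n * δ) + - (½ * (h k * X c k)) * (s n * e) + 0ℚ * (s n * y)) +
             (- (s n * X c n) * (h k * x) + ½ * (s n * X c n) * (h k * z) + ½ * (s n * X c n) * (h k * e)))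
             (sym (d-antisym k n)) ⟩
      R n k ∎
      where
      n k : ℕ
      n = suc n′
      k = suc k′
      x y δ e : ℚ
      x = r k
      y = r n
      δ = d n k
      e = r (n ℕ.+ k)
    diag : ∀ n → K (suc n) (suc n) - R (suc n) (suc n) ≡ diagonal c (suc n)
    diag n′ = diagonal-term c n (trans
      (cong (λ z → (½ * (h n * X c n) * (s n * z) + - (½ * (h n * X c n)) * (s n * e) + 0ℚ * (s n * r n)) +
        (- (s n * X c n) * (h n * r n) + ½ * (s n * X c n) * (h n * z) + ½ * (s n * X c n) * (h n * e))) (d-diag n))
      (solve 5 (λ σ a v x e →
        (con ½ :* (a :* v) :* (σ :* con 0ℚ) :+ (:- (con ½ :* (a :* v))) :* (σ :* e) :+ con 0ℚ :* (σ :* x)) :+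
        ((:- (σ :* v)) :* (a :* x) :+ con ½ :* (σ :* v) :* (a :* con 0ℚ) :+ con ½ :* (σ :* v) :* (a :* e))
        := :- (σ :* a :* (v :* x))) refl (s n) (h n) (X c n) (r n) e))
      where
      n : ℕ
      n = suc n′
      e : ℚ
      e = r (n ℕ.+ n)

  even-double-sum : ∀ c N →
    Σ (λ n → Σ (λ k → s n * h k * (r n * geometric (r k * r k) (r n * r n) c)) N) N ≡
    Σ (even-total c N) N + Σ (diagonal c) N
  even-double-sum c N = trans (ΣΣ-diagonal K R (diagonal c) off diag N)
    (cong (_+ Σ (diagonal c) N) (ΣΣ-split
      (λ k → ½ * (h k * X c k)) (λ k → ½ * (h k * X c k)) (λ k → - (h k * X c k))
      (λ _ → 0ℚ) (λ n → ½ * (s n * X c n)) (λ n → - (½ * (s n * X c n))) N))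
    where
    open ≡-Reasoning
    K R : ℕ → ℕ → ℚ
    K n k = s n * h k * (r n * geometric (r k * r k) (r n * r n) c)
    R n k =
      (½ * (h k * X c k) * (s n * d n k) + ½ * (h k * X c k) * (s n * r (n ℕ.+ k)) + - (h k * X c k) * (s n * r n)) +
      (0ℚ * (h k * r k) + ½ * (s n * X c n) * (h k * d k n) + - (½ * (s n * X c n)) * (h k * r (n ℕ.+ k)))
    off : ∀ n k → k ≢ n → K (suc n) (suc k) ≡ R (suc n) (suc k)
    off n′ k′ k≢n = begin
      K n k
        ≡⟨ cong (s n * h k *_) (even-kernel x y δ e (d-recip n′ k′ (≢-sym k≢n)) (r-sum n′ k′) c) ⟩
      s n * h k * (X c k * (½ * (δ + e) - y) - X c n * (½ * (δ + e)))
        ≡⟨ solve 8 (λ σ a u v x y δ e → σ :* a :* (u :* (con ½ :* (δ :+ e) :- y) :- v :* (con ½ :* (δ :+ e)))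
             := (con ½ :* (a :* u) :* (σ :* δ) :+ con ½ :* (a :* u) :* (σ :* e) :+ (:- (a :* u)) :* (σ :* y)) :+
                (con 0ℚ :* (a :* x) :+ con ½ :* (σ :* v) :* (a :* (:- δ)) :+ (:- (con ½ :* (σ :* v))) :* (a :* e)))
             refl (s n) (h k) (X c k) (X c n) x y δ e ⟩
      (½ * (h k * X c k) * (s n * δ) + ½ * (h k * X c k) * (s n * e) + - (h k * X c k) * (s n * y)) +
      (0ℚ * (h k * x) + ½ * (s n * X c n) * (h k * (- δ)) + - (½ * (s n * X c n)) * (h k * e))
        ≡⟨ cong (λ z → (½ * (h k * X c k) * (s n * δ) + ½ * (h k * X c k) * (s n * e) + - (h k * X c k) * (s n * y)) +
             (0ℚ * (h k * x) + ½ * (s n * X c n) * (h k * z) + - (½ * (s n * X c n)) * (h k * e)))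
             (sym (d-antisym k n)) ⟩
      R n k ∎
      where
      n k : ℕ
      n = suc n′
      k = suc k′
      x y δ e : ℚ
      x = r k
      y = r n
      δ = d n k
      e = r (n ℕ.+ k)
    diag : ∀ n → K (suc n) (suc n) - R (suc n) (suc n) ≡ diagonal c (suc n)
    diag n′ = diagonal-term c n (trans
      (cong (λ z → (½ * (h n * X c n) * (s n * z) + ½ * (h n * X c n) * (s n * e) + - (h n * X c n) * (s n * r n)) +
        (0ℚ * (h n * r n) + ½ * (s n * X c n) * (h n * z) + - (½ * (s n * X c n)) * (h n * e))) (d-diag n))
      (solve 5 (λ σ a v x e →
        (con ½ :* (a :* v) :* (σ :* con 0ℚ) :+ con ½ :* (a :* v) :* (σ :* e) :+ (:- (a :* v)) :* (σ :* x)) :+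
        (con 0ℚ :* (a :* x) :+ con ½ :* (σ :* v) :* (a :* con 0ℚ) :+ (:- (con ½ :* (σ :* v))) :* (a :* e))
        := :- (σ :* a :* (v :* x))) refl (s n) (h n) (X c n) (r n) e))
      where
      n : ℕ
      n = suc n′
      e : ℚ
      e = r (n ℕ.+ n)

  -- Exact identities at a fixed N

  alternating-closed : ∀ {n N} → n ℕ.≤ N → alternating N n ≡ - (s n * (l (N ℕ.∸ n) - l n)) - r n
  alternating-closed {n} {N} n≤N =
    trans (cong (Σ (λ j → s j * d j n)) (sym (ℕ.m∸n+n≡m n≤N))) (Σ-s*d (N ℕ.∸ n) n)

  -- What is left of the n-th term once the inner sums are replaced by their closed forms. The
  -- predecessor reflects the offset in `Q-closed`.
  odd-error even-error : ℕ → ℕ → ℕ → ℚ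
  odd-error c N n = X c n * (s n * (h n * (l (N ℕ.+ n) - l (N ℕ.∸ n)) + (Q-error N (ℕ.pred n) - P-error N n)))
  even-error c N n = X c n * (s n * (h n * (½ * ((l (N ℕ.∸ n) - l N) + (l (N ℕ.+ n) - l N)))
    + ½ * (Q-error N (ℕ.pred n) + P-error N n)))

  -- In `odd-total` the closed forms make `h*r N` and `l k` cancel, while the sum of P and Q leaves
  -- `h k * h k`, together with `h₂ k` and `r k * h k`. The last joins the diagonal term to give the
  -- coefficient 2m + 1.
  odd-terms : ∀ c {n N} → n ℕ.< N → let k = suc n ; m = fromℕ (suc c) in
    h k * h k * (s k * X c k) ≡
    (1ℚ * (s k * X c k * h₂ k) + (m + m + 1ℚ) * (s k * (r k * X c k) * h k) + - 1ℚ * (r k * X c k * h k)) +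
    (- h₂ N * (s k * X c k) + - (1ℚ + 1ℚ) * (odd-total c N k + diagonal c k) + 1ℚ * odd-error c N k)
  odd-terms c {n} {N} n<N = trans
    (solve 13 (λ σ y a b x u v w S B Ep Eq m →
        (a :+ x) :* (a :+ x) :* (σ :* y) :=
        (con 1ℚ :* (σ :* y :* (b :+ x :* x)) :+ (m :+ m :+ con 1ℚ) :* (σ :* (x :* y) :* (a :+ x))
          :+ (:- con 1ℚ) :* (x :* y :* (a :+ x))) :+
        ((:- B) :* (σ :* y) :+ (:- (con 1ℚ :+ con 1ℚ)) :*
          (((con ½ :* ((a :+ x) :* y) :* (:- (σ :* (u :- w)) :- x)
             :+ (:- (con ½ :* ((a :+ x) :* y))) :* (:- (σ :* (v :- w))) :+ con 0ℚ)
           :+ ((:- (σ :* y)) :* S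
             :+ con ½ :* (σ :* y) :* (S :+ con ½ :* ((con 1ℚ :+ con 1ℚ :+ con 1ℚ) :* (b :+ x :* x)
                   :- (a :+ x) :* (a :+ x)) :- Ep)
             :+ con ½ :* (σ :* y) :* (S :- B :- con ½ :* (a :* a :+ b) :+ Eq)))
           :+ m :* (σ :* ((a :+ x) :* (x :* y))))
         :+ con 1ℚ :* (y :* (σ :* ((a :+ x) :* (v :- u) :+ (Eq :- Ep))))))
      refl (s k) (X c k) (h n) (h₂ n) (r k) (l (N ℕ.∸ k)) (l (N ℕ.+ k)) (l k) (h*r N) (h₂ N)
        (P-error N k) (Q-error N n) m)
    -- The solver works on the closed forms; these equations put the inner sums back, the fifth one
    -- restoring the term with coefficient 0.
    (sym (combine (alternating-closed n<N) (Σ-s*r+ N k) (P-closed n<N) (Q-closed n N) (ℚ.*-zeroˡ (l N))))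
    where
    k : ℕ
    k = suc n
    m : ℚ
    m = fromℕ (suc c)
    combine : ∀ {α α′ β β′ p p′ q q′ z z′} → α ≡ α′ → β ≡ β′ → p ≡ p′ → q ≡ q′ → z ≡ z′ →
      (1ℚ * (s k * X c k * h₂ k) + (m + m + 1ℚ) * (s k * (r k * X c k) * h k) + - 1ℚ * (r k * X c k * h k)) +
      (- h₂ N * (s k * X c k) + - (1ℚ + 1ℚ) * ((
          (½ * (h k * X c k) * α + - (½ * (h k * X c k)) * β + z) +
          (- (s k * X c k) * h*r N + ½ * (s k * X c k) * p + ½ * (s k * X c k) * q)) + diagonal c k)
        + 1ℚ * odd-error c N k) ≡
      (1ℚ * (s k * X c k * h₂ k) + (m + m + 1ℚ) * (s k * (r k * X c k) * h k) + - 1ℚ * (r k * X c k * h k)) +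
      (- h₂ N * (s k * X c k) + - (1ℚ + 1ℚ) * ((
          (½ * (h k * X c k) * α′ + - (½ * (h k * X c k)) * β′ + z′) +
          (- (s k * X c k) * h*r N + ½ * (s k * X c k) * p′ + ½ * (s k * X c k) * q′)) + diagonal c k)
        + 1ℚ * odd-error c N k)
    combine refl refl refl refl refl = refl

  -- Now P and Q are subtracted: `h*r N` and the squares cancel, leaving `h₂ k` and half of
  -- `r k * h k`, whence m - ½. The two alternating sums each contribute half of `h k * l k`, and
  -- subtracting their common limiting value brings in `l N`.
  even-terms : ∀ c {n N} → n ℕ.< N → let k = suc n ; m = fromℕ (suc c) in
    h k * l k * (s k * X c k) ≡
    (1ℚ * (even-total c N k + diagonal c k) + l N * (s k * X c k * h k) + l N * (X c k * h k)) +
    (½ * (r k * X c k * h k) + - 1ℚ * (s k * X c k * h₂ k) + - (m - ½) * (s k * (r k * X c k) * h k)) +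
    (- (½ * h₂ N) * (s k * X c k) + even-error c N k)
  even-terms c {n} {N} n<N = trans
    (solve 14 (λ σ y a b x u v w S B Ep Eq m z →
        (a :+ x) :* w :* (σ :* y) :=
        (con 1ℚ :*
          (((con ½ :* ((a :+ x) :* y) :* (:- (σ :* (u :- w)) :- x)
             :+ con ½ :* ((a :+ x) :* y) :* (:- (σ :* (v :- w))) :+ (:- ((a :+ x) :* y)) :* z)
           :+ (con 0ℚ
             :+ con ½ :* (σ :* y) :* (S :+ con ½ :* ((con 1ℚ :+ con 1ℚ :+ con 1ℚ) :* (b :+ x :* x)
                   :- (a :+ x) :* (a :+ x)) :- Ep)
             :+ (:- (con ½ :* (σ :* y))) :* (S :- B :- con ½ :* (a :* a :+ b) :+ Eq)))
           :+ m :* (σ :* ((a :+ x) :* (x :* y))))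
         :+ z :* (σ :* y :* (a :+ x)) :+ z :* (y :* (a :+ x))) :+
        (con ½ :* (x :* y :* (a :+ x)) :+ (:- con 1ℚ) :* (σ :* y :* (b :+ x :* x))
          :+ (:- (m :- con ½)) :* (σ :* (x :* y) :* (a :+ x))) :+
        ((:- (con ½ :* B)) :* (σ :* y)
         :+ y :* (σ :* ((a :+ x) :* (con ½ :* ((u :- z) :+ (v :- z))) :+ con ½ :* (Eq :+ Ep)))))
      refl (s k) (X c k) (h n) (h₂ n) (r k) (l (N ℕ.∸ k)) (l (N ℕ.+ k)) (l k) (h*r N) (h₂ N)
        (P-error N k) (Q-error N n) m (l N))
    (sym (combine (alternating-closed n<N) (Σ-s*r+ N k) (P-closed n<N) (Q-closed n N) (ℚ.*-zeroˡ (h*r N))))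
    where
    k : ℕ
    k = suc n
    m : ℚ
    m = fromℕ (suc c)
    combine : ∀ {α α′ β β′ p p′ q q′ z z′} → α ≡ α′ → β ≡ β′ → p ≡ p′ → q ≡ q′ → z ≡ z′ →
      (1ℚ * ((
          (½ * (h k * X c k) * α + ½ * (h k * X c k) * β + - (h k * X c k) * l N) +
          (z + ½ * (s k * X c k) * p + - (½ * (s k * X c k)) * q)) + diagonal c k)
        + l N * (s k * X c k * h k) + l N * (X c k * h k)) +
      (½ * (r k * X c k * h k) + - 1ℚ * (s k * X c k * h₂ k) + - (m - ½) * (s k * (r k * X c k) * h k)) +
      (- (½ * h₂ N) * (s k * X c k) + even-error c N k) ≡
      (1ℚ * ((
          (½ * (h k * X c k) * α′ + ½ * (h k * X c k) * β′ + - (h k * X c k) * l N) +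
          (z′ + ½ * (s k * X c k) * p′ + - (½ * (s k * X c k)) * q′)) + diagonal c k)
        + l N * (s k * X c k * h k) + l N * (X c k * h k)) +
      (½ * (r k * X c k * h k) + - 1ℚ * (s k * X c k * h₂ k) + - (m - ½) * (s k * (r k * X c k) * h k)) +
      (- (½ * h₂ N) * (s k * X c k) + even-error c N k)
    combine refl refl refl refl refl = refl

  -- The row totals and the diagonal recombine into the double sum, which `seq-odd-sum` identifies
  -- with the partial sums of the products of zeta values.
  odd-identity : ∀ c N → let m = fromℕ (suc c) in
    Σ (λ n → h n * h n * (s n * X c n)) N ≡
    (1ℚ * Σ (λ n → s n * X c n * h₂ n) N + (m + m + 1ℚ) * Σ (λ n → s n * (r n * X c n) * h n) N
      + - 1ℚ * Σ (λ n → r n * X c n * h n) N) +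
    (- h₂ N * Σ (λ n → s n * X c n) N
      + - (1ℚ + 1ℚ) * Σ (λ n → Σ (λ k → s n * h k * (r k * geometric (r k * r k) (r n * r n) c)) N) N
      + 1ℚ * Σ (odd-error c N) N)
  odd-identity c N = begin
    Σ (λ n → h n * h n * (s n * X c n)) N
      ≡⟨ Σ-cong N (λ n n<N → odd-terms c n<N) ⟩
    Σ (λ n → u n + v n) N
      ≡⟨ Σ-+ u v N ⟩
    Σ u N + Σ v N
      ≡⟨ cong₂ _+_
           (Σ-linear₃ 1ℚ (m + m + 1ℚ) (- 1ℚ)
             (λ n → s n * X c n * h₂ n) (λ n → s n * (r n * X c n) * h n) (λ n → r n * X c n * h n) N)
           (trans (Σ-linear₃ (- h₂ N) (- (1ℚ + 1ℚ)) 1ℚ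
               (λ n → s n * X c n) (λ n → odd-total c N n + diagonal c n) (odd-error c N) N)
             (cong (λ z → - h₂ N * Σ (λ n → s n * X c n) N + - (1ℚ + 1ℚ) * z + 1ℚ * Σ (odd-error c N) N)
               (trans (Σ-+ (odd-total c N) (diagonal c) N) (sym (odd-double-sum c N))))) ⟩
    _ ∎
    where
    open ≡-Reasoning
    m : ℚ
    m = fromℕ (suc c)
    u v : ℕ → ℚ
    u n = 1ℚ * (s n * X c n * h₂ n) + (m + m + 1ℚ) * (s n * (r n * X c n) * h n) + - 1ℚ * (r n * X c n * h n)
    v n = - h₂ N * (s n * X c n) + - (1ℚ + 1ℚ) * (odd-total c N n + diagonal c n) + 1ℚ * odd-error c N n

  even-identity : ∀ c N → let m = fromℕ (suc c) in
    Σ (λ n → h n * l n * (s n * X c n)) N ≡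
    (1ℚ * Σ (λ n → Σ (λ k → s n * h k * (r n * geometric (r k * r k) (r n * r n) c)) N) N
      + l N * Σ (λ n → s n * X c n * h n) N + l N * Σ (λ n → X c n * h n) N) +
    (½ * Σ (λ n → r n * X c n * h n) N + - 1ℚ * Σ (λ n → s n * X c n * h₂ n) N
      + - (m - ½) * Σ (λ n → s n * (r n * X c n) * h n) N) +
    (- (½ * h₂ N) * Σ (λ n → s n * X c n) N + Σ (even-error c N) N)
  even-identity c N = begin
    Σ (λ n → h n * l n * (s n * X c n)) N
      ≡⟨ Σ-cong N (λ n n<N → even-terms c n<N) ⟩
    Σ (λ n → u n + v n + w n) N
      ≡⟨ trans (Σ-+ (λ n → u n + v n) w N) (cong (_+ Σ w N) (Σ-+ u v N)) ⟩
    Σ u N + Σ v N + Σ w N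
      ≡⟨ cong₂ _+_ (cong₂ _+_
           (trans (Σ-linear₃ 1ℚ (l N) (l N)
               (λ n → even-total c N n + diagonal c n) (λ n → s n * X c n * h n) (λ n → X c n * h n) N)
             (cong (λ z → 1ℚ * z + l N * Σ (λ n → s n * X c n * h n) N + l N * Σ (λ n → X c n * h n) N)
               (trans (Σ-+ (even-total c N) (diagonal c) N) (sym (even-double-sum c N)))))
           (Σ-linear₃ ½ (- 1ℚ) (- (m - ½))
             (λ n → r n * X c n * h n) (λ n → s n * X c n * h₂ n) (λ n → s n * (r n * X c n) * h n) N))
           (trans (Σ-+ (λ n → - (½ * h₂ N) * (s n * X c n)) (even-error c N) N)
             (cong (_+ Σ (even-error c N) N) (Σ-* (- (½ * h₂ N)) (λ n → s n * X c n) N))) ⟩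
    _ ∎
    where
    open ≡-Reasoning
    m : ℚ
    m = fromℕ (suc c)
    u v w : ℕ → ℚ
    u n = 1ℚ * (even-total c N n + diagonal c n) + l N * (s n * X c n * h n) + l N * (X c n * h n)
    v n = ½ * (r n * X c n * h n) + - 1ℚ * (s n * X c n * h₂ n) + - (m - ½) * (s n * (r n * X c n) * h n)
    w n = - (½ * h₂ N) * (s n * X c n) + even-error c N n

  -- Estimates of the tails

  0≤r : ∀ n → 0ℚ ≤ r n
  0≤r n = subst (0ℚ ≤_) (sym (r≡ n)) (Convergence.0≤r n)

  r-anti : ∀ {a b} → a ℕ.≤ b → r (suc b) ≤ r (suc a)
  r-anti {a} {b} a≤b = subst₂ _≤_ (sym (r≡ (suc b))) (sym (r≡ (suc a))) (recip-anti (s≤s a≤b))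

  r≤1 : ∀ n → r n ≤ 1ℚ
  r≤1 zero    = ℚ.<⇒≤ 0<1
  r≤1 (suc n) = ℚ.≤-trans (r-anti {0} {n} z≤n) (ℚ.≤-reflexive (r≡ 1))

  0≤h : ∀ n → 0ℚ ≤ h n
  0≤h zero    = ℚ.≤-refl
  0≤h (suc n) = 0≤+ (0≤h n) (0≤r (suc n))

  a≤b⇒0≤b-a : ∀ {a b} → a ≤ b → 0ℚ ≤ b - a
  a≤b⇒0≤b-a {a} {b} a≤b = subst (_≤ b - a) (ℚ.+-inverseʳ a) (ℚ.+-monoˡ-≤ (- a) a≤b)

  h-mono-+ : ∀ j a → h a ≤ h (j ℕ.+ a)
  h-mono-+ zero    a = ℚ.≤-refl
  h-mono-+ (suc j) a = ℚ.≤-trans (h-mono-+ j a) (a≤a+b (0≤r (suc (j ℕ.+ a))))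

  h-mono : ∀ {a b} → a ℕ.≤ b → h a ≤ h b
  h-mono {a} {b} a≤b = subst (λ i → h a ≤ h i) (ℕ.m∸n+n≡m a≤b) (h-mono-+ (b ℕ.∸ a) a)

  h-gap : ∀ j a → h (j ℕ.+ a) - h a ≤ fromℕ j * r (suc a)
  h-gap zero    a = ℚ.≤-reflexive (trans (ℚ.+-inverseʳ (h a)) (sym (ℚ.*-zeroˡ (r (suc a)))))
  h-gap (suc j) a = begin
    h (j ℕ.+ a) + r (suc (j ℕ.+ a)) - h a
      ≡⟨ solve 3 (λ p q b → p :+ q :- b := q :+ (p :- b)) refl (h (j ℕ.+ a)) (r (suc (j ℕ.+ a))) (h a) ⟩
    r (suc (j ℕ.+ a)) + (h (j ℕ.+ a) - h a)
      ≤⟨ ℚ.+-mono-≤ (r-anti (ℕ.m≤n+m a j)) (h-gap j a) ⟩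
    r (suc a) + fromℕ j * r (suc a)
      ≡⟨ solve 2 (λ f x → x :+ f :* x := (con 1ℚ :+ f) :* x) refl (fromℕ j) (r (suc a)) ⟩
    (1ℚ + fromℕ j) * r (suc a)
      ≡⟨ cong (_* r (suc a)) (sym (fromℕ-suc j)) ⟩
    fromℕ (suc j) * r (suc a) ∎
    where open ℚ.≤-Reasoning

  Σ-nonneg : ∀ {f} N → (∀ n → n ℕ.< N → 0ℚ ≤ f (suc n)) → 0ℚ ≤ Σ f N
  Σ-nonneg zero    0≤f = ℚ.≤-refl
  Σ-nonneg (suc N) 0≤f = 0≤+ (Σ-nonneg N λ n n<N → 0≤f n (ℕ.m≤n⇒m≤1+n n<N)) (0≤f N ℕ.≤-refl)

  Σ-const : ∀ c N → Σ (λ _ → c) N ≡ fromℕ N * c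
  Σ-const c zero    = sym (ℚ.*-zeroˡ c)
  Σ-const c (suc N) = trans (cong (_+ c) (Σ-const c N))
    (trans (solve 2 (λ f c → f :* c :+ c := (con 1ℚ :+ f) :* c) refl (fromℕ N) c)
      (cong (_* c) (sym (fromℕ-suc N))))

  r*[fromℕ*] : ∀ n x → r (suc n) * (fromℕ (suc n) * x) ≡ x
  r*[fromℕ*] n x = trans (sym (ℚ.*-assoc (r (suc n)) (fromℕ (suc n)) x))
    (trans (cong (_* x) (r-inverse n)) (ℚ.*-identityˡ x))

  error-assembly : ∀ {E t g a} K → E ≤ K * t → a ≤ K * t → 0ℚ ≤ g → E + g * a ≤ K * ((1ℚ + g) * t)
  error-assembly {E} {t} {g} {a} K E≤ a≤ 0≤g = ℚ.≤-trans (ℚ.+-mono-≤ E≤ (*-monoˡ 0≤g a≤))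
    (ℚ.≤-reflexive (solve 3 (λ K t g → K :* t :+ g :* (K :* t) := K :* ((con 1ℚ :+ g) :* t)) refl K t g))

  h-gap-≤ : ∀ {i N} → i ℕ.≤ N → h N - h (N ℕ.∸ i) ≤ fromℕ i * r (suc (N ℕ.∸ i))
  h-gap-≤ {i} {N} i≤N =
    subst (λ j → h j - h (N ℕ.∸ i) ≤ fromℕ i * r (suc (N ℕ.∸ i))) (ℕ.m+[n∸m]≡n i≤N) (h-gap i (N ℕ.∸ i))

  0≤P-error : ∀ {n N} → n ℕ.≤ N → 0ℚ ≤ P-error N n
  0≤P-error {n} {N} n≤N = 0≤+
    (Σ-nonneg n λ i _ → 0≤* (0≤r (suc i)) (a≤b⇒0≤b-a (h-mono (ℕ.m∸n≤m N (suc i)))))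
    (0≤* (0≤h N) (a≤b⇒0≤b-a (h-mono (ℕ.m∸n≤m N n))))

  -- The gap from `h (N ∸ i)` to `h N` consists of i terms, and the factor i cancels `r i`. So each
  -- of the n summands is at most 1/(N + 1 - n).
  P-error-bound : ∀ {n N} → n ℕ.≤ N → P-error N n ≤ fromℕ n * ((1ℚ + h N) * r (suc (N ℕ.∸ n)))
  P-error-bound {n} {N} n≤N = error-assembly (fromℕ n)
    (ℚ.≤-trans (Σ-mono n λ i i<n → begin
        r (suc i) * (h N - h (N ℕ.∸ suc i))
          ≤⟨ *-monoˡ (0≤r (suc i)) (h-gap-≤ (ℕ.≤-trans i<n n≤N)) ⟩
        r (suc i) * (fromℕ (suc i) * r (suc (N ℕ.∸ suc i)))
          ≡⟨ r*[fromℕ*] i (r (suc (N ℕ.∸ suc i))) ⟩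
        r (suc (N ℕ.∸ suc i))
          ≤⟨ r-anti (ℕ.∸-monoʳ-≤ N i<n) ⟩
        r (suc (N ℕ.∸ n)) ∎)
      (ℚ.≤-reflexive (Σ-const (r (suc (N ℕ.∸ n))) n)))
    (h-gap-≤ n≤N) (0≤h N)
    where open ℚ.≤-Reasoning

  0≤Q-error : ∀ n N → 0ℚ ≤ Q-error N n
  0≤Q-error n N = 0≤+
    (Σ-nonneg n λ i _ → 0≤* (0≤r (suc i)) (a≤b⇒0≤b-a (h-mono-+ (suc i) N)))
    (0≤* (0≤h N) (a≤b⇒0≤b-a (h-mono-+ (suc n) N)))

  -- The gaps lie beyond N and are governed by 1/(N + 1). This is weakened to the bound for
  -- `P-error` at n + 1, so that both tails are estimated alike.
  Q-error-bound : ∀ n N → Q-error N n ≤ fromℕ (suc n) * ((1ℚ + h N) * r (suc (N ℕ.∸ suc n)))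
  Q-error-bound n N = error-assembly (fromℕ (suc n))
    (begin
      Σ (λ i → r i * (h (i ℕ.+ N) - h N)) n
        ≤⟨ (Σ-mono n λ i _ → begin
             r (suc i) * (h (suc i ℕ.+ N) - h N)          ≤⟨ *-monoˡ (0≤r (suc i)) (h-gap (suc i) N) ⟩
             r (suc i) * (fromℕ (suc i) * r (suc N))      ≡⟨ r*[fromℕ*] i (r (suc N)) ⟩
             r (suc N)                                    ≤⟨ smaller ⟩
             t ∎) ⟩
      Σ (λ _ → t) n            ≤⟨ a≤a+b (0≤r (suc (N ℕ.∸ suc n))) ⟩
      Σ (λ _ → t) (suc n)      ≡⟨ Σ-const t (suc n) ⟩
      fromℕ (suc n) * t ∎)
    (ℚ.≤-trans (h-gap (suc n) N) (*-monoˡ (0≤fromℕ (suc n)) smaller)) (0≤h N)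
    where
    open ℚ.≤-Reasoning
    t : ℚ
    t = r (suc (N ℕ.∸ suc n))
    smaller : r (suc N) ≤ t
    smaller = r-anti (ℕ.m∸n≤m N (suc n))

  -- The Leibniz remainder estimate: a block of an alternating series has the sign of its first term
  -- and at most its size. The induction peels off the first term, because the rest then enters with
  -- the opposite sign.
  l-step : ∀ j a → ∃ λ t → 0ℚ ≤ t × t ≤ r (suc a) × l (j ℕ.+ a) - l a ≡ s (suc a) * t
  l-step zero    a = 0ℚ , ℚ.≤-refl , 0≤r (suc a) ,
    solve 2 (λ b σ → b :- b := σ :* con 0ℚ) refl (l a) (s (suc a))
  l-step (suc j) a with l-step j (suc a)
  ... | t , 0≤t , t≤ , eq = r (suc a) - t , a≤b⇒0≤b-a (ℚ.≤-trans t≤ (r-anti (ℕ.n≤1+n a))) , a-b≤a 0≤t , (begin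
    l (suc (j ℕ.+ a)) - l a                          ≡⟨ cong (λ i → l i - l a) (sym (ℕ.+-suc j a)) ⟩
    l (j ℕ.+ suc a) - l a                            ≡⟨ solve 4 (λ p q σ x → p :- q := (p :- (q :+ σ :* x)) :+ σ :* x)
                                                          refl (l (j ℕ.+ suc a)) (l a) (s (suc a)) (r (suc a)) ⟩
    l (j ℕ.+ suc a) - l (suc a) + s (suc a) * r (suc a)
      ≡⟨ cong (_+ s (suc a) * r (suc a)) eq ⟩
    - s (suc a) * t + s (suc a) * r (suc a)          ≡⟨ solve 3 (λ σ t x → (:- σ) :* t :+ σ :* x := σ :* (x :- t))
                                                          refl (s (suc a)) t (r (suc a)) ⟩
    s (suc a) * (r (suc a) - t) ∎)
    where open ≡-Reasoning

  ∣s∣≡1 : ∀ n → ∣ s n ∣ ≡ 1ℚ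
  ∣s∣≡1 zero    = refl
  ∣s∣≡1 (suc n) = trans (ℚ.∣-p∣≡∣p∣ (s n)) (∣s∣≡1 n)

  ∣s*∣ : ∀ n x → ∣ s n * x ∣ ≡ ∣ x ∣
  ∣s*∣ n x = trans (ℚ.∣p*q∣≡∣p∣*∣q∣ (s n) x) (trans (cong (_* ∣ x ∣) (∣s∣≡1 n)) (ℚ.*-identityˡ ∣ x ∣))

  l-gap : ∀ j a → ∣ l (j ℕ.+ a) - l a ∣ ≤ r (suc a)
  l-gap j a with l-step j a
  ... | t , 0≤t , t≤ , eq = ℚ.≤-trans
    (ℚ.≤-reflexive (trans (cong ∣_∣ eq) (trans (∣s*∣ (suc a) t) (0≤⇒∣∣ 0≤t)))) t≤

  l-gap-≤ : ∀ {a b} → a ℕ.≤ b → ∣ l b - l a ∣ ≤ r (suc a)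
  l-gap-≤ {a} {b} a≤b = subst (λ i → ∣ l i - l a ∣ ≤ r (suc a)) (ℕ.m∸n+n≡m a≤b) (l-gap (b ℕ.∸ a) a)

  0≤^ : ∀ {x} → 0ℚ ≤ x → ∀ n → 0ℚ ≤ x ^ n
  0≤^ 0≤x zero    = ℚ.<⇒≤ 0<1
  0≤^ 0≤x (suc n) = 0≤* 0≤x (0≤^ 0≤x n)

  ^≤1 : ∀ {x} → 0ℚ ≤ x → x ≤ 1ℚ → ∀ n → x ^ n ≤ 1ℚ
  ^≤1 0≤x x≤1 zero    = ℚ.≤-refl
  ^≤1 0≤x x≤1 (suc n) = *-mono 0≤x (ℚ.<⇒≤ 0<1) x≤1 (^≤1 0≤x x≤1 n)

  0≤X : ∀ c n → 0ℚ ≤ X c n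
  0≤X c n = 0≤^ (0≤* (0≤r n) (0≤r n)) (suc c)

  X≤r*r : ∀ c n → X c n ≤ r n * r n
  X≤r*r c n = subst (X c n ≤_) (ℚ.*-identityʳ (r n * r n))
    (*-monoˡ (0≤* (0≤r n) (0≤r n)) (^≤1 (0≤* (0≤r n) (0≤r n)) (*-mono (0≤r n) (ℚ.<⇒≤ 0<1) (r≤1 n) (r≤1 n)) c))

  two : ℚ
  two = 1ℚ + 1ℚ

  0≤two : 0ℚ ≤ two
  0≤two = 0≤+ (ℚ.<⇒≤ 0<1) (ℚ.<⇒≤ 0<1)

  -- Of the two factors 1/(n + 1) supplied by `X≤r*r`, one cancels `fromℕ (suc n)` in the part with
  -- v and is bounded by 1 in the part with u. Each part then contributes the constant 2.
  term-bound : ∀ c n {N t u v} → n ℕ.< N → 0ℚ ≤ t → ∣ u ∣ ≤ two * t →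
    ∣ v ∣ ≤ two * (fromℕ (suc n) * ((1ℚ + h N) * t)) →
    ∣ X c (suc n) * (s (suc n) * (h (suc n) * u + v)) ∣ ≤ two * two * (1ℚ + h N) * (r (suc n) * t)
  term-bound c n {N} {t} {u} {v} n<N 0≤t u≤ v≤ = begin
    ∣ X c k * (s k * (h k * u + v)) ∣
      ≡⟨ trans (ℚ.∣p*q∣≡∣p∣*∣q∣ (X c k) (s k * (h k * u + v)))
           (cong₂ _*_ (0≤⇒∣∣ (0≤X c k)) (∣s*∣ k (h k * u + v))) ⟩
    X c k * ∣ h k * u + v ∣
      ≤⟨ *-mono (0≤X c k) 0≤w (X≤r*r c k) (ℚ.≤-trans (ℚ.∣p+q∣≤∣p∣+∣q∣ (h k * u) v) (ℚ.+-mono-≤ hu≤ v≤)) ⟩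
    x * x * (g * (two * t) + two * (fromℕ k * (g * t)))
      ≡⟨ solve 5 (λ x g t K e → x :* x :* (g :* (e :* t) :+ e :* (K :* (g :* t)))
           := x :* (e :* (g :* t)) :* x :+ x :* (x :* (K :* (e :* (g :* t))))) refl x g t (fromℕ k) two ⟩
    x * (two * (g * t)) * x + x * (x * (fromℕ k * (two * (g * t))))
      ≡⟨ cong (λ z → x * (two * (g * t)) * x + x * z) (r*[fromℕ*] n (two * (g * t))) ⟩
    x * (two * (g * t)) * x + x * (two * (g * t))
      ≤⟨ ℚ.+-monoˡ-≤ (x * (two * (g * t)))
           (*-monoˡ (0≤* (0≤r k) (0≤* 0≤two (0≤* 0≤g 0≤t))) (r≤1 k)) ⟩
    x * (two * (g * t)) * 1ℚ + x * (two * (g * t))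
      ≡⟨ solve 3 (λ x g t → x :* ((con 1ℚ :+ con 1ℚ) :* (g :* t)) :* con 1ℚ :+ x :* ((con 1ℚ :+ con 1ℚ) :* (g :* t))
           := (con 1ℚ :+ con 1ℚ) :* (con 1ℚ :+ con 1ℚ) :* g :* (x :* t)) refl x g t ⟩
    two * two * g * (x * t) ∎
    where
    open ℚ.≤-Reasoning
    k : ℕ
    k = suc n
    x g : ℚ
    x = r k
    g = 1ℚ + h N
    0≤g : 0ℚ ≤ g
    0≤g = 0≤+ (ℚ.<⇒≤ 0<1) (0≤h N)
    0≤w : 0ℚ ≤ g * (two * t) + two * (fromℕ k * (g * t))
    0≤w = 0≤+ (0≤* 0≤g (0≤* 0≤two 0≤t)) (0≤* 0≤two (0≤* (0≤fromℕ k) (0≤* 0≤g 0≤t)))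
    hu≤ : ∣ h k * u ∣ ≤ g * (two * t)
    hu≤ = ℚ.≤-trans (ℚ.≤-reflexive (trans (ℚ.∣p*q∣≡∣p∣*∣q∣ (h k) u) (cong (_* ∣ u ∣) (0≤⇒∣∣ (0≤h k)))))
      (*-mono (0≤h k) (0≤* 0≤two 0≤t) (ℚ.≤-trans (h-mono n<N) (a≤b+a (ℚ.<⇒≤ 0<1))) u≤)

  x≤two*x : ∀ {x} → 0ℚ ≤ x → x ≤ two * x
  x≤two*x {x} 0≤x = subst (x ≤_) (solve 1 (λ x → x :+ x := (con 1ℚ :+ con 1ℚ) :* x) refl x) (a≤a+b 0≤x)

  ∣-∣≤two : ∀ {a b K} → ∣ a ∣ ≤ K → ∣ b ∣ ≤ K → ∣ a - b ∣ ≤ two * K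
  ∣-∣≤two {a} {b} {K} a≤ b≤ = ℚ.≤-trans (ℚ.∣p-q∣≤∣p∣+∣q∣ a b) (ℚ.≤-trans (ℚ.+-mono-≤ a≤ b≤)
    (ℚ.≤-reflexive (solve 1 (λ K → K :+ K := (con 1ℚ :+ con 1ℚ) :* K) refl K)))

  ∣½+∣≤two : ∀ {a b K} → ∣ a ∣ ≤ K → ∣ b ∣ ≤ K → ∣ ½ * (a + b) ∣ ≤ two * K
  ∣½+∣≤two {a} {b} {K} a≤ b≤ = begin
    ∣ ½ * (a + b) ∣      ≡⟨ ℚ.∣p*q∣≡∣p∣*∣q∣ ½ (a + b) ⟩
    ½ * ∣ a + b ∣        ≤⟨ *-monoˡ (ℚ.<⇒≤ 0<½) (ℚ.≤-trans (ℚ.∣p+q∣≤∣p∣+∣q∣ a b) (ℚ.+-mono-≤ a≤ b≤)) ⟩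
    ½ * (K + K)          ≡⟨ solve 1 (λ K → con ½ :* (K :+ K) := K) refl K ⟩
    K                    ≤⟨ x≤two*x (ℚ.≤-trans (ℚ.0≤∣p∣ a) a≤) ⟩
    two * K ∎
    where open ℚ.≤-Reasoning

  ∣P-error∣ : ∀ {n N} → n ℕ.≤ N → ∣ P-error N n ∣ ≤ fromℕ n * ((1ℚ + h N) * r (suc (N ℕ.∸ n)))
  ∣P-error∣ n≤N = ℚ.≤-trans (ℚ.≤-reflexive (0≤⇒∣∣ (0≤P-error n≤N))) (P-error-bound n≤N)

  ∣Q-error∣ : ∀ n N → ∣ Q-error N n ∣ ≤ fromℕ (suc n) * ((1ℚ + h N) * r (suc (N ℕ.∸ suc n)))
  ∣Q-error∣ n N = ℚ.≤-trans (ℚ.≤-reflexive (0≤⇒∣∣ (0≤Q-error n N))) (Q-error-bound n N)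

  odd-error-bound : ∀ c {n N} → n ℕ.< N →
    ∣ odd-error c N (suc n) ∣ ≤ two * two * (1ℚ + h N) * (r (suc n) * r (suc (N ℕ.∸ suc n)))
  odd-error-bound c {n} {N} n<N = term-bound c n n<N (0≤r (suc (N ℕ.∸ suc n)))
    (ℚ.≤-trans (l-gap-≤ (ℕ.≤-trans (ℕ.m∸n≤m N (suc n)) (ℕ.m≤m+n N (suc n))))
      (x≤two*x (0≤r (suc (N ℕ.∸ suc n)))))
    (∣-∣≤two (∣Q-error∣ n N) (∣P-error∣ n<N))

  even-error-bound : ∀ c {n N} → n ℕ.< N →
    ∣ even-error c N (suc n) ∣ ≤ two * two * (1ℚ + h N) * (r (suc n) * r (suc (N ℕ.∸ suc n)))
  even-error-bound c {n} {N} n<N = term-bound c n n<N (0≤r (suc (N ℕ.∸ suc n)))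
    (∣½+∣≤two
      (subst (_≤ r (suc (N ℕ.∸ suc n))) (swap-∣-∣ (l N) (l (N ℕ.∸ suc n))) (l-gap-≤ (ℕ.m∸n≤m N (suc n))))
      (ℚ.≤-trans (l-gap-≤ (ℕ.m≤m+n N (suc n))) (r-anti (ℕ.m∸n≤m N (suc n)))))
    (∣½+∣≤two (∣Q-error∣ n N) (∣P-error∣ n<N))

  Σ-reverse : ∀ f N → Σ (λ n → f (suc (N ℕ.∸ n))) N ≡ Σ f N
  Σ-reverse f zero    = refl
  Σ-reverse f (suc N) = begin
    Σ (λ n → f (suc (suc N ℕ.∸ n))) (suc N)             ≡⟨ Σ-first (λ n → f (suc (suc N ℕ.∸ n))) N ⟩
    f (suc N) + Σ (λ n → f (suc (N ℕ.∸ n))) N           ≡⟨ cong (_+_ (f (suc N))) (Σ-reverse f N) ⟩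
    f (suc N) + Σ f N                                   ≡⟨ ℚ.+-comm (f (suc N)) (Σ f N) ⟩
    Σ f (suc N) ∎
    where open ≡-Reasoning

  -- By partial fractions, 1/(n (N + 1 - n)) is 1/(N + 1) times 1/n + 1/(N + 1 - n), and reversing
  -- the order of summation shows that both parts sum to `h N`.
  Σ-convolution : ∀ N → Σ (λ n → r n * r (suc (N ℕ.∸ n))) N ≡ r (suc N) * (two * h N)
  Σ-convolution N = begin
    Σ (λ n → r n * r (suc (N ℕ.∸ n))) N
      ≡⟨ Σ-cong N (λ n n<N → trans (sym (r-sum n (N ℕ.∸ suc n)))
           (cong (λ i → r i * (r (suc n) + r (suc (N ℕ.∸ suc n))))
             (trans (ℕ.+-suc (suc n) (N ℕ.∸ suc n)) (cong suc (ℕ.m+[n∸m]≡n n<N))))) ⟩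
    Σ (λ n → r (suc N) * (r n + r (suc (N ℕ.∸ n)))) N
      ≡⟨ Σ-* (r (suc N)) (λ n → r n + r (suc (N ℕ.∸ n))) N ⟩
    r (suc N) * Σ (λ n → r n + r (suc (N ℕ.∸ n))) N
      ≡⟨ cong (r (suc N) *_) (trans (Σ-+ r (λ n → r (suc (N ℕ.∸ n))) N) (cong (_+_ (h N)) (Σ-reverse r N))) ⟩
    r (suc N) * (h N + h N)
      ≡⟨ solve 2 (λ x a → x :* (a :+ a) := x :* ((con 1ℚ :+ con 1ℚ) :* a)) refl (r (suc N)) (h N) ⟩
    r (suc N) * (two * h N) ∎
    where open ≡-Reasoning

  Σ-error-bound : ∀ f N →
    (∀ n → n ℕ.< N → ∣ f (suc n) ∣ ≤ two * two * (1ℚ + h N) * (r (suc n) * r (suc (N ℕ.∸ suc n)))) →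
    ∣ Σ f N ∣ ≤ two * two * two * ((h N + h N * h N) * r (suc N))
  Σ-error-bound f N bound = begin
    ∣ Σ f N ∣
      ≤⟨ ∣Σ∣≤ f N ⟩
    Σ (λ n → ∣ f n ∣) N
      ≤⟨ Σ-mono N bound ⟩
    Σ (λ n → two * two * (1ℚ + h N) * (r n * r (suc (N ℕ.∸ n)))) N
      ≡⟨ trans (Σ-* (two * two * (1ℚ + h N)) (λ n → r n * r (suc (N ℕ.∸ n))) N)
           (cong (two * two * (1ℚ + h N) *_) (Σ-convolution N)) ⟩
    two * two * (1ℚ + h N) * (r (suc N) * (two * h N))
      ≡⟨ solve 3 (λ e a x → e :* e :* (con 1ℚ :+ a) :* (x :* (e :* a)) := e :* e :* e :* ((a :+ a :* a) :* x))
           refl two (h N) (r (suc N)) ⟩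
    two * two * two * ((h N + h N * h N) * r (suc N)) ∎
    where open ℚ.≤-Reasoning

  -- Vanishing of the remainders

  A₁≡h : ∀ n → A 1 n ≡ h n
  A₁≡h zero    = refl
  A₁≡h (suc n) = cong₂ _+_ (A₁≡h n) (trans (ℚ.*-identityʳ (Convergence.r (suc n))) (sym (r≡ (suc n))))

  -- `A 2 n` is the sum of H_j / j, so its double exceeds the square of `h n` by `h₂ n`. The bound
  -- makes `null-A*r` applicable, so that H_N² / N tends to 0.
  h²≤2A₂ : ∀ n → h n * h n ≤ two * A 2 n
  h²≤2A₂ zero    = ℚ.≤-refl
  h²≤2A₂ (suc n) = begin
    (a + x) * (a + x)                            ≤⟨ a≤a+b (0≤* (0≤r (suc n)) (0≤r (suc n))) ⟩
    (a + x) * (a + x) + x * x                    ≡⟨ solve 2 (λ a x → (a :+ x) :* (a :+ x) :+ x :* x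
                                                      := a :* a :+ (con 1ℚ :+ con 1ℚ) :* (x :* (a :+ x))) refl a x ⟩
    a * a + two * (x * h (suc n))                ≤⟨ ℚ.+-monoˡ-≤ (two * (x * h (suc n))) (h²≤2A₂ n) ⟩
    two * A 2 n + two * (x * h (suc n))          ≡⟨ cong₂ (λ y z → two * A 2 n + two * (y * z)) (r≡ (suc n)) (sym (A₁≡h (suc n))) ⟩
    two * A 2 n + two * (ρ * A 1 (suc n))        ≡⟨ sym (ℚ.*-distribˡ-+ two (A 2 n) (ρ * A 1 (suc n))) ⟩
    two * (A 2 n + ρ * A 1 (suc n)) ∎
    where
    open ℚ.≤-Reasoning
    a x ρ : ℚ
    a = h n
    x = r (suc n)
    ρ = Convergence.r (suc n)

  null-h-h² : Null (λ N → (h N + h N * h N) * r (suc N))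
  null-h-h² = null-dominated dominated (null-+ {λ N → A 1 N * Convergence.r N} {λ N → two * (A 2 N * Convergence.r N)}
    (null-A*r 1) (null-scale two {λ N → A 2 N * Convergence.r N} (null-A*r 2)))
    where
    open ℚ.≤-Reasoning
    dominated : ∀ N → ∣ (h N + h N * h N) * r (suc N) ∣ ≤
      ∣ A 1 N * Convergence.r N + two * (A 2 N * Convergence.r N) ∣
    -- At N = 0 the reciprocal on the right is 0 by convention, so the estimate rests on `h 0` being
    -- 0.
    dominated zero        = ℚ.≤-reflexive (cong ∣_∣ (ℚ.*-zeroˡ (r 1)))
    dominated N@(suc n) = begin
      ∣ (h N + h N * h N) * r (suc N) ∣
        ≡⟨ 0≤⇒∣∣ (0≤* (0≤+ (0≤h N) (0≤* (0≤h N) (0≤h N))) (0≤r (suc N))) ⟩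
      (h N + h N * h N) * r (suc N)
        ≤⟨ *-mono (0≤+ (0≤h N) (0≤* (0≤h N) (0≤h N))) (Convergence.0≤r N)
             (ℚ.+-mono-≤ (ℚ.≤-reflexive (sym (A₁≡h N))) (h²≤2A₂ N))
             (ℚ.≤-trans (r-anti (ℕ.n≤1+n n)) (ℚ.≤-reflexive (r≡ N))) ⟩
      (A 1 N + two * A 2 N) * Convergence.r N
        ≡⟨ solve 4 (λ a b e x → (a :+ e :* b) :* x := a :* x :+ e :* (b :* x)) refl (A 1 N) (A 2 N) two (Convergence.r N) ⟩
      A 1 N * Convergence.r N + two * (A 2 N * Convergence.r N)
        ≡⟨ sym (0≤⇒∣∣ (0≤+ (0≤* (0≤A 1 N) (Convergence.0≤r N))
             (0≤* 0≤two (0≤* (0≤A 2 N) (Convergence.0≤r N))))) ⟩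
      ∣ A 1 N * Convergence.r N + two * (A 2 N * Convergence.r N) ∣ ∎

  null-bounded : ∀ {x : ℕ → ℚ} K → 0ℚ ≤ K → (∀ N → ∣ x N ∣ ≤ K * ((h N + h N * h N) * r (suc N))) → Null x
  null-bounded K 0≤K bound = null-dominated
    (λ N → ℚ.≤-trans (bound N) (ℚ.≤-reflexive (sym (0≤⇒∣∣
      (0≤* 0≤K (0≤* (0≤+ (0≤h N) (0≤* (0≤h N) (0≤h N))) (0≤r (suc N))))))))
    (null-scale K {λ N → (h N + h N * h N) * r (suc N)} null-h-h²)

  null-odd-error : ∀ c → Null (λ N → Σ (odd-error c N) N)
  null-odd-error c = null-bounded (two * two * two) (0≤* (0≤* 0≤two 0≤two) 0≤two)
    λ N → Σ-error-bound (odd-error c N) N λ n n<N → odd-error-bound c n<N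

  null-even-error : ∀ c → Null (λ N → Σ (even-error c N) N)
  null-even-error c = null-bounded (two * two * two) (0≤* (0≤* 0≤two 0≤two) 0≤two)
    λ N → Σ-error-bound (even-error c N) N λ n n<N → even-error-bound c n<N

  X≤r : ∀ c n → X c n ≤ r n
  X≤r c n = ℚ.≤-trans (X≤r*r c n) (subst (r n * r n ≤_) (ℚ.*-identityʳ (r n)) (*-monoˡ (0≤r n) (r≤1 n)))

  Σ-X*h-bound : ∀ c f N → (∀ n → ∣ f n ∣ ≤ X c n * h n) → ∣ Σ f N ∣ ≤ h N * h N
  Σ-X*h-bound c f N f≤ = begin
    ∣ Σ f N ∣                    ≤⟨ ∣Σ∣≤ f N ⟩
    Σ (λ n → ∣ f n ∣) N          ≤⟨ (Σ-mono N λ n n<N → ℚ.≤-trans (f≤ (suc n)) (ℚ.≤-trans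
                                      (*-mono (0≤X c (suc n)) (0≤h N) (X≤r c (suc n)) (h-mono n<N))
                                      (ℚ.≤-reflexive (ℚ.*-comm (r (suc n)) (h N))))) ⟩
    Σ (λ n → h N * r n) N        ≡⟨ Σ-* (h N) r N ⟩
    h N * h N ∎
    where open ℚ.≤-Reasoning

  -- The exact identity carries `l N`, whereas `ln2` is approximated by `l (N + N)`. Their gap is at
  -- most 1/(N + 1), which beats the crude bound `h N * h N` on the sum.
  null-l-gap* : ∀ c f → (∀ n → ∣ f n ∣ ≤ X c n * h n) → Null (λ N → (l (N ℕ.+ N) - l N) * Σ f N)
  null-l-gap* c f f≤ = null-bounded 1ℚ (ℚ.<⇒≤ 0<1) λ N → begin
    ∣ (l (N ℕ.+ N) - l N) * Σ f N ∣                ≡⟨ ℚ.∣p*q∣≡∣p∣*∣q∣ (l (N ℕ.+ N) - l N) (Σ f N) ⟩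
    ∣ l (N ℕ.+ N) - l N ∣ * ∣ Σ f N ∣              ≤⟨ *-mono (ℚ.0≤∣p∣ (l (N ℕ.+ N) - l N)) (0≤* (0≤h N) (0≤h N))
                                                        (l-gap N N) (Σ-X*h-bound c f N f≤) ⟩
    r (suc N) * (h N * h N)                        ≤⟨ *-monoˡ (0≤r (suc N)) (a≤b+a (0≤h N)) ⟩
    r (suc N) * (h N + h N * h N)                  ≡⟨ solve 2 (λ x a → x :* a := con 1ℚ :* (a :* x)) refl
                                                        (r (suc N)) (h N + h N * h N) ⟩
    1ℚ * ((h N + h N * h N) * r (suc N)) ∎
    where open ℚ.≤-Reasoning

  -- The Riemann sums of ln 2

  s-double : ∀ N → s (suc (N ℕ.+ N)) ≡ 1ℚ
  s-double N = trans (cong -_ (s-+ N N)) (trans (solve 1 (λ a → :- (:- a) := a) refl (s N * s N)) (s*s N))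

  r-double : ∀ N → r (suc N) ≡ r (suc N ℕ.+ suc N) + r (suc N ℕ.+ suc N)
  r-double N = sym (begin
    e + e                            ≡⟨ solve 1 (λ e → e :+ e := (con 1ℚ :+ con 1ℚ) :* (con 1ℚ :* e)) refl e ⟩
    two * (1ℚ * e)                   ≡⟨ cong (λ i → two * (i * e)) (sym (r-inverse N)) ⟩
    two * (x * f * e)                ≡⟨ solve 3 (λ x f e → (con 1ℚ :+ con 1ℚ) :* (x :* f :* e) := f :* (e :* (x :+ x))) refl x f e ⟩
    f * (e * (x + x))                ≡⟨ cong (f *_) (r-sum N N) ⟩
    f * (x * x)                      ≡⟨ solve 2 (λ x f → f :* (x :* x) := x :* f :* x) refl x f ⟩
    x * f * x                        ≡⟨ cong (_* x) (r-inverse N) ⟩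
    1ℚ * x                           ≡⟨ ℚ.*-identityˡ x ⟩
    x ∎)
    where
    open ≡-Reasoning
    x e f : ℚ
    x = r (suc N)
    e = r (suc N ℕ.+ suc N)
    f = fromℕ (suc N)

  -- Passing to N + 1 adds 1/(2N + 1) + 1/(2N + 2) - 1/(N + 1) on the left. As 1/(N + 1) is 2/(2N +
  -- 2), the two new terms of the alternating sum remain.
  catalan : ∀ N → h (N ℕ.+ N) - h N ≡ l (N ℕ.+ N)
  catalan zero    = refl
  catalan (suc N) = begin
    h (suc N ℕ.+ suc N) - (h N + r (suc N))
      ≡⟨ cong₂ (λ i x → h i + e - (h N + x)) (ℕ.+-suc N N) (r-double N) ⟩
    h (N ℕ.+ N) + y + e - (h N + (e + e))
      ≡⟨ solve 4 (λ a b y e → a :+ y :+ e :- (b :+ (e :+ e)) := (a :- b) :+ con 1ℚ :* y :+ (:- con 1ℚ) :* e)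
           refl (h (N ℕ.+ N)) (h N) y e ⟩
    (h (N ℕ.+ N) - h N) + 1ℚ * y + - 1ℚ * e
      ≡⟨ cong₂ (λ a σ → a + σ * y + - σ * e) (catalan N) (sym (s-double N)) ⟩
    l (suc (N ℕ.+ N)) + s (suc (suc (N ℕ.+ N))) * e
      ≡⟨ cong (λ i → l i + s (suc i) * e) (sym (ℕ.+-suc N N)) ⟩
    l (suc N ℕ.+ suc N) ∎
    where
    open ≡-Reasoning
    y e : ℚ
    y = r (suc (N ℕ.+ N))
    e = r (suc N ℕ.+ suc N)

  -- Partial sums of ζ, ζ̄ and ζ⋆

  ÷-^ : ∀ k n → (ℤ.+ 1 ÷ suc n ^ k) ≡ r (suc n) ^ k
  ÷-^ zero    n = refl
  ÷-^ (suc k) n = trans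
    (sym (/-*-/ (ℤ.+ 1) (ℤ.+ 1) (suc n) (suc n ℕ.^ k) {{_}} {{ℕ.m^n≢0 (suc n) k}} {{ℕ.m^n≢0 (suc n) (suc k)}}))
    (cong₂ _*_ (sym (r≡ (suc n))) (÷-^ k n))

  σ-bar : ∀ k n → σ (bar k) n ≡ s (suc n)
  σ-bar k zero    = refl
  σ-bar k (suc n) = trans (σ-suc (bar k) n)
    (trans (cong (- 1ℚ *_) (σ-bar k n)) (solve 1 (λ a → (:- con 1ℚ) :* a := :- a) refl (s (suc n))))

  alt-≡ : ∀ k n → alt k (suc n) ≡ s (suc n) * r (suc n) ^ k
  alt-≡ k n = trans (÷-split (-1ℤ ℤ.^ n) n k) (cong₂ _*_ (σ-bar k n) (÷-^ k n))

  coef-plain : ∀ k n → coef (plain k) n ≡ r (suc n) ^ k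
  coef-plain k n = trans (cong (λ i → i ÷ suc n ^ k) (ℤ.^-zeroˡ (suc n))) (÷-^ k n)

  coef-bar : ∀ k n → coef (bar k) n ≡ - s (suc n) * r (suc n) ^ k
  coef-bar k n = trans (÷-split (-1ℤ ℤ.^ suc n) n k) (cong₂ _*_ (σ-bar k (suc n)) (÷-^ k n))

  H≡h : ∀ N → H N ≡ h N
  H≡h = ∑≡Σ λ n → sym (r≡ (suc n))

  L₁≡l : ∀ N → L 1 N ≡ l N
  L₁≡l = ∑≡Σ λ n → trans (alt-≡ 1 n) (cong (s (suc n) *_) (ℚ.*-identityʳ (r (suc n))))

  -- Here p is the shape in which the power of 1/n occurs in the identities, so that the exponents
  -- 2m and 2m + 1 are handled by the same lemmas.
  module _ (k : ℕ) (ss : List Index) (p g : ℕ → ℚ)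
           (p≡ : ∀ n → r n ^ k ≡ p n) (g≡ : ∀ n → ζ⋆-partial ss n ≡ g n) where

    ζ⋆-partial-plain : ∀ N → ζ⋆-partial (plain k ∷ ss) N ≡ Σ (λ n → p n * g n) N
    ζ⋆-partial-plain = ∑≡Σ λ n → cong₂ _*_ (trans (coef-plain k n) (p≡ (suc n))) (g≡ (suc n))

    -- The minus sign arises because a barred index carries the n-th power of -1, whereas `s n` is
    -- the power with exponent n - 1.
    ζ⋆-partial-bar : ∀ N → ζ⋆-partial (bar k ∷ ss) N ≡ - Σ (λ n → s n * p n * g n) N
    ζ⋆-partial-bar N = begin
      ζ⋆-partial (bar k ∷ ss) N
        ≡⟨ ∑≡Σ (λ n → trans (cong₂ _*_ (trans (coef-bar k n) (cong (- s (suc n) *_) (p≡ (suc n)))) (g≡ (suc n)))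
             (solve 3 (λ σ p g → (:- σ) :* p :* g := (:- con 1ℚ) :* (σ :* p :* g)) refl (s (suc n)) (p (suc n)) (g (suc n)))) N ⟩
      Σ (λ n → - 1ℚ * (s n * p n * g n)) N
        ≡⟨ Σ-* (- 1ℚ) (λ n → s n * p n * g n) N ⟩
      - 1ℚ * Σ (λ n → s n * p n * g n) N
        ≡⟨ solve 1 (λ a → (:- con 1ℚ) :* a := :- a) refl (Σ (λ n → s n * p n * g n) N) ⟩
      - Σ (λ n → s n * p n * g n) N ∎
      where open ≡-Reasoning

  ζ⋆-partial-1 : ∀ N → ζ⋆-partial (plain 1 ∷ []) N ≡ h N
  ζ⋆-partial-1 = ∑≡Σ λ n → trans (ℚ.*-identityʳ (coef (plain 1) n))
    (trans (coef-plain 1 n) (ℚ.*-identityʳ (r (suc n))))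

  ζ⋆-partial-2 : ∀ N → ζ⋆-partial (plain 2 ∷ []) N ≡ h₂ N
  ζ⋆-partial-2 = ∑≡Σ λ n → trans (ℚ.*-identityʳ (coef (plain 2) n))
    (trans (coef-plain 2 n) (cong (r (suc n) *_) (ℚ.*-identityʳ (r (suc n)))))

  -- For a symbolic index the decision in `limitIf` does not compute; a proof of P rules out the
  -- default value 0.
  seq-limitIf : ∀ {P : Set} {x : ℕ → ℚ} (P? : Dec P) (c : P → Cauchy x) → P →
    ∀ N → seq (limitIf {x = x} P? c) N ≡ x N
  seq-limitIf (yes _) c p N = refl
  seq-limitIf (no ¬p) c p N = ⊥-elim (¬p p)

  seq-ζ⋆ : ∀ {ss} → Admissible ss → ∀ N → seq (ζ⋆ ss) N ≡ ζ⋆-partial ss N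
  seq-ζ⋆ {ss} = seq-limitIf (admissible? ss) (cauchy-ζ⋆ ss)

  seq-ζ⋆-plain-1 : ∀ k (p : ℕ → ℚ) → 2 ℕ.≤ k → (∀ n → r n ^ k ≡ p n) →
    ∀ N → seq (ζ⋆ (plain k ∷ plain 1 ∷ [])) N ≡ Σ (λ n → p n * h n) N
  seq-ζ⋆-plain-1 k p 2≤k p≡ N =
    trans (seq-ζ⋆ {plain k ∷ plain 1 ∷ []} (2≤k , s≤s z≤n ∷ []) N) (ζ⋆-partial-plain k (plain 1 ∷ []) p h p≡ ζ⋆-partial-1 N)

  seq-ζ⋆-bar-1 : ∀ k (p : ℕ → ℚ) → 1 ℕ.≤ k → (∀ n → r n ^ k ≡ p n) →
    ∀ N → seq (ζ⋆ (bar k ∷ plain 1 ∷ [])) N ≡ - Σ (λ n → s n * p n * h n) N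
  seq-ζ⋆-bar-1 k p 1≤k p≡ N =
    trans (seq-ζ⋆ {bar k ∷ plain 1 ∷ []} (1≤k , s≤s z≤n ∷ []) N) (ζ⋆-partial-bar k (plain 1 ∷ []) p h p≡ ζ⋆-partial-1 N)

  seq-ζ⋆-bar-2 : ∀ k (p : ℕ → ℚ) → 1 ℕ.≤ k → (∀ n → r n ^ k ≡ p n) →
    ∀ N → seq (ζ⋆ (bar k ∷ plain 2 ∷ [])) N ≡ - Σ (λ n → s n * p n * h₂ n) N
  seq-ζ⋆-bar-2 k p 1≤k p≡ N =
    trans (seq-ζ⋆ {bar k ∷ plain 2 ∷ []} (1≤k , s≤s z≤n ∷ []) N) (ζ⋆-partial-bar k (plain 2 ∷ []) p h₂ p≡ ζ⋆-partial-2 N)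

  seq-ζ2 : ∀ N → seq (ζ 2) N ≡ h₂ N
  seq-ζ2 = ∑≡Σ λ n → trans (÷-^ 2 n) (cong (r (suc n) *_) (ℚ.*-identityʳ (r (suc n))))

  seq-ζ̄ : ∀ k (p : ℕ → ℚ) → 1 ℕ.≤ k → (∀ n → r n ^ k ≡ p n) → ∀ N → seq (ζ̄ k) N ≡ Σ (λ n → s n * p n) N
  seq-ζ̄ k p 1≤k p≡ N = trans (seq-limitIf (1 ℕ.≤? k) (cauchy-ζ̄ k) 1≤k N)
    (∑≡Σ (λ n → trans (alt-≡ k n) (cong (s (suc n) *_) (p≡ (suc n)))) N)

  seq-ln2 : ∀ N → seq ln2 N ≡ l (N ℕ.+ N)
  seq-ln2 N = trans (cong₂ _-_ (trans (H≡h (2 ℕ.* N)) (cong (λ i → h (N ℕ.+ i)) (ℕ.+-identityʳ N))) (H≡h N))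
    (catalan N)

  seq-foldr : ∀ (F : ℕ → ℝ) g c N →
    seq (foldr _+ᵣ_ (ι 0ℚ) (map F (applyUpTo g c))) N ≡ Σ₀ (λ i → seq (F (g i)) N) c
  seq-foldr F g zero    N = refl
  seq-foldr F g (suc c) N = cong (_+_ (seq (F (g 0)) N)) (seq-foldr F (λ i → g (suc i)) c N)

  ^-even : ∀ x m → x ^ (2 ℕ.* m) ≡ (x * x) ^ m
  ^-even x zero    = refl
  ^-even x (suc m) = trans (cong (λ i → x ^ suc i) (ℕ.+-suc m (m ℕ.+ 0)))
    (trans (cong (λ p → x * (x * p)) (^-even x m)) (sym (ℚ.*-assoc x x ((x * x) ^ m))))

  ^-odd : ∀ x m → x ^ (2 ℕ.* m ℕ.+ 1) ≡ x * (x * x) ^ m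
  ^-odd x m = trans (cong (x ^_) (ℕ.+-comm (2 ℕ.* m) 1)) (cong (x *_) (^-even x m))

  Σ-product : ∀ f g N → Σ f N * Σ g N ≡ Σ (λ n → Σ (λ k → g n * f k) N) N
  Σ-product f g N = trans (sym (Σ-* (Σ f N) g N))
    (Σ-cong N λ n _ → trans (ℚ.*-comm (Σ f N) (g (suc n))) (sym (Σ-* (g (suc n)) f N)))

  -- Both factors are cut at the same N, so each product is a double sum over a square, and the
  -- summation over i acts on the powers alone. The weight w is the odd factor 1/k or 1/n left
  -- outside the squares.
  Σ₀-products : ∀ c N (p q w : ℕ → ℕ → ℚ) →
    (∀ i n k → q i n * p i k ≡ w n k * ((r k * r k) ^ suc i * (r n * r n) ^ (c ℕ.∸ i))) →
    Σ₀ (λ i → Σ (λ k → p i k * h k) N * Σ (λ n → s n * q i n) N) c ≡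
    Σ (λ n → Σ (λ k → s n * h k * (w n k * geometric (r k * r k) (r n * r n) c)) N) N
  Σ₀-products c N p q w split = begin
    Σ₀ (λ i → Σ (λ k → p i k * h k) N * Σ (λ n → s n * q i n) N) c
      ≡⟨ Σ₀-cong c (λ i _ → Σ-product (λ k → p i k * h k) (λ n → s n * q i n) N) ⟩
    Σ₀ (λ i → Σ (λ n → Σ (λ k → s n * q i n * (p i k * h k)) N) N) c
      ≡⟨ Σ-Σ₀-swap (λ i n → Σ (λ k → s n * q i n * (p i k * h k)) N) N c ⟩
    Σ (λ n → Σ₀ (λ i → Σ (λ k → s n * q i n * (p i k * h k)) N) c) N
      ≡⟨ Σ-cong N (λ n _ → trans (Σ-Σ₀-swap (λ i k → s (suc n) * q i (suc n) * (p i k * h k)) N c)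
           (Σ-cong N λ k _ → pointwise (suc n) (suc k))) ⟩
    Σ (λ n → Σ (λ k → s n * h k * (w n k * geometric (r k * r k) (r n * r n) c)) N) N ∎
    where
    open ≡-Reasoning
    pointwise : ∀ n k → Σ₀ (λ i → s n * q i n * (p i k * h k)) c ≡
      s n * h k * (w n k * geometric (r k * r k) (r n * r n) c)
    pointwise n k = begin
      Σ₀ (λ i → s n * q i n * (p i k * h k)) c
        ≡⟨ Σ₀-cong c (λ i _ → trans
             (solve 4 (λ σ a p q → σ :* q :* (p :* a) := σ :* a :* (q :* p)) refl (s n) (h k) (p i k) (q i n))
             (trans (cong (s n * h k *_) (split i n k)) (sym (ℚ.*-assoc (s n * h k) (w n k) _)))) ⟩
      Σ₀ (λ i → s n * h k * w n k * ((r k * r k) ^ suc i * (r n * r n) ^ (c ℕ.∸ i))) c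
        ≡⟨ Σ₀-* (s n * h k * w n k) (λ i → (r k * r k) ^ suc i * (r n * r n) ^ (c ℕ.∸ i)) c ⟩
      s n * h k * w n k * geometric (r k * r k) (r n * r n) c
        ≡⟨ ℚ.*-assoc (s n * h k) (w n k) (geometric (r k * r k) (r n * r n) c) ⟩
      s n * h k * (w n k * geometric (r k * r k) (r n * r n) c) ∎

  odd-exponent : ∀ i → 2 ℕ.* (2 ℕ.+ i) ℕ.∸ 1 ≡ 2 ℕ.* suc i ℕ.+ 1
  odd-exponent i = trans (ℕ.+-suc (suc i) (suc i ℕ.+ 0)) (ℕ.+-comm 1 (2 ℕ.* suc i))

  even-coexponent : ∀ c i → 2 ℕ.* suc c ℕ.+ 2 ℕ.∸ 2 ℕ.* (2 ℕ.+ i) ≡ 2 ℕ.* (c ℕ.∸ i)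
  even-coexponent c i = trans
    (cong (ℕ._∸ 2 ℕ.* (2 ℕ.+ i)) (trans (ℕ.+-comm (2 ℕ.* suc c) 2) (sym (ℕ.*-suc 2 (suc c)))))
    (sym (ℕ.*-distribˡ-∸ 2 (2 ℕ.+ c) (2 ℕ.+ i)))

  odd-coexponent : ∀ {c i} → i ℕ.< c → 2 ℕ.* suc c ℕ.+ 1 ℕ.∸ 2 ℕ.* suc i ≡ 2 ℕ.* (c ℕ.∸ i) ℕ.+ 1
  odd-coexponent {c} {i} i<c = trans (ℕ.+-∸-comm 1 (ℕ.*-monoʳ-≤ 2 (s≤s (ℕ.<⇒≤ i<c))))
    (cong (ℕ._+ 1) (sym (ℕ.*-distribˡ-∸ 2 (suc c) (suc i))))

  1≤m+1 : ∀ m → 1 ℕ.≤ m ℕ.+ 1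
  1≤m+1 m = ℕ.m≤n+m 1 m

  2≤2*suc : ∀ m → 2 ℕ.≤ 2 ℕ.* suc m
  2≤2*suc m = ℕ.*-monoʳ-≤ 2 (s≤s z≤n)

  -- Counted from i = 0, the summands have l = 2 + i, so the arguments are 2(i + 1) + 1 and 2(c -
  -- i): the exponents in `geometric` of squares, with an additional factor `r k`.
  seq-odd-sum : ∀ c N →
    seq (∑ᵣ 2 (suc c) (λ i → ζ⋆ (plain (2 ℕ.* i ℕ.∸ 1) ∷ plain 1 ∷ []) *ᵣ ζ̄ (2 ℕ.* suc c ℕ.+ 2 ℕ.∸ 2 ℕ.* i))) N ≡
    Σ (λ n → Σ (λ k → s n * h k * (r k * geometric (r k * r k) (r n * r n) c)) N) N
  seq-odd-sum c N = trans
    (seq-foldr (λ i → ζ⋆ (plain (2 ℕ.* i ℕ.∸ 1) ∷ plain 1 ∷ []) *ᵣ ζ̄ (2 ℕ.* suc c ℕ.+ 2 ℕ.∸ 2 ℕ.* i)) (2 ℕ.+_) c N)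
    (trans
      (Σ₀-cong c λ i i<c → cong₂ _*_
        (seq-ζ⋆-plain-1 (2 ℕ.* (2 ℕ.+ i) ℕ.∸ 1) (λ k → r k * (r k * r k) ^ suc i)
          (subst (2 ℕ.≤_) (sym (odd-exponent i)) (ℕ.≤-trans (2≤2*suc i) (ℕ.m≤m+n (2 ℕ.* suc i) 1)))
          (λ k → trans (cong (r k ^_) (odd-exponent i)) (^-odd (r k) (suc i))) N)
        (seq-ζ̄ (2 ℕ.* suc c ℕ.+ 2 ℕ.∸ 2 ℕ.* (2 ℕ.+ i)) (λ n → (r n * r n) ^ (c ℕ.∸ i))
          (subst (1 ℕ.≤_) (sym (even-coexponent c i)) (ℕ.*-mono-≤ (s≤s (z≤n {1})) (ℕ.m<n⇒0<n∸m i<c)))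
          (λ n → trans (cong (r n ^_) (even-coexponent c i)) (^-even (r n) (c ℕ.∸ i))) N))
      (Σ₀-products c N (λ i k → r k * (r k * r k) ^ suc i) (λ i n → (r n * r n) ^ (c ℕ.∸ i)) (λ _ k → r k)
        (λ i n k → solve 3 (λ q x p → q :* (x :* p) := x :* (p :* q)) refl
          ((r n * r n) ^ (c ℕ.∸ i)) (r k) ((r k * r k) ^ suc i))))

  seq-even-sum : ∀ c N →
    seq (∑ᵣ 1 c (λ i → ζ⋆ (plain (2 ℕ.* i) ∷ plain 1 ∷ []) *ᵣ ζ̄ (2 ℕ.* suc c ℕ.+ 1 ℕ.∸ 2 ℕ.* i))) N ≡
    Σ (λ n → Σ (λ k → s n * h k * (r n * geometric (r k * r k) (r n * r n) c)) N) N
  seq-even-sum c N = trans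
    (seq-foldr (λ i → ζ⋆ (plain (2 ℕ.* i) ∷ plain 1 ∷ []) *ᵣ ζ̄ (2 ℕ.* suc c ℕ.+ 1 ℕ.∸ 2 ℕ.* i)) (1 ℕ.+_) c N)
    (trans
      (Σ₀-cong c λ i i<c → cong₂ _*_
        (seq-ζ⋆-plain-1 (2 ℕ.* suc i) (λ k → (r k * r k) ^ suc i) (2≤2*suc i) (λ k → ^-even (r k) (suc i)) N)
        (seq-ζ̄ (2 ℕ.* suc c ℕ.+ 1 ℕ.∸ 2 ℕ.* suc i) (λ n → r n * (r n * r n) ^ (c ℕ.∸ i))
          (subst (1 ℕ.≤_) (sym (odd-coexponent i<c)) (1≤m+1 (2 ℕ.* (c ℕ.∸ i))))
          (λ n → trans (cong (r n ^_) (odd-coexponent i<c)) (^-odd (r n) (c ℕ.∸ i))) N))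
      (Σ₀-products c N (λ i k → (r k * r k) ^ suc i) (λ i n → r n * (r n * r n) ^ (c ℕ.∸ i)) (λ n _ → r n)
        (λ i n k → solve 3 (λ q x p → x :* q :* p := x :* (p :* q)) refl
          ((r n * r n) ^ (c ℕ.∸ i)) (r n) ((r k * r k) ^ suc i))))

  -- Assembling the values

  coefficient-2m+1 : ∀ m → (ℤ.+ (2 ℕ.* m ℕ.+ 1)) / 1 ≡ fromℕ m + fromℕ m + 1ℚ
  coefficient-2m+1 m = trans (fromℕ-+ (2 ℕ.* m) 1)
    (cong (_+ 1ℚ) (trans (cong (λ i → fromℕ (m ℕ.+ i)) (ℕ.+-identityʳ m)) (fromℕ-+ m m)))

  coefficient-[2m-1]/2 : ∀ c → (ℤ.+ (2 ℕ.* suc c ℕ.∸ 1)) / 2 ≡ fromℕ (suc c) - ½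
  coefficient-[2m-1]/2 c = begin
    (ℤ.+ (c ℕ.+ suc (c ℕ.+ 0))) / 2      ≡⟨ /-split (ℤ.+ (c ℕ.+ suc (c ℕ.+ 0))) 2 ⟩
    fromℕ (c ℕ.+ suc (c ℕ.+ 0)) * ½      ≡⟨ cong (λ i → fromℕ (c ℕ.+ suc i) * ½) (ℕ.+-identityʳ c) ⟩
    fromℕ (c ℕ.+ suc c) * ½              ≡⟨ cong (_* ½) (trans (fromℕ-+ c (suc c)) (cong (_+_ (fromℕ c)) (fromℕ-suc c))) ⟩
    (fromℕ c + (1ℚ + fromℕ c)) * ½       ≡⟨ solve 1 (λ f → (f :+ (con 1ℚ :+ f)) :* con ½ := (con 1ℚ :+ f) :- con ½)
                                              refl (fromℕ c) ⟩
    (1ℚ + fromℕ c) - ½                   ≡⟨ cong (_- ½) (sym (fromℕ-suc c)) ⟩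
    fromℕ (suc c) - ½ ∎
    where open ≡-Reasoning

  -- Partial sum and approximation are first compared at the same index, where the difference is the
  -- null sequence; the Cauchy property of x then moves the approximation to an independent index.
  null⇒sumsTo : ∀ {f} x {e : ℕ → ℚ} → Null e → (∀ N → ∑ f N - seq x N ≡ e N) → f sumsTo x
  null⇒sumsTo {f} x {e} null-e eq ε 0<ε with null-e (½ * ε) (0<½* 0<ε) | cauchy x (½ * ε) (0<½* 0<ε)
  ... | N , p | M , q = N ℕ.+ M , λ n k hn hk → subst (∣ ∑ f n - seq x k ∣ <_) (halves ε)
    (ℚ.≤-<-trans (triangle (∑ f n) (seq x n) (seq x k)) (ℚ.+-mono-<
      (subst (λ z → ∣ z ∣ < ½ * ε) (sym (eq n)) (p n (ℕ.m+n≤o⇒m≤o N hn)))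
      (q n k (ℕ.m+n≤o⇒n≤o N hn) (ℕ.m+n≤o⇒n≤o N hk))))

  -- The approximations of the constants are variables tied by equations, so that matching on `refl`
  -- leaves a polynomial identity for the solver.
  odd-assembly : ∀ c N {F z₁ m₂ z₂ z₃ z₄ z₅ S} →
    F ≡ Σ (λ n → h n * h n * (s n * X c n)) N →
    z₁ ≡ - Σ (λ n → s n * X c n * h₂ n) N →
    m₂ ≡ fromℕ (suc c) + fromℕ (suc c) + 1ℚ →
    z₂ ≡ - Σ (λ n → s n * (r n * X c n) * h n) N →
    z₃ ≡ Σ (λ n → r n * X c n * h n) N →
    z₄ ≡ h₂ N → z₅ ≡ Σ (λ n → s n * X c n) N →
    S ≡ Σ (λ n → Σ (λ k → s n * h k * (r k * geometric (r k * r k) (r n * r n) c)) N) N →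
    F - (- z₁ - m₂ * z₂ - z₃ - z₄ * z₅ - two * S) ≡ Σ (odd-error c N) N
  odd-assembly c N {S = S} eq refl refl refl refl refl refl refl =
    trans (cong (_- _) (trans eq (odd-identity c N)))
      (solve 8 (λ a m b z g y S e →
        (con 1ℚ :* a :+ (m :+ m :+ con 1ℚ) :* b :+ (:- con 1ℚ) :* z) :+
        ((:- g) :* y :+ (:- (con 1ℚ :+ con 1ℚ)) :* S :+ con 1ℚ :* e)
        :- ((:- (:- a)) :- (m :+ m :+ con 1ℚ) :* (:- b) :- z :- g :* y :- (con 1ℚ :+ con 1ℚ) :* S)
        := e) refl
        (Σ (λ n → s n * X c n * h₂ n) N) (fromℕ (suc c)) (Σ (λ n → s n * (r n * X c n) * h n) N)
        (Σ (λ n → r n * X c n * h n) N) (h₂ N) (Σ (λ n → s n * X c n) N) S (Σ (odd-error c N) N))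

  -- Besides the tails it contains the cost of replacing `l N` by the approximation `l (N + N)` of
  -- `ln2` in its two occurrences.
  even-remainder : ℕ → ℕ → ℚ
  even-remainder c N = Σ (even-error c N) N +
    ((- 1ℚ) * ((l (N ℕ.+ N) - l N) * Σ (λ n → s n * X c n * h n) N) +
     (- 1ℚ) * ((l (N ℕ.+ N) - l N) * Σ (λ n → X c n * h n) N))

  null-even-remainder : ∀ c → Null (even-remainder c)
  null-even-remainder c = null-+ {λ N → Σ (even-error c N) N} (null-even-error c)
    (null-+ {λ N → (- 1ℚ) * g₁ N} {λ N → (- 1ℚ) * g₂ N}
      (null-scale (- 1ℚ) {g₁} (null-l-gap* c (λ n → s n * X c n * h n) λ n → ℚ.≤-reflexive
        (trans (cong ∣_∣ (ℚ.*-assoc (s n) (X c n) (h n))) (trans (∣s*∣ n (X c n * h n)) (0≤⇒∣∣ (0≤Xh n))))))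
      (null-scale (- 1ℚ) {g₂} (null-l-gap* c (λ n → X c n * h n) λ n → ℚ.≤-reflexive (0≤⇒∣∣ (0≤Xh n)))))
    where
    g₁ g₂ : ℕ → ℚ
    g₁ N = (l (N ℕ.+ N) - l N) * Σ (λ n → s n * X c n * h n) N
    g₂ N = (l (N ℕ.+ N) - l N) * Σ (λ n → X c n * h n) N
    0≤Xh : ∀ n → 0ℚ ≤ X c n * h n
    0≤Xh n = 0≤* (0≤X c n) (0≤h n)

  even-assembly : ∀ c N {F S λ₂ z₁ z₂ z₃ z₄ m₅ z₅ z₆ z₇} →
    F ≡ Σ (λ n → h n * l n * (s n * X c n)) N →
    S ≡ Σ (λ n → Σ (λ k → s n * h k * (r n * geometric (r k * r k) (r n * r n) c)) N) N →
    λ₂ ≡ l (N ℕ.+ N) →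
    z₁ ≡ - Σ (λ n → s n * X c n * h n) N →
    z₂ ≡ Σ (λ n → X c n * h n) N →
    z₃ ≡ Σ (λ n → r n * X c n * h n) N →
    z₄ ≡ - Σ (λ n → s n * X c n * h₂ n) N →
    m₅ ≡ fromℕ (suc c) - ½ →
    z₅ ≡ - Σ (λ n → s n * (r n * X c n) * h n) N →
    z₆ ≡ h₂ N → z₇ ≡ Σ (λ n → s n * X c n) N →
    F - (S - λ₂ * z₁ + λ₂ * z₂ + ½ * z₃ + z₄ + m₅ * z₅ - ½ * z₆ * z₇) ≡ even-remainder c N
  even-assembly c N {S = S} eq refl refl refl refl refl refl refl refl refl refl =
    trans (cong (_- _) (trans eq (even-identity c N)))
      (solve 12 (λ S k k₂ u v z a m b g y e →
        ((con 1ℚ :* S :+ k :* u :+ k :* v) :+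
         (con ½ :* z :+ (:- con 1ℚ) :* a :+ (:- (m :- con ½)) :* b) :+
         ((:- (con ½ :* g)) :* y :+ e))
        :- (S :- k₂ :* (:- u) :+ k₂ :* v :+ con ½ :* z :+ (:- a) :+ (m :- con ½) :* (:- b) :- con ½ :* g :* y)
        := e :+ ((:- con 1ℚ) :* ((k₂ :- k) :* u) :+ (:- con 1ℚ) :* ((k₂ :- k) :* v))) refl
        S (l N) (l (N ℕ.+ N)) (Σ (λ n → s n * X c n * h n) N) (Σ (λ n → X c n * h n) N)
        (Σ (λ n → r n * X c n * h n) N) (Σ (λ n → s n * X c n * h₂ n) N) (fromℕ (suc c))
        (Σ (λ n → s n * (r n * X c n) * h n) N) (h₂ N) (Σ (λ n → s n * X c n) N) (Σ (even-error c N) N))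

open import Data.Nat using (ℕ; suc; z≤n; s≤s; _+_; _*_; _∸_; _≤_)
import Data.Nat.Properties as ℕ
open import Data.Integer using (+_)
open import Data.Rational using (ℚ; ½; _/_) renaming (_*_ to _*ℚ_)
open import Data.List using ([]; _∷_)
open import Data.Product using (_×_; _,_)
open import Relation.Binary.PropositionalEquality using (_≡_; trans; cong; cong₂)
open EulerSums

square-value mixed-value : ℕ → ℝ
square-value m =
  -ᵣ ζ⋆ (bar (2 * m) ∷ plain 2 ∷ [])
  -ᵣ ι (+ (2 * m + 1) / 1) *ᵣ ζ⋆ (bar (2 * m + 1) ∷ plain 1 ∷ [])
  -ᵣ ζ⋆ (plain (2 * m + 1) ∷ plain 1 ∷ [])
  -ᵣ ζ 2 *ᵣ ζ̄ (2 * m)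
  -ᵣ ι (+ 2 / 1) *ᵣ ∑ᵣ 2 m (λ l → ζ⋆ (plain (2 * l ∸ 1) ∷ plain 1 ∷ []) *ᵣ ζ̄ (2 * m + 2 ∸ 2 * l))
mixed-value m =
  ∑ᵣ 1 (m ∸ 1) (λ l → ζ⋆ (plain (2 * l) ∷ plain 1 ∷ []) *ᵣ ζ̄ (2 * m + 1 ∸ 2 * l))
  -ᵣ ln2 *ᵣ ζ⋆ (bar (2 * m) ∷ plain 1 ∷ [])
  +ᵣ ln2 *ᵣ ζ⋆ (plain (2 * m) ∷ plain 1 ∷ [])
  +ᵣ ι ½ *ᵣ ζ⋆ (plain (2 * m + 1) ∷ plain 1 ∷ [])
  +ᵣ ζ⋆ (bar (2 * m) ∷ plain 2 ∷ [])
  +ᵣ ι (+ (2 * m ∸ 1) / 2) *ᵣ ζ⋆ (bar (2 * m + 1) ∷ plain 1 ∷ [])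
  -ᵣ ι ½ *ᵣ ζ 2 *ᵣ ζ̄ (2 * m)

theorem3p1 : ∀ (m : ℕ) → 1 ≤ m →
  ( (λ n → H n *ℚ H n *ℚ alt (2 * m) n)
      sumsTo
        -ᵣ ζ⋆ (bar (2 * m) ∷ plain 2 ∷ [])
        -ᵣ ι (+ (2 * m + 1) / 1) *ᵣ ζ⋆ (bar (2 * m + 1) ∷ plain 1 ∷ [])
        -ᵣ ζ⋆ (plain (2 * m + 1) ∷ plain 1 ∷ [])
        -ᵣ ζ 2 *ᵣ ζ̄ (2 * m)
        -ᵣ ι (+ 2 / 1) *ᵣ ∑ᵣ 2 m (λ l → ζ⋆ (plain (2 * l ∸ 1) ∷ plain 1 ∷ []) *ᵣ ζ̄ (2 * m + 2 ∸ 2 * l)) )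
  ×
  ( (λ n → H n *ℚ L 1 n *ℚ alt (2 * m) n)
      sumsTo
        ∑ᵣ 1 (m ∸ 1) (λ l → ζ⋆ (plain (2 * l) ∷ plain 1 ∷ []) *ᵣ ζ̄ (2 * m + 1 ∸ 2 * l))
        -ᵣ ln2 *ᵣ ζ⋆ (bar (2 * m) ∷ plain 1 ∷ [])
        +ᵣ ln2 *ᵣ ζ⋆ (plain (2 * m) ∷ plain 1 ∷ [])
        +ᵣ ι ½ *ᵣ ζ⋆ (plain (2 * m + 1) ∷ plain 1 ∷ [])
        +ᵣ ζ⋆ (bar (2 * m) ∷ plain 2 ∷ [])
        +ᵣ ι (+ (2 * m ∸ 1) / 2) *ᵣ ζ⋆ (bar (2 * m + 1) ∷ plain 1 ∷ [])
        -ᵣ ι ½ *ᵣ ζ 2 *ᵣ ζ̄ (2 * m) )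
-- With m = c + 1, c is the number of products in the finite sum of either formula, hence the length
-- of the geometric sums.
theorem3p1 (suc c) _ =
  null⇒sumsTo (square-value (suc c)) (null-odd-error c) (λ N → odd-assembly c N
    (∑≡Σ (λ n → cong₂ _*ℚ_ (cong₂ _*ℚ_ (H≡h (suc n)) (H≡h (suc n))) (alt-2m n)) N)
    (seq-ζ⋆-bar-2 2m (X c) 1≤2m r^2m N)
    (coefficient-2m+1 (suc c))
    (seq-ζ⋆-bar-1 2m+1 r*X 1≤2m+1 r^[2m+1] N)
    (seq-ζ⋆-plain-1 2m+1 r*X 2≤2m+1 r^[2m+1] N)
    (seq-ζ2 N)
    (seq-ζ̄ 2m (X c) 1≤2m r^2m N)
    (seq-odd-sum c N)) ,
  null⇒sumsTo (mixed-value (suc c)) (null-even-remainder c) (λ N → even-assembly c N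
    (∑≡Σ (λ n → cong₂ _*ℚ_ (cong₂ _*ℚ_ (H≡h (suc n)) (L₁≡l (suc n))) (alt-2m n)) N)
    (seq-even-sum c N)
    (seq-ln2 N)
    (seq-ζ⋆-bar-1 2m (X c) 1≤2m r^2m N)
    (seq-ζ⋆-plain-1 2m (X c) (2≤2*suc c) r^2m N)
    (seq-ζ⋆-plain-1 2m+1 r*X 2≤2m+1 r^[2m+1] N)
    (seq-ζ⋆-bar-2 2m (X c) 1≤2m r^2m N)
    (coefficient-[2m-1]/2 c)
    (seq-ζ⋆-bar-1 2m+1 r*X 1≤2m+1 r^[2m+1] N)
    (seq-ζ2 N)
    (seq-ζ̄ 2m (X c) 1≤2m r^2m N))
  where
  2m 2m+1 : ℕ
  2m = 2 * suc c
  2m+1 = 2m + 1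
  r*X : ℕ → ℚ
  r*X n = r n *ℚ X c n
  r^2m : ∀ n → r n ^ 2m ≡ X c n
  r^2m n = ^-even (r n) (suc c)
  r^[2m+1] : ∀ n → r n ^ 2m+1 ≡ r*X n
  r^[2m+1] n = ^-odd (r n) (suc c)
  alt-2m : ∀ n → alt 2m (suc n) ≡ s (suc n) *ℚ X c (suc n)
  alt-2m n = trans (alt-≡ 2m n) (cong (s (suc n) *ℚ_) (r^2m (suc n)))
  1≤2m : 1 ≤ 2m
  1≤2m = s≤s z≤n
  1≤2m+1 : 1 ≤ 2m+1
  1≤2m+1 = s≤s z≤n
  2≤2m+1 : 2 ≤ 2m+1
  2≤2m+1 = ℕ.≤-trans (2≤2*suc c) (ℕ.m≤m+n 2m 1)
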